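{- Let $\mathbb{F}$ be a field and let $V=\mathbb{F}^2\otimes\mathbb{F}^2\otimes\mathbb{F}^3$. Let $G$ be the setwise stabiliser in $\mathrm{GL}(V)$ of the set of fundamental (rank one) tensors of $V$, and let $H$ be the subgroup of $G$ induced by $\mathrm{GL}(\mathbb{F}^2)\times\mathrm{GL}(\mathbb{F}^2)\times\mathrm{GL}(\mathbb{F}^3)$. (1) If $\mathbb{F}$ is a finite field or $\mathbb{F}=\mathbb{R}$, then there are precisely $10$ $H$-orbits and precisely $9$ $G$-orbits of tensors in $V$. (2) If $\mathbb{F}$ is an algebraically closed field, then there are precisely $9$ $H$-orbits and precisely $8$ $G$-orbits of tensors in $V$.
   Context: All tensor products are over $\mathbb{F}$. The fundamental tensors (rank one tensors) of $V=V_1\otimes V_2\otimes V_3$ are the tensors $v_1\otimes v_2\otimes v_3$ with each $v_i\in V_i\setminus\{0\}$. The group $\mathrm{GL}(V_1)\times\mathrm{GL}(V_2)\times\mathrm{GL}(V_3)$ acts linearly on $V$ by $(g_1,g_2,g_3): v_1\otimes v_2\otimes v_3\mapsto v_1^{g_1}\otimes v_2^{g_2}\otimes v_3^{g_3}$, and $H$ denotes the resulting subgroup of $\mathrm{GL}(V)$. The orbits counted are the orbits on all elements of $V$; the orbit $\{0\}$ of the zero tensor is included in the count. -}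

module Defs where

open import Level using (Level; _⊔_; suc)
open import Algebra.Bundles using (CommutativeRing; AbelianGroup)
open import Algebra.Module.Bundles using (LeftModule)
open import Algebra.Module.Morphism.Structures using (module LeftModuleMorphisms)
import Algebra.Module.Morphism.Construct.Identity as Identity
import Algebra.Module.Morphism.Construct.Composition as Composition
import Algebra.Construct.Pointwise as Pointwise
import Algebra.Properties.Monoid.Sum as Sum
import Algebra.Properties.Semiring.Exp as Exp
open import Data.Fin.Base using (Fin; toℕ; fromℕ)
open import Data.Nat.Base as ℕ using (ℕ)
open import Data.Product.Base using (∃; ∃-syntax; _×_; _,_; proj₁; proj₂)
open import Function.Base using (_∘_; id)
open import Function.Bundles using (Bijection; _⇔_; mk⇔; Equivalence)
open import Relation.Binary.Bundles using (Setoid)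
open import Relation.Binary.Core using (Rel)
open import Relation.Binary.Structures using (IsTotalOrder)
import Relation.Binary.PropositionalEquality.Properties as ≡
open import Relation.Unary using (Pred; _∈_; _⊆_)

-- The cardinality of the quotient set that the setoid represents.
HasCardinality : ∀ {a ℓ} → Setoid a ℓ → ℕ → Set (a ⊔ ℓ)
HasCardinality S n = Bijection (≡.setoid (Fin n)) S

record Field (c ℓ : Level) : Set (suc (c ⊔ ℓ)) where
  field
    commutativeRing : CommutativeRing c ℓ

  open CommutativeRing commutativeRing public

  field
    1≉0     : 1# ≉ 0#
    inverse : ∀ x → x ≉ 0# → ∃[ y ] x * y ≈ 1#

IsFiniteField : ∀ {c ℓ} → Field c ℓ → Set (c ⊔ ℓ)
IsFiniteField F = ∃[ q ] HasCardinality (Field.setoid F) q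

-- Every polynomial a₀ + a₁ x + … + a_d x^d with d ≥ 1 and a_d ≠ 0 has a root.
IsAlgebraicallyClosed : ∀ {c ℓ} → Field c ℓ → Set (c ⊔ ℓ)
IsAlgebraicallyClosed F =
  ∀ (d : ℕ) → 1 ℕ.≤ d →
  ∀ (a : Fin (ℕ.suc d) → Carrier) → a (fromℕ d) ≉ 0# →
  ∃[ x ] sum (λ i → a i * x ^ toℕ i) ≈ 0#
  where
  open Field F
  open Sum +-monoid using (sum)
  open Exp semiring using (_^_)

-- ℝ is specified as the Dedekind-complete ordered field, which in classical
-- mathematics determines it up to a unique isomorphism.
record IsRealField {c ℓ} (F : Field c ℓ) (o : Level) : Set (c ⊔ ℓ ⊔ suc o) where
  open Field F

  field
    _≤_          : Rel Carrier o
    isTotalOrder : IsTotalOrder _≈_ _≤_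
    +-monoˡ-≤    : ∀ z {x y} → x ≤ y → (x + z) ≤ (y + z)
    *-nonNeg     : ∀ {x y} → 0# ≤ x → 0# ≤ y → 0# ≤ (x * y)

  IsUpperBound : Pred Carrier o → Pred Carrier (c ⊔ o)
  IsUpperBound P b = ∀ {x} → x ∈ P → x ≤ b

  field
    complete : ∀ (P : Pred Carrier o) → ∃[ x ] x ∈ P → ∃[ b ] b ∈ IsUpperBound P →
               ∃[ s ] (s ∈ IsUpperBound P × (∀ {b} → b ∈ IsUpperBound P → s ≤ b))

module _ {c ℓ} (F : Field c ℓ) where
  open Field F

  infix 8 _^ᴹ_

  _^ᴹ_ : Set → LeftModule ring c ℓ
  _^ᴹ_ I = record
    { Carrierᴹ = I → Carrier
    ; _≈ᴹ_ = AbelianGroup._≈_ +ᴵ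
    ; _+ᴹ_ = AbelianGroup._∙_ +ᴵ
    ; _*ₗ_ = λ r x i → r * x i
    ; 0ᴹ   = AbelianGroup.ε +ᴵ
    ; -ᴹ_  = AbelianGroup._⁻¹ +ᴵ
    ; isLeftModule = record
      { isLeftSemimodule = record
        { +ᴹ-isCommutativeMonoid = AbelianGroup.isCommutativeMonoid +ᴵ
        ; isPreleftSemimodule = record
          { *ₗ-cong      = λ r≈s x≈y i → *-cong r≈s (x≈y i)
          ; *ₗ-zeroˡ     = λ x i → zeroˡ (x i)
          ; *ₗ-distribʳ  = λ x r s i → distribʳ (x i) r s
          ; *ₗ-identityˡ = λ x i → *-identityˡ (x i)
          ; *ₗ-assoc     = λ r s x i → *-assoc r s (x i)
          ; *ₗ-zeroʳ     = λ r i → zeroʳ r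
          ; *ₗ-distribˡ  = λ r x y i → distribˡ r (x i) (y i)
          }
        }
      ; -ᴹ‿cong    = AbelianGroup.⁻¹-cong +ᴵ
      ; -ᴹ‿inverse = AbelianGroup.inverse +ᴵ
      }
    }
    where
    +ᴵ : AbelianGroup c ℓ
    +ᴵ = Pointwise.abelianGroup I +-abelianGroup

module GeneralLinear {c ℓ} {F : Field c ℓ} {m ℓm} (M : LeftModule (Field.ring F) m ℓm) where
  open LeftModule M
  open LeftModuleMorphisms rawLeftModule rawLeftModule using (IsLeftModuleIsomorphism)

  record GL : Set (c ⊔ m ⊔ ℓm) where
    constructor mkGL
    field
      ⟦_⟧                     : Carrierᴹ → Carrierᴹ
      isLeftModuleIsomorphism : IsLeftModuleIsomorphism ⟦_⟧

    open IsLeftModuleIsomorphism isLeftModuleIsomorphism public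

    _⁻¹⟦_⟧ : Carrierᴹ → Carrierᴹ
    _⁻¹⟦_⟧ y = proj₁ (surjective y)

    inverseˡ : ∀ y → ⟦ _⁻¹⟦_⟧ y ⟧ ≈ᴹ y
    inverseˡ y = proj₂ (surjective y) ≈ᴹ-refl

    inverseʳ : ∀ x → _⁻¹⟦_⟧ ⟦ x ⟧ ≈ᴹ x
    inverseʳ x = injective (inverseˡ ⟦ x ⟧)

  open GL

  idᴳ : GL
  idᴳ = mkGL id (Identity.isLeftModuleIsomorphism rawLeftModule ≈ᴹ-refl)

  _∘ᴳ_ : GL → GL → GL
  g ∘ᴳ f = mkGL (⟦ g ⟧ ∘ ⟦ f ⟧)
    (Composition.isLeftModuleIsomorphism ≈ᴹ-trans
      (isLeftModuleIsomorphism f) (isLeftModuleIsomorphism g))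

  _⁻¹ᴳ : GL → GL
  g ⁻¹ᴳ = mkGL (g ⁻¹⟦_⟧) record
    { isLeftModuleMonomorphism = record
      { isLeftModuleHomomorphism = record
        { +ᴹ-isGroupHomomorphism = record
          { isMonoidHomomorphism = record
            { isMagmaHomomorphism = record
              { isRelHomomorphism = record { cong = cong }
              ; homo = λ x y → pull (≈ᴹ-trans (+ᴹ-homo g _ _)
                                      (+ᴹ-cong (inverseˡ g x) (inverseˡ g y)))
              }
            ; ε-homo = pull (0ᴹ-homo g)
            }
          ; ⁻¹-homo = λ x → pull (≈ᴹ-trans (-ᴹ-homo g _) (-ᴹ‿cong (inverseˡ g x)))
          }
        ; *ₗ-homo = λ r x → pull (≈ᴹ-trans (*ₗ-homo g r _) (*ₗ-congˡ (inverseˡ g x)))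
        }
      ; injective = λ {x} {y} eq → ≈ᴹ-trans (≈ᴹ-sym (inverseˡ g x))
                      (≈ᴹ-trans (⟦⟧-cong g eq) (inverseˡ g y))
      }
    ; surjective = λ x → ⟦ g ⟧ x , λ z≈gx → ≈ᴹ-trans (cong z≈gx) (inverseʳ g x)
    }
    where
    pull : ∀ {x y} → ⟦ g ⟧ x ≈ᴹ y → g ⁻¹⟦ y ⟧ ≈ᴹ x
    pull {x} {y} gx≈y = injective g (≈ᴹ-trans (inverseˡ g y) (≈ᴹ-sym gx≈y))

    cong : ∀ {x y} → x ≈ᴹ y → g ⁻¹⟦ x ⟧ ≈ᴹ g ⁻¹⟦ y ⟧
    cong {x} {y} x≈y = pull (≈ᴹ-trans (inverseˡ g y) (≈ᴹ-sym x≈y))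

  record Subgroup (k : Level) : Set (c ⊔ m ⊔ ℓm ⊔ suc k) where
    field
      Member     : Pred GL k
      id-closed  : idᴳ ∈ Member
      ∘-closed   : ∀ {g f} → g ∈ Member → f ∈ Member → (g ∘ᴳ f) ∈ Member
      ⁻¹-closed  : ∀ {g} → g ∈ Member → (g ⁻¹ᴳ) ∈ Member

    orbits : Setoid m (c ⊔ m ⊔ ℓm ⊔ k)
    orbits = record
      { Carrier = Carrierᴹ
      ; _≈_ = λ x y → ∃[ g ] (g ∈ Member × ⟦ g ⟧ x ≈ᴹ y)
      ; isEquivalence = record
        { refl  = idᴳ , id-closed , ≈ᴹ-refl
        ; sym   = λ { {x} (g , g∈K , gx≈y) → g ⁻¹ᴳ , ⁻¹-closed g∈K ,
                    ≈ᴹ-trans (⟦⟧-cong (g ⁻¹ᴳ) (≈ᴹ-sym gx≈y)) (inverseʳ g x) }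
        ; trans = λ { (f , f∈K , fx≈y) (g , g∈K , gy≈z) → g ∘ᴳ f , ∘-closed g∈K f∈K ,
                    ≈ᴹ-trans (⟦⟧-cong g fx≈y) gy≈z }
        }
      }

-- 𝔽^l ⊗ 𝔽^m ⊗ 𝔽^n in coordinates: a tensor t is the family of its coefficients
-- t (i , j , k) with respect to the basis e_i ⊗ e_j ⊗ e_k.
module Tensors {c ℓ} (F : Field c ℓ) (l m n : ℕ) where
  open Field F

  V₁ V₂ V₃ V : LeftModule ring c ℓ
  V₁ = F ^ᴹ Fin l
  V₂ = F ^ᴹ Fin m
  V₃ = F ^ᴹ Fin n
  V  = F ^ᴹ (Fin l × Fin m × Fin n)

  module V₁ = LeftModule V₁
  module V₂ = LeftModule V₂
  module V₃ = LeftModule V₃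
  module V  = LeftModule V

  module GL₁ = GeneralLinear {F = F} V₁
  module GL₂ = GeneralLinear {F = F} V₂
  module GL₃ = GeneralLinear {F = F} V₃
  open GeneralLinear {F = F} V
  open GL

  pure : V₁.Carrierᴹ → V₂.Carrierᴹ → V₃.Carrierᴹ → V.Carrierᴹ
  pure v₁ v₂ v₃ (i , j , k) = v₁ i * v₂ j * v₃ k

  pure-cong : ∀ {u₁ v₁ u₂ v₂ u₃ v₃} → u₁ V₁.≈ᴹ v₁ → u₂ V₂.≈ᴹ v₂ → u₃ V₃.≈ᴹ v₃ →
              pure u₁ u₂ u₃ V.≈ᴹ pure v₁ v₂ v₃
  pure-cong e₁ e₂ e₃ (i , j , k) = *-cong (*-cong (e₁ i) (e₂ j)) (e₃ k)

  Fundamental : Pred V.Carrierᴹ (c ⊔ ℓ)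
  Fundamental t = ∃[ v₁ ] ∃[ v₂ ] ∃[ v₃ ]
    (v₁ V₁.≉ᴹ V₁.0ᴹ × v₂ V₂.≉ᴹ V₂.0ᴹ × v₃ V₃.≉ᴹ V₃.0ᴹ × t V.≈ᴹ pure v₁ v₂ v₃)

  Fundamental-resp : ∀ {s t} → s V.≈ᴹ t → Fundamental s → Fundamental t
  Fundamental-resp s≈t (v₁ , v₂ , v₃ , ≉₁ , ≉₂ , ≉₃ , s≈v) =
    v₁ , v₂ , v₃ , ≉₁ , ≉₂ , ≉₃ , V.≈ᴹ-trans (V.≈ᴹ-sym s≈t) s≈v

  -- Since g is bijective, this says that g maps the set of fundamental tensors
  -- onto itself.
  G : Subgroup (c ⊔ ℓ)
  G = record
    { Member    = λ g → ∀ t → Fundamental t ⇔ Fundamental (⟦ g ⟧ t)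
    ; id-closed = λ t → mk⇔ id id
    ; ∘-closed  = λ {g} {f} g∈G f∈G t →
        mk⇔ (Equivalence.to (g∈G (⟦ f ⟧ t)) ∘ Equivalence.to (f∈G t))
            (Equivalence.from (f∈G t) ∘ Equivalence.from (g∈G (⟦ f ⟧ t)))
    ; ⁻¹-closed = λ {g} g∈G t →
        mk⇔ (Equivalence.from (g∈G (g ⁻¹⟦ t ⟧)) ∘ Fundamental-resp (V.≈ᴹ-sym (inverseˡ g t)))
            (Fundamental-resp (inverseˡ g t) ∘ Equivalence.to (g∈G (g ⁻¹⟦ t ⟧)))
    }

  Induces : GL₁.GL → GL₂.GL → GL₃.GL → GL → Set (c ⊔ ℓ)
  Induces g₁ g₂ g₃ g = ∀ v₁ v₂ v₃ →
    ⟦ g ⟧ (pure v₁ v₂ v₃) V.≈ᴹ pure (GL₁.GL.⟦ g₁ ⟧ v₁) (GL₂.GL.⟦ g₂ ⟧ v₂) (GL₃.GL.⟦ g₃ ⟧ v₃)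

  -- An element of GL(V) is determined by its values on pure tensors, so every
  -- triple (g₁ , g₂ , g₃) induces exactly one.
  H : Subgroup (c ⊔ ℓ)
  H = record
    { Member    = λ g → ∃[ g₁ ] ∃[ g₂ ] ∃[ g₃ ] Induces g₁ g₂ g₃ g
    ; id-closed = GL₁.idᴳ , GL₂.idᴳ , GL₃.idᴳ , λ _ _ _ → V.≈ᴹ-refl
    ; ∘-closed  = λ { {g} {f} (g₁ , g₂ , g₃ , g-ind) (f₁ , f₂ , f₃ , f-ind) →
        g₁ GL₁.∘ᴳ f₁ , g₂ GL₂.∘ᴳ f₂ , g₃ GL₃.∘ᴳ f₃ ,
        λ v₁ v₂ v₃ → V.≈ᴹ-trans (⟦⟧-cong g (f-ind v₁ v₂ v₃)) (g-ind _ _ _) }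
    ; ⁻¹-closed = λ { {g} (g₁ , g₂ , g₃ , g-ind) →
        g₁ GL₁.⁻¹ᴳ , g₂ GL₂.⁻¹ᴳ , g₃ GL₃.⁻¹ᴳ ,
        λ v₁ v₂ v₃ → injective g (V.≈ᴹ-trans (inverseˡ g _) (V.≈ᴹ-sym (V.≈ᴹ-trans (g-ind _ _ _)
          (pure-cong (GL₁.GL.inverseˡ g₁ v₁) (GL₂.GL.inverseˡ g₂ v₂) (GL₃.GL.inverseˡ g₃ v₃))))) }
    }

  H⊆G : Subgroup.Member H ⊆ Subgroup.Member G
  H⊆G {g} g∈H t = mk⇔ (preserves g g∈H)
    (Fundamental-resp (inverseʳ g t) ∘ preserves (g ⁻¹ᴳ) (Subgroup.⁻¹-closed H {g} g∈H))
    where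
    preserves : ∀ f → f ∈ Subgroup.Member H → ∀ {s} → Fundamental s → Fundamental (⟦ f ⟧ s)
    preserves f (f₁ , f₂ , f₃ , f-ind) (v₁ , v₂ , v₃ , ≉₁ , ≉₂ , ≉₃ , s≈v) =
      GL₁.GL.⟦ f₁ ⟧ v₁ , GL₂.GL.⟦ f₂ ⟧ v₂ , GL₃.GL.⟦ f₃ ⟧ v₃ ,
      (λ e → ≉₁ (GL₁.GL.injective f₁ (V₁.≈ᴹ-trans e (V₁.≈ᴹ-sym (GL₁.GL.0ᴹ-homo f₁))))) ,
      (λ e → ≉₂ (GL₂.GL.injective f₂ (V₂.≈ᴹ-trans e (V₂.≈ᴹ-sym (GL₂.GL.0ᴹ-homo f₂))))) ,
      (λ e → ≉₃ (GL₃.GL.injective f₃ (V₃.≈ᴹ-trans e (V₃.≈ᴹ-sym (GL₃.GL.0ᴹ-homo f₃))))) ,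
      V.≈ᴹ-trans (⟦⟧-cong f s≈v) (f-ind v₁ v₂ v₃)

  NumberOfOrbits : GeneralLinear.Subgroup {F = F} V (c ⊔ ℓ) → ℕ → Set (c ⊔ ℓ)
  NumberOfOrbits K N = HasCardinality (Subgroup.orbits K) N

{-# OPTIONS --safe #-}

-- A tensor t is a linear map T from ξ ∈ 𝔽³ to 2 × 2 matrices, T(ξ) = Σ ξₖ tₖ, so H-orbits
-- are the GL₂ × GL₂-orbits of the images of T.  Elimination brings every image that contains
-- a nonzero singular matrix to one of finitely many forms; the other ones are zero, a line
-- spanned by an invertible matrix, or the span of the identity and the companion matrix of an
-- irreducible quadratic polynomial.  The last kind is absent over algebraically closed fields.
-- Over ℝ and over finite fields all irreducible quadratics are related by affine
-- substitutions: over ℝ because positive elements are squares, over 𝔽_q by a pigeonhole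
-- argument on two maps 𝔽_q → 𝔽_q that together take no value more than twice.
--
-- An element of G permutes the subspaces u ⊗ v ⊗ 𝔽³, the only three-dimensional spaces of
-- pure tensors, and therefore has the form M ⊗ N, where M preserves singularity of 2 × 2
-- matrices.  Hence the dimension of the image of T and the shape of its singular locus
-- distinguish the G-orbits.  The only two H-orbits that G merges are those of the spaces
-- e₂ ⊗ 𝔽² and 𝔽² ⊗ e₂, which differ by the transposition of the first two factors.
module Submission where

open import Defs
open import Level using (Level; _⊔_; Lift; lift; lower)
open import Axiom.ExcludedMiddle using (ExcludedMiddle)
open import Algebra.Bundles using (CommutativeRing)
import Algebra.Properties.AbelianGroup as AbelianGroupProperties
import Algebra.Properties.CommutativeSemigroup as CommutativeSemigroupProperties
import Algebra.Properties.Ring as RingProperties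
import Algebra.Properties.Semiring.Mult.TCOptimised as Mult
open import Data.Bool.Base using (Bool; true; false; if_then_else_)
open import Data.Empty using (⊥; ⊥-elim)
open import Data.Fin.Base using (Fin; zero; suc; _<_; join; splitAt; punchIn; punchOut)
open import Data.Fin.Patterns
open import Data.Fin.Properties
  using (_≟_; _<?_; any?; pigeonhole; <-trans; <⇒≢; <⇒notInjective; join-splitAt; splitAt-join;
         punchIn-injective; punchIn-punchOut; punchInᵢ≢i; punchOut-injective)
open import Data.Integer.Base as ℤ using (ℤ; +_; -[1+_])
import Data.Integer.Properties as ℤ
open import Data.List.Base using (List; []; _∷_; null)
open import Data.Maybe.Base using (Maybe; just; nothing)
open import Data.Maybe.Properties using (just-injective)
open import Data.Nat.Base as ℕ using (ℕ; zero; suc; s≤s; z≤n)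
import Data.Nat.Properties as ℕ
open import Data.Product.Base using (∃; ∃-syntax; _×_; _,_; proj₁; proj₂)
open import Data.Sum.Base using (_⊎_; inj₁; inj₂; [_,_]′)
open import Data.Sum.Properties using (inj₁-injective; inj₂-injective)
open import Function.Base using (id; _∘_; case_of_)
open import Function.Bundles using (Bijection; Equivalence; mk⇔)
open import Relation.Binary.Bundles using (Setoid)
open import Relation.Binary.PropositionalEquality.Core as ≡ using (_≡_; _≢_)
open import Relation.Binary.Structures using (IsTotalOrder)
open import Relation.Nullary using (¬_; Dec; yes; no)
open import Relation.Nullary.Decidable
  using (map′; does; dec-true; dec-false; decidable-stable; ¬?; _×-dec_)

-- Ring identities

-- The formulas for quadratics have to work in characteristic two as well. Hence the normal form X²
-- + X - b with discriminant 1 + 4b, and the two maps of the pigeonhole argument are x ↦ x² + x and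
-- u ↦ b + (u² + u)(1 + 4b). The first yields the constants of reducible polynomials, the second,
-- for 1 + 2u ≠ 0, those that affine substitutions produce from X² + X - b; together they must fill
-- 𝔽_q. Elements of G are known only through their action on pure tensors. A sum of two pure tensors
-- is pure only if they agree, up to scalars, in two of the three factors. For tensors in the image
-- of u ⊗ v ⊗ 𝔽³ these are the first two: if the third factor were shared, three independent tensors
-- would lie in a copy of 𝔽². This is where the format 2 × 2 × 3 enters. Inequivalence is not
-- checked pair by pair. Excluded middle turns the invariants into a map `code` to the indices of
-- the representatives, which is constant on orbits and sends each representative to its own index.

module Normalisation where
  infixl 6 _:+_ _:-_
  infixl 7 _:*_
  infix  8 :-_

  data Expr : Set where
    con       : ℤ → Expr
    var       : ℕ → Expr
    _:+_ _:*_ : Expr → Expr → Expr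
    :-_       : Expr → Expr

  _:-_ : Expr → Expr → Expr
  x :- y = x :+ :- y

  :0 :1 : Expr
  :0 = con (+ 0)
  :1 = con (+ 1)

  #0 #1 #2 #3 #4 #5 #6 #7 #8 #9 #10 #11 #12 #13 #14 #15 #16 #17 #18 : Expr
  #0 = var 0
  #1 = var 1
  #2 = var 2
  #3 = var 3
  #4 = var 4
  #5 = var 5
  #6 = var 6
  #7 = var 7
  #8 = var 8
  #9 = var 9
  #10 = var 10
  #11 = var 11
  #12 = var 12
  #13 = var 13
  #14 = var 14
  #15 = var 15
  #16 = var 16
  #17 = var 17
  #18 = var 18
  Monomial Polynomial : Set
  Monomial   = List ℕ
  Polynomial = List (Monomial × ℤ)

  data Comparison (m n : Monomial) : Set where
    less greater : Comparison m n
    equal    : m ≡ n → Comparison m n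

  compare : ∀ m n → Comparison m n
  compare []      []      = equal ≡.refl
  compare []      (_ ∷ _) = greater
  compare (_ ∷ _) []      = less
  compare (i ∷ m) (j ∷ n) with i ℕ.<ᵇ j | j ℕ.<ᵇ i
  ... | true  | _     = less
  ... | false | true  = greater
  ... | false | false with i ℕ.≟ j | compare m n
  ...   | yes ≡.refl | less        = less
  ...   | yes ≡.refl | greater        = greater
  ...   | yes ≡.refl | equal ≡.refl = equal ≡.refl
  -- An unreachable case with a default answer; `merge` is sound whatever `compare` decides between
  -- distinct monomials.
  ...   | no _       | _         = less

  _·ᴹ_ : Monomial → Monomial → Monomial
  []      ·ᴹ n       = n
  (i ∷ m) ·ᴹ []      = i ∷ m
  (i ∷ m) ·ᴹ (j ∷ n) = if i ℕ.<ᵇ j then i ∷ (m ·ᴹ (j ∷ n)) else j ∷ ((i ∷ m) ·ᴹ n)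

  -- Zero coefficients are dropped so that the zero polynomial is recognised as `[]`.
  consᴾ : Monomial → ℤ → Polynomial → Polynomial
  consᴾ m (+ zero) p = p
  consᴾ m c        p = (m , c) ∷ p

  merge : ∀ {m n} → Comparison m n → ℤ → ℤ → (p+yq xp+q p+q : Polynomial) → Polynomial
  merge {m} less     c d p+yq xp+q p+q = (m , c) ∷ p+yq
  merge {n = n} greater c d p+yq xp+q p+q = (n , d) ∷ xp+q
  merge {m} (equal _) c d p+yq xp+q p+q = consᴾ m (c ℤ.+ d) p+q

  _+ᴾ_ : Polynomial → Polynomial → Polynomial
  []            +ᴾ q             = q
  ((m , c) ∷ p) +ᴾ []            = (m , c) ∷ p
  ((m , c) ∷ p) +ᴾ ((n , d) ∷ q) =
    merge (compare m n) c d (p +ᴾ ((n , d) ∷ q)) (((m , c) ∷ p) +ᴾ q) (p +ᴾ q)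

  -- No sorting is called for: the lexicographic order is compatible with multiplication, and ℤ has
  -- no zero divisors.
  scaleᴾ : Monomial → ℤ → Polynomial → Polynomial
  scaleᴾ m c []            = []
  scaleᴾ m c ((n , d) ∷ q) = (m ·ᴹ n , c ℤ.* d) ∷ scaleᴾ m c q

  _*ᴾ_ : Polynomial → Polynomial → Polynomial
  []            *ᴾ q = []
  ((m , c) ∷ p) *ᴾ q = scaleᴾ m c q +ᴾ (p *ᴾ q)

  norm : Expr → Polynomial
  norm (con c)   = consᴾ [] c []
  norm (var i)   = (i ∷ [] , + 1) ∷ []
  norm (x :+ y) = norm x +ᴾ norm y
  norm (x :* y) = norm x *ᴾ norm y
  norm (:- x)   = scaleᴾ [] (ℤ.- (+ 1)) (norm x)

module RingSolver {c ℓ} (R : CommutativeRing c ℓ) where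
  open import Data.Bool.Base using (T)
  open import Data.Unit.Base using (⊤)
  open CommutativeRing R
  open Normalisation
  open Mult semiring using (1+×; ×-homo-+; ×1-homo-*) renaming (_×_ to _·_)
  open RingProperties ring using (-0#≈0#; -‿distribˡ-*; -‿distribʳ-*; -‿involutive; -1*x≈-x)
  open AbelianGroupProperties +-abelianGroup using (⁻¹-∙-comm; x∙y⁻¹≈ε⇒x≈y)
  open import Relation.Binary.Reasoning.Setoid setoid

  -- With this version of multiples, `fromℤ (+ 0)` and `fromℤ (+ 1)` reduce to `0#` and `1#`, so
  -- that goals with these constants match `:0` and `:1` definitionally.
  fromℤ : ℤ → Carrier
  fromℤ (+ n)    = n · 1#
  fromℤ -[1+ n ] = - (suc n · 1#)

  fromℤ-⊖ : ∀ m n → fromℤ (m ℤ.⊖ n) ≈ m · 1# - n · 1#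
  fromℤ-⊖ m       zero    = sym (trans (+-congˡ -0#≈0#) (+-identityʳ _))
  fromℤ-⊖ zero    (suc n) = sym (+-identityˡ _)
  fromℤ-⊖ (suc m) (suc n) = begin
    fromℤ (suc m ℤ.⊖ suc n)             ≡⟨ ≡.cong fromℤ (ℤ.[1+m]⊖[1+n]≡m⊖n m n) ⟩
    fromℤ (m ℤ.⊖ n)                     ≈⟨ fromℤ-⊖ m n ⟩
    x - y                               ≈⟨ +-identityˡ _ ⟨
    0# + (x - y)                        ≈⟨ +-congʳ (-‿inverseʳ 1#) ⟨
    (1# - 1#) + (x - y)                 ≈⟨ +-assoc _ _ _ ⟩
    1# + (- 1# + (x - y))               ≈⟨ +-congˡ (+-comm _ _) ⟩
    1# + ((x - y) - 1#)                 ≈⟨ +-congˡ (+-assoc _ _ _) ⟩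
    1# + (x + (- y - 1#))               ≈⟨ +-assoc _ _ _ ⟨
    (1# + x) + (- y - 1#)               ≈⟨ +-congˡ (+-comm _ _) ⟩
    (1# + x) + (- 1# - y)               ≈⟨ +-congˡ (⁻¹-∙-comm _ _) ⟩
    (1# + x) - (1# + y)                 ≈⟨ +-cong (1+× m 1#) (-‿cong (1+× n 1#)) ⟨
    suc m · 1# - suc n · 1#             ∎
    where x = m · 1# ; y = n · 1#

  fromℤ-+ : ∀ i j → fromℤ (i ℤ.+ j) ≈ fromℤ i + fromℤ j
  fromℤ-+ (+ m)    (+ n)    = ×-homo-+ 1# m n
  fromℤ-+ (+ m)    -[1+ n ] = fromℤ-⊖ m (suc n)
  fromℤ-+ -[1+ m ] (+ n)    = trans (fromℤ-⊖ n (suc m)) (+-comm _ _)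
  fromℤ-+ -[1+ m ] -[1+ n ] = begin
    - (suc (suc (m ℕ.+ n)) · 1#)    ≡⟨ ≡.cong (λ k → - (suc k · 1#)) (≡.sym (ℕ.+-suc m n)) ⟩
    - ((suc m ℕ.+ suc n) · 1#)      ≈⟨ -‿cong (×-homo-+ 1# (suc m) (suc n)) ⟩
    - (suc m · 1# + suc n · 1#)     ≈⟨ ⁻¹-∙-comm _ _ ⟨
    - (suc m · 1#) - (suc n · 1#)   ∎

  fromℤ-neg : ∀ i → fromℤ (ℤ.- i) ≈ - fromℤ i
  fromℤ-neg (+ zero)  = sym -0#≈0#
  fromℤ-neg (+ suc n) = refl
  fromℤ-neg -[1+ n ]  = sym (-‿involutive _)

  fromℤ-*⁺ : ∀ m j → fromℤ (+ m ℤ.* j) ≈ fromℤ (+ m) * fromℤ j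
  fromℤ-*⁺ m (+ n) = trans (reflexive (≡.cong fromℤ (≡.sym (ℤ.pos-* m n)))) (×1-homo-* m n)
  fromℤ-*⁺ m -[1+ n ] = begin
    fromℤ (+ m ℤ.* -[1+ n ])       ≡⟨ ≡.cong fromℤ (ℤ.neg-distribʳ-* (+ m) (+ suc n)) ⟨
    fromℤ (ℤ.- (+ m ℤ.* + suc n))  ≈⟨ fromℤ-neg (+ m ℤ.* + suc n) ⟩
    - fromℤ (+ m ℤ.* + suc n)      ≈⟨ -‿cong (fromℤ-*⁺ m (+ suc n)) ⟩
    - (m · 1# * suc n · 1#)        ≈⟨ -‿distribʳ-* _ _ ⟩
    m · 1# * - (suc n · 1#)        ∎

  fromℤ-* : ∀ i j → fromℤ (i ℤ.* j) ≈ fromℤ i * fromℤ j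
  fromℤ-* (+ m)    j = fromℤ-*⁺ m j
  fromℤ-* -[1+ m ] j = begin
    fromℤ (-[1+ m ] ℤ.* j)         ≡⟨ ≡.cong fromℤ (ℤ.neg-distribˡ-* (+ suc m) j) ⟨
    fromℤ (ℤ.- (+ suc m ℤ.* j))    ≈⟨ fromℤ-neg (+ suc m ℤ.* j) ⟩
    - fromℤ (+ suc m ℤ.* j)        ≈⟨ -‿cong (fromℤ-*⁺ (suc m) j) ⟩
    - (suc m · 1# * fromℤ j)       ≈⟨ -‿distribˡ-* _ _ ⟩
    - (suc m · 1#) * fromℤ j       ∎

  -- Nested pairs, so that unification finds the atoms #0, #1, … of an identity.
  Env : ℕ → Set c
  Env zero    = Lift c ⊤
  Env (suc n) = Carrier × Env n

  lookup : ∀ n → Env n → ℕ → Carrier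
  lookup zero    ρ i       = 0#
  lookup (suc n) ρ zero    = proj₁ ρ
  lookup (suc n) ρ (suc i) = lookup n (proj₂ ρ) i

  eval : Expr → (ℕ → Carrier) → Carrier
  eval (con c)   ρ = fromℤ c
  eval (var i)   ρ = ρ i
  eval (x :+ y) ρ = eval x ρ + eval y ρ
  eval (x :* y) ρ = eval x ρ * eval y ρ
  eval (:- x)   ρ = - eval x ρ

  module _ (ρ : ℕ → Carrier) where
    open CommutativeSemigroupProperties *-commutativeSemigroup
      using (x∙yz≈y∙xz; interchange)
    open CommutativeSemigroupProperties +-commutativeSemigroup using ()
      renaming (x∙yz≈y∙xz to x+yz≈y+xz; interchange to +-interchange)

    ⟦_⟧ᴹ : Monomial → Carrier
    ⟦ [] ⟧ᴹ    = 1#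
    ⟦ i ∷ m ⟧ᴹ = ρ i * ⟦ m ⟧ᴹ

    ⟦_⟧ᴾ : Polynomial → Carrier
    ⟦ [] ⟧ᴾ          = 0#
    ⟦ (m , c) ∷ p ⟧ᴾ = fromℤ c * ⟦ m ⟧ᴹ + ⟦ p ⟧ᴾ

    ·ᴹ-correct : ∀ m n → ⟦ m ·ᴹ n ⟧ᴹ ≈ ⟦ m ⟧ᴹ * ⟦ n ⟧ᴹ
    ·ᴹ-correct []      n       = sym (*-identityˡ _)
    ·ᴹ-correct (i ∷ m) []      = sym (*-identityʳ _)
    ·ᴹ-correct (i ∷ m) (j ∷ n) = choose (i ℕ.<ᵇ j)
      (trans (*-congˡ (·ᴹ-correct m (j ∷ n))) (sym (*-assoc _ _ _)))
      (trans (*-congˡ (·ᴹ-correct (i ∷ m) n)) (x∙yz≈y∙xz _ _ _))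
      where
      choose : ∀ b {k l z} → ⟦ k ⟧ᴹ ≈ z → ⟦ l ⟧ᴹ ≈ z → ⟦ if b then k else l ⟧ᴹ ≈ z
      choose true  k≈z _   = k≈z
      choose false _   l≈z = l≈z

    consᴾ-correct : ∀ m c p → ⟦ consᴾ m c p ⟧ᴾ ≈ fromℤ c * ⟦ m ⟧ᴹ + ⟦ p ⟧ᴾ
    consᴾ-correct m (+ zero)  p = sym (trans (+-congʳ (zeroˡ _)) (+-identityˡ _))
    consᴾ-correct m (+ suc _) p = refl
    consᴾ-correct m -[1+ _ ]  p = refl

    merge-correct : ∀ {m n} (o : Comparison m n) c d p q {p+yq xp+q p+q} →
      ⟦ p+yq ⟧ᴾ ≈ ⟦ p ⟧ᴾ + ⟦ (n , d) ∷ q ⟧ᴾ → ⟦ xp+q ⟧ᴾ ≈ ⟦ (m , c) ∷ p ⟧ᴾ + ⟦ q ⟧ᴾ →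
      ⟦ p+q ⟧ᴾ ≈ ⟦ p ⟧ᴾ + ⟦ q ⟧ᴾ →
      ⟦ merge o c d p+yq xp+q p+q ⟧ᴾ ≈ ⟦ (m , c) ∷ p ⟧ᴾ + ⟦ (n , d) ∷ q ⟧ᴾ
    merge-correct less c d p q ih _ _ = trans (+-congˡ ih) (sym (+-assoc _ _ _))
    merge-correct greater c d p q _ ih _ = trans (+-congˡ ih) (x+yz≈y+xz _ _ _)
    merge-correct {m} (equal ≡.refl) c d p q {p+q = r} _ _ ih = begin
      ⟦ consᴾ m (c ℤ.+ d) r ⟧ᴾ
        ≈⟨ consᴾ-correct m (c ℤ.+ d) r ⟩
      fromℤ (c ℤ.+ d) * ⟦ m ⟧ᴹ + ⟦ r ⟧ᴾ
        ≈⟨ +-cong (trans (*-congʳ (fromℤ-+ c d)) (distribʳ _ _ _)) ih ⟩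
      (fromℤ c * ⟦ m ⟧ᴹ + fromℤ d * ⟦ m ⟧ᴹ) + (⟦ p ⟧ᴾ + ⟦ q ⟧ᴾ)
        ≈⟨ +-interchange _ _ _ _ ⟩
      (fromℤ c * ⟦ m ⟧ᴹ + ⟦ p ⟧ᴾ) + (fromℤ d * ⟦ m ⟧ᴹ + ⟦ q ⟧ᴾ) ∎

    +ᴾ-correct : ∀ p q → ⟦ p +ᴾ q ⟧ᴾ ≈ ⟦ p ⟧ᴾ + ⟦ q ⟧ᴾ
    +ᴾ-correct []            q             = sym (+-identityˡ _)
    +ᴾ-correct ((m , c) ∷ p) []            = sym (+-identityʳ _)
    +ᴾ-correct ((m , c) ∷ p) ((n , d) ∷ q) = merge-correct (compare m n) c d p q
      (+ᴾ-correct p ((n , d) ∷ q)) (+ᴾ-correct ((m , c) ∷ p) q) (+ᴾ-correct p q)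

    scaleᴾ-correct : ∀ m c q → ⟦ scaleᴾ m c q ⟧ᴾ ≈ (fromℤ c * ⟦ m ⟧ᴹ) * ⟦ q ⟧ᴾ
    scaleᴾ-correct m c []            = sym (zeroʳ _)
    scaleᴾ-correct m c ((n , d) ∷ q) = begin
      fromℤ (c ℤ.* d) * ⟦ m ·ᴹ n ⟧ᴹ + ⟦ scaleᴾ m c q ⟧ᴾ
        ≈⟨ +-cong (*-cong (fromℤ-* c d) (·ᴹ-correct m n)) (scaleᴾ-correct m c q) ⟩
      (fromℤ c * fromℤ d) * (⟦ m ⟧ᴹ * ⟦ n ⟧ᴹ) + (fromℤ c * ⟦ m ⟧ᴹ) * ⟦ q ⟧ᴾ
        ≈⟨ +-congʳ (interchange _ _ _ _) ⟩
      (fromℤ c * ⟦ m ⟧ᴹ) * (fromℤ d * ⟦ n ⟧ᴹ) + (fromℤ c * ⟦ m ⟧ᴹ) * ⟦ q ⟧ᴾ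
        ≈⟨ distribˡ _ _ _ ⟨
      (fromℤ c * ⟦ m ⟧ᴹ) * (fromℤ d * ⟦ n ⟧ᴹ + ⟦ q ⟧ᴾ) ∎

    *ᴾ-correct : ∀ p q → ⟦ p *ᴾ q ⟧ᴾ ≈ ⟦ p ⟧ᴾ * ⟦ q ⟧ᴾ
    *ᴾ-correct []            q = sym (zeroˡ _)
    *ᴾ-correct ((m , c) ∷ p) q = begin
      ⟦ scaleᴾ m c q +ᴾ (p *ᴾ q) ⟧ᴾ
        ≈⟨ +ᴾ-correct (scaleᴾ m c q) (p *ᴾ q) ⟩
      ⟦ scaleᴾ m c q ⟧ᴾ + ⟦ p *ᴾ q ⟧ᴾ
        ≈⟨ +-cong (scaleᴾ-correct m c q) (*ᴾ-correct p q) ⟩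
      (fromℤ c * ⟦ m ⟧ᴹ) * ⟦ q ⟧ᴾ + ⟦ p ⟧ᴾ * ⟦ q ⟧ᴾ
        ≈⟨ distribʳ _ _ _ ⟨
      (fromℤ c * ⟦ m ⟧ᴹ + ⟦ p ⟧ᴾ) * ⟦ q ⟧ᴾ ∎

    norm-correct : ∀ e → ⟦ norm e ⟧ᴾ ≈ eval e ρ
    norm-correct (con c)   = trans (consᴾ-correct [] c []) (trans (+-identityʳ _) (*-identityʳ _))
    norm-correct (var i)   = trans (+-identityʳ _) (trans (*-identityˡ _) (*-identityʳ _))
    norm-correct (x :+ y) =
      trans (+ᴾ-correct (norm x) (norm y)) (+-cong (norm-correct x) (norm-correct y))
    norm-correct (x :* y) =
      trans (*ᴾ-correct (norm x) (norm y)) (*-cong (norm-correct x) (norm-correct y))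
    norm-correct (:- x)   = begin
      ⟦ scaleᴾ [] (ℤ.- (+ 1)) (norm x) ⟧ᴾ  ≈⟨ scaleᴾ-correct [] (ℤ.- (+ 1)) (norm x) ⟩
      (- 1# * 1#) * ⟦ norm x ⟧ᴾ            ≈⟨ *-cong (*-identityʳ _) (norm-correct x) ⟩
      - 1# * eval x ρ                      ≈⟨ -1*x≈-x _ ⟩
      - eval x ρ                           ∎

    null⇒≈0 : ∀ p → T (null p) → ⟦ p ⟧ᴾ ≈ 0#
    null⇒≈0 [] _ = refl

  -- The type checker normalises `x :- y`. If the result is `[]`, the hidden argument has the unit
  -- type and is filled in automatically.
  solve : ∀ n x y {ρ : Env n} {_ : T (null (norm (x :- y)))} → eval x (lookup n ρ) ≈ eval y (lookup n ρ)
  solve n x y {ρ} {p} = x∙y⁻¹≈ε⇒x≈y _ _ (trans (sym (norm-correct (lookup n ρ) (x :- y)))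
    (null⇒≈0 (lookup n ρ) (norm (x :- y)) p))

open Normalisation
  using (_:+_; _:*_; :-_; _:-_; :0; :1; #0; #1; #2; #3; #4; #5; #6; #7; #8; #9; #10; #11; #12;
         #13; #14; #15; #16; #17; #18)

-- General linear groups and their action on tensors

module FieldLemmas {c ℓ} (F : Field c ℓ) where
  open Field F hiding (zero)
  open RingSolver commutativeRing public using (solve)
  open import Relation.Binary.Reasoning.Setoid setoid

  -- Nested uses leave a ring identity that writes x - y as a combination of the differences p - q.
  combine : ∀ {p q x y} k → p ≈ q → x + k * q ≈ y + k * p → x ≈ y
  combine {p} {q} {x} {y} k p≈q eq = begin
    x                    ≈⟨ solve 3 #0 (#0 :+ #1 :* #2 :- #1 :* #2) ⟩
    (x + k * q) - k * q  ≈⟨ +-cong eq (-‿cong (*-congˡ (sym p≈q))) ⟩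
    (y + k * p) - k * p  ≈⟨ solve 3 (#0 :+ #1 :* #2 :- #1 :* #2) #0 ⟩
    y                    ∎

  *≈0⇒≈0 : ∀ {x y} → x ≉ 0# → x * y ≈ 0# → y ≈ 0#
  *≈0⇒≈0 {x} {y} x≉0 xy≈0 with inverse x x≉0
  ... | x⁻¹ , eq = combine (- y) eq (combine x⁻¹ xy≈0
    (solve 3 (#0 :+ :- #0 :* :1 :+ #1 :* :0) (:0 :+ :- #0 :* (#2 :* #1) :+ #1 :* (#2 :* #0))))

  *-≉0 : ∀ {x y} → x ≉ 0# → y ≉ 0# → x * y ≉ 0#
  *-≉0 x≉0 y≉0 xy≈0 = y≉0 (*≈0⇒≈0 x≉0 xy≈0)

  inverse≉0 : ∀ {x y} → x * y ≈ 1# → y ≉ 0#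
  inverse≉0 {x} eq y≈0 = 1≉0 (trans (sym eq) (trans (*-congˡ y≈0) (zeroʳ x)))

  -‿≉0 : ∀ {x} → x ≉ 0# → - x ≉ 0#
  -‿≉0 {x} x≉0 -x≈0 = x≉0 (combine (- 1#) -x≈0 (solve 1 (#0 :+ :- :1 :* :0) (:0 :+ :- :1 :* :- #0)))

  -- Standard basis vectors. The recursion makes `e k l` compute on numerals, so `refl` proves facts
  -- such as `e 0F 1F ≈ 0#`.
  e : ∀ {n} → Fin n → Fin n → Carrier
  e zero    zero    = 1#
  e zero    (suc j) = 0#
  e (suc i) zero    = 0#
  e (suc i) (suc j) = e i j

  e-diagonal : ∀ {n} (i : Fin n) → e i i ≈ 1#
  e-diagonal zero    = refl
  e-diagonal (suc i) = e-diagonal i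

  module _ (I : Set) where
    open GeneralLinear {F = F} (_^ᴹ_ F I)

    linearGL : (f f⁻¹ : (I → Carrier) → I → Carrier) →
      (∀ {u v} → (∀ i → u i ≈ v i) → ∀ i → f u i ≈ f v i) →
      (∀ {u v} → (∀ i → u i ≈ v i) → ∀ i → f⁻¹ u i ≈ f⁻¹ v i) →
      (∀ u v i → f (λ j → u j + v j) i ≈ f u i + f v i) →
      (∀ r v i → f (λ j → r * v j) i ≈ r * f v i) →
      (∀ v i → f (f⁻¹ v) i ≈ v i) → (∀ v i → f⁻¹ (f v) i ≈ v i) → GL
    linearGL f f⁻¹ f-cong f⁻¹-cong f-+ f-* f∘f⁻¹ f⁻¹∘f = mkGL f record
      { isLeftModuleMonomorphism = record
        { isLeftModuleHomomorphism = record
          { +ᴹ-isGroupHomomorphism = record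
            { isMonoidHomomorphism = record
              { isMagmaHomomorphism = record
                { isRelHomomorphism = record { cong = f-cong }
                ; homo = f-+
                }
              -- Homogeneity gives both remaining laws, with the scalar 0 here and the scalar -1 for
              -- negation.
              ; ε-homo = λ i → trans (f-cong {v = λ _ → 0# * 0#} (λ _ → solve 0 :0 (:0 :* :0)) i)
                          (trans (f-* 0# (λ _ → 0#) i) (zeroˡ _))
              }
            ; ⁻¹-homo = λ v i → trans (f-cong {v = λ j → - 1# * v j} (λ _ → solve 1 (:- #0) (:- :1
              :* #0)) i)
                          (trans (f-* (- 1#) v i) (solve 1 (:- :1 :* #0) (:- #0)))
            }
          ; *ₗ-homo = f-*
          }
        ; injective = λ {u} {v} eq i →
            trans (sym (f⁻¹∘f u i)) (trans (f⁻¹-cong eq i) (f⁻¹∘f v i))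
        }
      ; surjective = λ v → f⁻¹ v , λ eq i → trans (f-cong eq i) (f∘f⁻¹ v i)
      }

  module _ (a b c d : Carrier) where
    matrix₂ : (Fin 2 → Carrier) → Fin 2 → Carrier
    matrix₂ v 0F = a * v 0F + b * v 1F
    matrix₂ v 1F = c * v 0F + d * v 1F

    matrix₂-cong : ∀ {u v} → (∀ i → u i ≈ v i) → ∀ i → matrix₂ u i ≈ matrix₂ v i
    matrix₂-cong eq 0F = +-cong (*-congˡ (eq 0F)) (*-congˡ (eq 1F))
    matrix₂-cong eq 1F = +-cong (*-congˡ (eq 0F)) (*-congˡ (eq 1F))

  det₂ : (a b c d : Carrier) → Carrier
  det₂ a b c d = a * d - b * c

  GL₂-matrix : ∀ a b c d → det₂ a b c d ≉ 0# → GeneralLinear.GL {F = F} (_^ᴹ_ F (Fin 2))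
  GL₂-matrix a b c d det≉0 with inverse (det₂ a b c d) det≉0
  -- The inverse is the adjugate matrix times the inverse of the determinant.
  ... | e , eq = linearGL (Fin 2) (matrix₂ a b c d) (matrix₂ (e * d) (- (e * b)) (- (e * c)) (e * a))
    (matrix₂-cong a b c d) (matrix₂-cong _ _ _ _)
    (λ u v → λ { 0F → solve 6 (#0 :* (#1 :+ #2) :+ #3 :* (#4 :+ #5)) (#0 :* #1 :+ #3 :* #4 :+ (#0 :*
      #2 :+ #3 :* #5)) ; 1F → solve 6 (#0 :* (#1 :+ #2) :+ #3 :* (#4 :+ #5)) (#0 :* #1 :+ #3 :* #4
      :+ (#0 :* #2 :+ #3 :* #5)) })
    (λ r v → λ { 0F → solve 5 (#0 :* (#1 :* #2) :+ #3 :* (#1 :* #4)) (#1 :* (#0 :* #2 :+ #3 :* #4))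
      ; 1F → solve 5 (#0 :* (#1 :* #2) :+ #3 :* (#1 :* #4)) (#1 :* (#0 :* #2 :+ #3 :* #4)) })
    (λ v → λ { 0F → combine (v 0F) eq
      (solve 7 (#0 :* (#1 :* #2 :* #3 :+ :- (#1 :* #4) :* #5) :+ #4 :* (:- (#1 :* #6) :* #3 :+ #1 :*
      #0 :* #5) :+ #3 :* :1) (#3 :+ #3 :* ((#0 :* #2 :- #4 :* #6) :* #1))) ; 1F → combine (v 1F) eq
      (solve 7 (#0 :* (#1 :* #2 :* #3 :+ :- (#1 :* #4) :* #5) :+ #2 :* (:- (#1 :* #0) :* #3 :+ #1 :*
      #6 :* #5) :+ #5 :* :1) (#5 :+ #5 :* ((#6 :* #2 :- #4 :* #0) :* #1))) })
    (λ v → λ { 0F → combine (v 0F) eq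
      (solve 7 (#0 :* #1 :* (#2 :* #3 :+ #4 :* #5) :+ :- (#0 :* #4) :* (#6 :* #3 :+ #1 :* #5) :+ #3
      :* :1) (#3 :+ #3 :* ((#2 :* #1 :- #4 :* #6) :* #0))) ; 1F → combine (v 1F) eq
      (solve 7 (:- (#0 :* #1) :* (#2 :* #3 :+ #4 :* #5) :+ #0 :* #2 :* (#1 :* #3 :+ #6 :* #5) :+ #5
      :* :1) (#5 :+ #5 :* ((#2 :* #6 :- #4 :* #1) :* #0))) })

  module _ (a b c d e f g h i : Carrier) where
    matrix₃ : (Fin 3 → Carrier) → Fin 3 → Carrier
    matrix₃ v 0F = a * v 0F + b * v 1F + c * v 2F
    matrix₃ v 1F = d * v 0F + e * v 1F + f * v 2F
    matrix₃ v 2F = g * v 0F + h * v 1F + i * v 2F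

    matrix₃-cong : ∀ {u v} → (∀ i → u i ≈ v i) → ∀ i → matrix₃ u i ≈ matrix₃ v i
    matrix₃-cong eq 0F = +-cong (+-cong (*-congˡ (eq 0F)) (*-congˡ (eq 1F))) (*-congˡ (eq 2F))
    matrix₃-cong eq 1F = +-cong (+-cong (*-congˡ (eq 0F)) (*-congˡ (eq 1F))) (*-congˡ (eq 2F))
    matrix₃-cong eq 2F = +-cong (+-cong (*-congˡ (eq 0F)) (*-congˡ (eq 1F))) (*-congˡ (eq 2F))

    det₃ : Carrier
    det₃ = a * det₂ e f h i - b * det₂ d f g i + c * det₂ d e g h

  GL₃-matrix : ∀ a b c d e f g h i → det₃ a b c d e f g h i ≉ 0# →
               GeneralLinear.GL {F = F} (_^ᴹ_ F (Fin 3))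
  GL₃-matrix a b c d e f g h i det≉0 with inverse (det₃ a b c d e f g h i) det≉0
  ... | k , eq = linearGL (Fin 3) (matrix₃ a b c d e f g h i)
    -- The adjugate again; the signs of the cofactors are absorbed by the order of the arguments of
    -- `det₂`.
    (matrix₃ (k * det₂ e f h i) (k * det₂ c b i h) (k * det₂ b c e f)
             (k * det₂ f d i g) (k * det₂ a c g i) (k * det₂ c a f d)
             (k * det₂ d e g h) (k * det₂ b a h g) (k * det₂ a b d e))
    (matrix₃-cong _ _ _ _ _ _ _ _ _) (matrix₃-cong _ _ _ _ _ _ _ _ _)
    (λ u v → λ { 0F → solve 9 (#0 :* (#1 :+ #2) :+ #3 :* (#4 :+ #5) :+ #6 :* (#7 :+ #8)) (#0 :* #1
      :+ #3 :* #4 :+ #6 :* #7 :+ (#0 :* #2 :+ #3 :* #5 :+ #6 :* #8)) ; 1F → solve 9 (#0 :* (#1 :+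
      #2) :+ #3 :* (#4 :+ #5) :+ #6 :* (#7 :+ #8)) (#0 :* #1 :+ #3 :* #4 :+ #6 :* #7 :+ (#0 :* #2 :+
      #3 :* #5 :+ #6 :* #8)) ; 2F → solve 9 (#0 :* (#1 :+ #2) :+ #3 :* (#4 :+ #5) :+ #6 :* (#7 :+
      #8)) (#0 :* #1 :+ #3 :* #4 :+ #6 :* #7 :+ (#0 :* #2 :+ #3 :* #5 :+ #6 :* #8)) })
    (λ r v → λ { 0F → solve 7 (#0 :* (#1 :* #2) :+ #3 :* (#1 :* #4) :+ #5 :* (#1 :* #6)) (#1 :* (#0
      :* #2 :+ #3 :* #4 :+ #5 :* #6)) ; 1F → solve 7 (#0 :* (#1 :* #2) :+ #3 :* (#1 :* #4) :+ #5 :*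
      (#1 :* #6)) (#1 :* (#0 :* #2 :+ #3 :* #4 :+ #5 :* #6)) ; 2F → solve 7 (#0 :* (#1 :* #2) :+ #3
      :* (#1 :* #4) :+ #5 :* (#1 :* #6)) (#1 :* (#0 :* #2 :+ #3 :* #4 :+ #5 :* #6)) })
    (λ v → λ { 0F → combine (v 0F) eq
      (solve 13 (#0 :* (#1 :* (#2 :* #3 :- #4 :* #5) :* #6 :+ #1 :* (#7 :* #5 :- #8 :* #3) :* #9 :+
      #1 :* (#8 :* #4 :- #7 :* #2) :* #10) :+ #8 :* (#1 :* (#4 :* #11 :- #12 :* #3) :* #6 :+ #1 :*
      (#0 :* #3 :- #7 :* #11) :* #9 :+ #1 :* (#7 :* #12 :- #0 :* #4) :* #10) :+ #7 :* (#1 :* (#12 :*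
      #5 :- #2 :* #11) :* #6 :+ #1 :* (#8 :* #11 :- #0 :* #5) :* #9 :+ #1 :* (#0 :* #2 :- #8 :* #12)
      :* #10) :+ #6 :* :1) (#6 :+ #6 :* ((#0 :* (#2 :* #3 :- #4 :* #5) :- #8 :* (#12 :* #3 :- #4 :*
      #11) :+ #7 :* (#12 :* #5 :- #2 :* #11)) :* #1))) ; 1F → combine (v 1F) eq
      (solve 13 (#0 :* (#1 :* (#2 :* #3 :- #4 :* #5) :* #6 :+ #1 :* (#7 :* #5 :- #8 :* #3) :* #9 :+
      #1 :* (#8 :* #4 :- #7 :* #2) :* #10) :+ #2 :* (#1 :* (#4 :* #11 :- #0 :* #3) :* #6 :+ #1 :*
      (#12 :* #3 :- #7 :* #11) :* #9 :+ #1 :* (#7 :* #0 :- #12 :* #4) :* #10) :+ #4 :* (#1 :* (#0 :*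
      #5 :- #2 :* #11) :* #6 :+ #1 :* (#8 :* #11 :- #12 :* #5) :* #9 :+ #1 :* (#12 :* #2 :- #8 :*
      #0) :* #10) :+ #9 :* :1) (#9 :+ #9 :* ((#12 :* (#2 :* #3 :- #4 :* #5) :- #8 :* (#0 :* #3 :- #4
      :* #11) :+ #7 :* (#0 :* #5 :- #2 :* #11)) :* #1)))
             ; 2F → combine (v 2F) eq (solve 13 (#0 :* (#1 :* (#2 :* #3 :- #4 :* #5) :* #6 :+ #1 :*
               (#7 :* #5 :- #8 :* #3) :* #9 :+ #1 :* (#8 :* #4 :- #7 :* #2) :* #10) :+ #5 :* (#1 :*
               (#4 :* #0 :- #11 :* #3) :* #6 :+ #1 :* (#12 :* #3 :- #7 :* #0) :* #9 :+ #1 :* (#7 :*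
               #11 :- #12 :* #4) :* #10) :+ #3 :* (#1 :* (#11 :* #5 :- #2 :* #0) :* #6 :+ #1 :* (#8
               :* #0 :- #12 :* #5) :* #9 :+ #1 :* (#12 :* #2 :- #8 :* #11) :* #10) :+ #10 :* :1)
               (#10 :+ #10 :* ((#12 :* (#2 :* #3 :- #4 :* #5) :- #8 :* (#11 :* #3 :- #4 :* #0) :+ #7
               :* (#11 :* #5 :- #2 :* #0)) :* #1))) })
    (λ v → λ { 0F → combine (v 0F) eq
      (solve 13 (#0 :* (#1 :* #2 :- #3 :* #4) :* (#5 :* #6 :+ #7 :* #8 :+ #9 :* #10) :+ #0 :* (#9 :*
      #4 :- #7 :* #2) :* (#11 :* #6 :+ #1 :* #8 :+ #3 :* #10) :+ #0 :* (#7 :* #3 :- #9 :* #1) :*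
      (#12 :* #6 :+ #4 :* #8 :+ #2 :* #10) :+ #6 :* :1) (#6 :+ #6 :* ((#5 :* (#1 :* #2 :- #3 :* #4)
      :- #7 :* (#11 :* #2 :- #3 :* #12) :+ #9 :* (#11 :* #4 :- #1 :* #12)) :* #0))) ; 1F → combine
      (v 1F) eq (solve 13 (#0 :* (#1 :* #2 :- #3 :* #4) :* (#5 :* #6 :+ #7 :* #8 :+ #9 :* #10) :+ #0
      :* (#5 :* #4 :- #9 :* #2) :* (#3 :* #6 :+ #11 :* #8 :+ #1 :* #10) :+ #0 :* (#9 :* #3 :- #5 :*
      #1) :* (#2 :* #6 :+ #12 :* #8 :+ #4 :* #10) :+ #8 :* :1) (#8 :+ #8 :* ((#5 :* (#11 :* #4 :- #1
      :* #12) :- #7 :* (#3 :* #4 :- #1 :* #2) :+ #9 :* (#3 :* #12 :- #11 :* #2)) :* #0)))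
             ; 2F → combine (v 2F) eq (solve 13 (#0 :* (#1 :* #2 :- #3 :* #4) :* (#5 :* #6 :+ #7 :*
               #8 :+ #9 :* #10) :+ #0 :* (#7 :* #4 :- #5 :* #2) :* (#1 :* #6 :+ #3 :* #8 :+ #11 :*
               #10) :+ #0 :* (#5 :* #3 :- #7 :* #1) :* (#4 :* #6 :+ #2 :* #8 :+ #12 :* #10) :+ #10
               :* :1) (#10 :+ #10 :* ((#5 :* (#3 :* #12 :- #11 :* #2) :- #7 :* (#1 :* #12 :- #11 :*
               #4) :+ #9 :* (#1 :* #2 :- #3 :* #4)) :* #0))) })

module Moves {c ℓ} (F : Field c ℓ) where
  open Field F hiding (zero)
  open FieldLemmas F
  open Tensors F 2 2 3
  open GeneralLinear {F = F} V using (GL; idᴳ; module GL; module Subgroup)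
  open GL

  Index : Set
  Index = Fin 2 × Fin 2 × Fin 3

  Tensor : Set c
  Tensor = Index → Carrier

  private module Orbit = Setoid (Subgroup.orbits H)

  -- A record, so that the two tensors can be inferred from the type.
  infix 4 _~_
  record _~_ (s t : Tensor) : Set (c ⊔ ℓ) where
    constructor sameOrbit
    field inOrbit : s Orbit.≈ t
  open _~_ public

  ~-refl : ∀ {t} → t ~ t
  ~-refl {t} = sameOrbit (Orbit.refl {t})

  ~-sym : ∀ {s t} → s ~ t → t ~ s
  ~-sym {s} {t} (sameOrbit p) = sameOrbit (Orbit.sym {s} {t} p)

  ~-trans : ∀ {s t u} → s ~ t → t ~ u → s ~ u
  ~-trans {s} {t} {u} (sameOrbit p) (sameOrbit q) = sameOrbit (Orbit.trans {s} {t} {u} p q)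

  ≈⇒~ : ∀ {s t : Tensor} → (∀ i → s i ≈ t i) → s ~ t
  ≈⇒~ s≈t = sameOrbit (idᴳ , Subgroup.id-closed H , s≈t)

  lift₁ : GL₁.GL → GL
  lift₁ g = linearGL Index
    (λ { t (i , j , k) → GL₁.GL.⟦ g ⟧ (λ i′ → t (i′ , j , k)) i })
    (λ { t (i , j , k) → GL₁.GL.⟦ g GL₁.⁻¹ᴳ ⟧ (λ i′ → t (i′ , j , k)) i })
    (λ { eq (i , j , k) → GL₁.GL.⟦⟧-cong g (λ i′ → eq (i′ , j , k)) i })
    (λ { eq (i , j , k) → GL₁.GL.⟦⟧-cong (g GL₁.⁻¹ᴳ) (λ i′ → eq (i′ , j , k)) i })
    (λ { s t (i , j , k) → GL₁.GL.+ᴹ-homo g _ _ i })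
    (λ { r t (i , j , k) → GL₁.GL.*ₗ-homo g r _ i })
    (λ { t (i , j , k) → GL₁.GL.inverseˡ g _ i })
    (λ { t (i , j , k) → GL₁.GL.inverseʳ g _ i })

  lift₂ : GL₂.GL → GL
  lift₂ g = linearGL Index
    (λ { t (i , j , k) → GL₂.GL.⟦ g ⟧ (λ j′ → t (i , j′ , k)) j })
    (λ { t (i , j , k) → GL₂.GL.⟦ g GL₂.⁻¹ᴳ ⟧ (λ j′ → t (i , j′ , k)) j })
    (λ { eq (i , j , k) → GL₂.GL.⟦⟧-cong g (λ j′ → eq (i , j′ , k)) j })
    (λ { eq (i , j , k) → GL₂.GL.⟦⟧-cong (g GL₂.⁻¹ᴳ) (λ j′ → eq (i , j′ , k)) j })
    (λ { s t (i , j , k) → GL₂.GL.+ᴹ-homo g _ _ j })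
    (λ { r t (i , j , k) → GL₂.GL.*ₗ-homo g r _ j })
    (λ { t (i , j , k) → GL₂.GL.inverseˡ g _ j })
    (λ { t (i , j , k) → GL₂.GL.inverseʳ g _ j })

  lift₃ : GL₃.GL → GL
  lift₃ g = linearGL Index
    (λ { t (i , j , k) → GL₃.GL.⟦ g ⟧ (λ k′ → t (i , j , k′)) k })
    (λ { t (i , j , k) → GL₃.GL.⟦ g GL₃.⁻¹ᴳ ⟧ (λ k′ → t (i , j , k′)) k })
    (λ { eq (i , j , k) → GL₃.GL.⟦⟧-cong g (λ k′ → eq (i , j , k′)) k })
    (λ { eq (i , j , k) → GL₃.GL.⟦⟧-cong (g GL₃.⁻¹ᴳ) (λ k′ → eq (i , j , k′)) k })
    (λ { s t (i , j , k) → GL₃.GL.+ᴹ-homo g _ _ k })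
    (λ { r t (i , j , k) → GL₃.GL.*ₗ-homo g r _ k })
    (λ { t (i , j , k) → GL₃.GL.inverseˡ g _ k })
    (λ { t (i , j , k) → GL₃.GL.inverseʳ g _ k })

  lift₁∈H : ∀ g → Subgroup.Member H (lift₁ g)
  lift₁∈H g = g , GL₂.idᴳ , GL₃.idᴳ , λ v₁ v₂ v₃ → λ { (i , j , k) →
    trans (GL₁.GL.⟦⟧-cong g {y = λ i′ → (v₂ j * v₃ k) * v₁ i′} (λ _ → solve 3 (#0 :* #1 :* #2) (#1
      :* #2 :* #0)) i)
      (trans (GL₁.GL.*ₗ-homo g (v₂ j * v₃ k) v₁ i) (solve 3 (#0 :* #1 :* #2) (#2 :* #0 :* #1))) }

  lift₂∈H : ∀ g → Subgroup.Member H (lift₂ g)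
  lift₂∈H g = GL₁.idᴳ , g , GL₃.idᴳ , λ v₁ v₂ v₃ → λ { (i , j , k) →
    trans (GL₂.GL.⟦⟧-cong g {y = λ j′ → (v₁ i * v₃ k) * v₂ j′} (λ _ → solve 3 (#0 :* #1 :* #2) (#0
      :* #2 :* #1)) j)
      (trans (GL₂.GL.*ₗ-homo g (v₁ i * v₃ k) v₂ j) (solve 3 (#0 :* #1 :* #2) (#0 :* #2 :* #1))) }

  lift₃∈H : ∀ g → Subgroup.Member H (lift₃ g)
  lift₃∈H g = GL₁.idᴳ , GL₂.idᴳ , g , λ v₁ v₂ v₃ → λ { (i , j , k) →
    GL₃.GL.*ₗ-homo g _ v₃ k }

  act₁ : (a b c d : Carrier) → Tensor → Tensor
  act₁ a b c d t (i , j , k) = matrix₂ a b c d (λ i′ → t (i′ , j , k)) i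

  act₂ : (a b c d : Carrier) → Tensor → Tensor
  act₂ a b c d t (i , j , k) = matrix₂ a b c d (λ j′ → t (i , j′ , k)) j

  act₃ : (a b c d e f g h i : Carrier) → Tensor → Tensor
  act₃ a b c d e f g h i t (x , y , z) = matrix₃ a b c d e f g h i (λ z′ → t (x , y , z′)) z

  ~-act₁ : ∀ a b c d t → det₂ a b c d ≉ 0# → t ~ act₁ a b c d t
  ~-act₁ a b c d t det≉0 = sameOrbit (lift₁ g , lift₁∈H g , λ _ → refl)
    where g = GL₂-matrix a b c d det≉0

  ~-act₂ : ∀ a b c d t → det₂ a b c d ≉ 0# → t ~ act₂ a b c d t
  ~-act₂ a b c d t det≉0 = sameOrbit (lift₂ g , lift₂∈H g , λ _ → refl)
    where g = GL₂-matrix a b c d det≉0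

  ~-act₃ : ∀ a b c d e f g h i t → det₃ a b c d e f g h i ≉ 0# → t ~ act₃ a b c d e f g h i t
  ~-act₃ a b c d e f g h i t det≉0 = sameOrbit (lift₃ γ , lift₃∈H γ , λ _ → refl)
    where γ = GL₃-matrix a b c d e f g h i det≉0

-- Representatives and elimination

module Representatives {c ℓ} (F : Field c ℓ) where
  open Field F hiding (zero)
  open Moves F

  Matrix : Set c
  Matrix = Fin 2 → Fin 2 → Carrier

  mat : (a b c d : Carrier) → Matrix
  mat a b c d 0F 0F = a
  mat a b c d 0F 1F = b
  mat a b c d 1F 0F = c
  mat a b c d 1F 1F = d

  Slice : Tensor → Fin 3 → Matrix
  Slice t k i j = t (i , j , k)

  slices : (X Y Z : Matrix) → Tensor
  slices X Y Z (i , j , 0F) = X i j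
  slices X Y Z (i , j , 1F) = Y i j
  slices X Y Z (i , j , 2F) = Z i j

  det : Matrix → Carrier
  det X = X 0F 0F * X 1F 1F - X 0F 1F * X 1F 0F

  infix 4 _≈ᴹ_
  _≈ᴹ_ : Matrix → Matrix → Set ℓ
  X ≈ᴹ Y = ∀ i j → X i j ≈ Y i j

  mat≈ : ∀ {X Y} → X 0F 0F ≈ Y 0F 0F → X 0F 1F ≈ Y 0F 1F →
         X 1F 0F ≈ Y 1F 0F → X 1F 1F ≈ Y 1F 1F → X ≈ᴹ Y
  mat≈ p q r s 0F 0F = p
  mat≈ p q r s 0F 1F = q
  mat≈ p q r s 1F 0F = r
  mat≈ p q r s 1F 1F = s

  slices≈ : ∀ {s t} → Slice s 0F ≈ᴹ Slice t 0F → Slice s 1F ≈ᴹ Slice t 1F →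
            Slice s 2F ≈ᴹ Slice t 2F → ∀ i → s i ≈ t i
  slices≈ p q r (i , j , 0F) = p i j
  slices≈ p q r (i , j , 1F) = q i j
  slices≈ p q r (i , j , 2F) = r i j

  O I E₁₁ E₁₂ E₂₁ E₂₂ : Matrix
  O   = mat 0# 0# 0# 0#
  I   = mat 1# 0# 0# 1#
  E₁₁ = mat 1# 0# 0# 0#
  E₁₂ = mat 0# 1# 0# 0#
  E₂₁ = mat 0# 0# 1# 0#
  E₂₂ = mat 0# 0# 0# 1#

  -- The last slice C has characteristic polynomial X² - d X - b, and det (x I + C) = x² + d x - b.
  companion : (b d : Carrier) → Tensor
  companion b d = slices O I (mat 0# b 1# d)

  module _ (b : Carrier) where
    -- rep 8F is a normal form only if X² + X - b is irreducible.
    rep : Fin 10 → Tensor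
    rep 0F = slices O O O
    rep 1F = slices E₂₂ O O
    rep 2F = slices O I O
    rep 3F = slices E₂₂ O E₂₁
    rep 4F = slices E₂₂ O E₁₁
    rep 5F = slices E₂₂ O (mat 0# 1# 1# 0#)
    rep 6F = slices E₂₂ E₁₂ E₁₁
    rep 7F = slices E₂₂ (mat 0# 1# 1# 0#) E₁₁
    rep 8F = companion b 1#
    rep 9F = slices E₂₂ O E₁₂

module Classification {c ℓ} (F : Field c ℓ) (em : ExcludedMiddle (c ⊔ ℓ)) where
  open Field F hiding (zero)
  open FieldLemmas F
  open Moves F
  open Representatives F

  infix 4 _≈0?
  _≈0? : ∀ x → Dec (x ≈ 0#)
  x ≈0? = map′ lower lift (em {Lift c (x ≈ 0#)})

  -1≉0 : - 1# ≉ 0#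
  -1≉0 = -‿≉0 1≉0

  flip : Fin 2 → Fin 2
  flip 0F = 1F
  flip 1F = 0F

  flip₁ flip₂ : Tensor → Tensor
  flip₁ t (i , j , k) = t (flip i , j , k)
  flip₂ t (i , j , k) = t (i , flip j , k)

  ~-flip₁ : ∀ t → t ~ flip₁ t
  ~-flip₁ t = ~-trans {t = t′} (~-act₁ 0# 1# 1# 0# t λ e → -1≉0 (trans
    (solve 0 (:- :1) (:0 :* :0 :- :1 :* :1)) e))
    (≈⇒~ {t′} {flip₁ t} λ { (0F , j , k) → solve 2 (:0 :* #0 :+ :1 :* #1) #1 ; (1F , j , k) →
      solve 2 (:1 :* #0 :+ :0 :* #1) #0 })
    where t′ = act₁ 0# 1# 1# 0# t

  ~-flip₂ : ∀ t → t ~ flip₂ t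
  ~-flip₂ t = ~-trans {t = t′} (~-act₂ 0# 1# 1# 0# t λ e → -1≉0 (trans
    (solve 0 (:- :1) (:0 :* :0 :- :1 :* :1)) e))
    (≈⇒~ {t′} {flip₂ t} λ { (i , 0F , k) → solve 2 (:0 :* #0 :+ :1 :* #1) #1 ; (i , 1F , k) →
      solve 2 (:1 :* #0 :+ :0 :* #1) #0 })
    where t′ = act₂ 0# 1# 1# 0# t

  ~-transpose₀₁ : ∀ t → t ~ slices (Slice t 1F) (Slice t 0F) (Slice t 2F)
  ~-transpose₀₁ t = ~-trans (~-act₃ 0# 1# 0# 1# 0# 0# 0# 0# 1# t λ e → -1≉0 (trans
    (solve 0 (:- :1) (:0 :* (:0 :* :1 :- :0 :* :0) :- :1 :* (:1 :* :1 :- :0 :* :0) :+ :0 :* (:1 :*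
    :0 :- :0 :* :0))) e))
    (≈⇒~ (slices≈ (λ _ _ → solve 3 (:0 :* #0 :+ :1 :* #1 :+ :0 :* #2) #1) (λ _ _ → solve 3 (:1 :* #0
      :+ :0 :* #1 :+ :0 :* #2) #0) (λ _ _ → solve 3 (:0 :* #0 :+ :0 :* #1 :+ :1 :* #2) #2)))

  ~-transpose₀₂ : ∀ t → t ~ slices (Slice t 2F) (Slice t 1F) (Slice t 0F)
  ~-transpose₀₂ t = ~-trans (~-act₃ 0# 0# 1# 0# 1# 0# 1# 0# 0# t λ e → -1≉0 (trans
    (solve 0 (:- :1) (:0 :* (:1 :* :0 :- :0 :* :0) :- :0 :* (:0 :* :0 :- :0 :* :1) :+ :1 :* (:0 :*
    :0 :- :1 :* :1))) e))
    (≈⇒~ (slices≈ (λ _ _ → solve 3 (:0 :* #0 :+ :0 :* #1 :+ :1 :* #2) #2) (λ _ _ → solve 3 (:0 :* #0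
      :+ :1 :* #1 :+ :0 :* #2) #1) (λ _ _ → solve 3 (:1 :* #0 :+ :0 :* #1 :+ :0 :* #2) #0)))

  ~-transpose₁₂ : ∀ t → t ~ slices (Slice t 0F) (Slice t 2F) (Slice t 1F)
  ~-transpose₁₂ t = ~-trans (~-act₃ 1# 0# 0# 0# 0# 1# 0# 1# 0# t λ e → -1≉0 (trans
    (solve 0 (:- :1) (:1 :* (:0 :* :0 :- :1 :* :1) :- :0 :* (:0 :* :0 :- :1 :* :0) :+ :0 :* (:0 :*
    :1 :- :0 :* :0))) e))
    (≈⇒~ (slices≈ (λ _ _ → solve 3 (:1 :* #0 :+ :0 :* #1 :+ :0 :* #2) #0) (λ _ _ → solve 3 (:0 :* #0
      :+ :0 :* #1 :+ :1 :* #2) #2) (λ _ _ → solve 3 (:0 :* #0 :+ :1 :* #1 :+ :0 :* #2) #1)))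

  -- With α and β the entries to compare, α ≠ 0, the slices S₀, S₁ become β S₀ - α S₁ and S₀, a
  -- substitution of determinant α. Entries that vanish in both slices stay zero, which allows
  -- several eliminations in succession.
  eliminate₀ : ∀ t i j → ∃[ t′ ] t ~ t′ × t′ (i , j , 0F) ≈ 0# ×
    (∀ x y → t (x , y , 0F) ≈ 0# → t (x , y , 1F) ≈ 0# →
             t′ (x , y , 0F) ≈ 0# × t′ (x , y , 1F) ≈ 0#)
  eliminate₀ t i j with t (i , j , 0F) ≈0?
  ... | yes α≈0 = t , ~-refl {t} , α≈0 , λ _ _ → _,_
  ... | no α≉0 =
    act₃ β (- α) 0# 1# 0# 0# 0# 0# 1# t ,
    ~-act₃ β (- α) 0# 1# 0# 0# 0# 0# 1# t (λ e → α≉0 (trans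
      (solve 2 #0 (#1 :* (:0 :* :1 :- :0 :* :0) :- :- #0 :* (:1 :* :1 :- :0 :* :0) :+ :0 :* (:1 :*
      :0 :- :0 :* :0))) e)) ,
    (solve 3 (#0 :* #1 :+ :- #1 :* #0 :+ :0 :* #2) :0) ,
    λ x y p q → combine β p (combine (- α) q
      (solve 5 (#0 :* #1 :+ :- #2 :* #3 :+ :0 :* #4 :+ #0 :* :0 :+ :- #2 :* :0) (:0 :+ #0 :* #1 :+
      :- #2 :* #3))) , combine 1# p (solve 3 (:1 :* #0 :+ :0 :* #1 :+ :0 :* #2 :+ :1 :* :0) (:0 :+
      :1 :* #0))
    where α = t (i , j , 0F) ; β = t (i , j , 1F)

  eliminate₁ : ∀ t i j → ∃[ t′ ] t ~ t′ × t′ (i , j , 1F) ≈ 0# ×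
    (∀ x y → t (x , y , 1F) ≈ 0# → t (x , y , 2F) ≈ 0# →
             t′ (x , y , 1F) ≈ 0# × t′ (x , y , 2F) ≈ 0#) ×
    Slice t′ 0F ≈ᴹ Slice t 0F
  eliminate₁ t i j with t (i , j , 1F) ≈0?
  ... | yes α≈0 = t , ~-refl {t} , α≈0 , (λ _ _ → _,_) , λ _ _ → refl
  ... | no α≉0 =
    act₃ 1# 0# 0# 0# β (- α) 0# 1# 0# t ,
    ~-act₃ 1# 0# 0# 0# β (- α) 0# 1# 0# t (λ e → α≉0 (trans
      (solve 2 #0 (:1 :* (#1 :* :0 :- :- #0 :* :1) :- :0 :* (:0 :* :0 :- :- #0 :* :0) :+ :0 :* (:0
      :* :1 :- #1 :* :0))) e)) ,
    (solve 3 (:0 :* #0 :+ #1 :* #2 :+ :- #2 :* #1) :0) ,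
    (λ x y p q → combine β p (combine (- α) q
      (solve 5 (:0 :* #0 :+ #1 :* #2 :+ :- #3 :* #4 :+ #1 :* :0 :+ :- #3 :* :0) (:0 :+ #1 :* #2 :+
      :- #3 :* #4))) , combine 1# p (solve 3 (:0 :* #0 :+ :1 :* #1 :+ :0 :* #2 :+ :1 :* :0) (:0 :+
      :1 :* #1))) ,
    λ x y → solve 3 (:1 :* #0 :+ :0 :* #1 :+ :0 :* #2) #0
    where α = t (i , j , 1F) ; β = t (i , j , 2F)

  -- A three-dimensional space of 2 × 2 matrices meets the plane of matrices with zero first row.
  -- Clearing the corner from two slices leaves one of them available to clear the next entry.
  singularSlice : ∀ t → ∃[ t′ ] t ~ t′ × t′ (0F , 0F , 0F) ≈ 0# × t′ (0F , 1F , 0F) ≈ 0#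
  singularSlice t with eliminate₀ t 0F 0F
  ... | t₁ , t~t₁ , p₀ , _ with eliminate₁ t₁ 0F 0F
  ... | t₂ , t₁~t₂ , p₁ , _ , same with eliminate₀ t₂ 0F 1F
  ... | t₃ , t₂~t₃ , q₀ , pres =
    t₃ , ~-trans t~t₁ (~-trans t₁~t₂ t₂~t₃) ,
    proj₁ (pres 0F 0F (trans (same 0F 0F) p₀) p₁) , q₀

  -- Row and column operations with the nonzero corner d as pivot leave the Schur complement a -
  -- bc/d = det/d in the opposite corner, and that is zero.
  toE₂₂ : ∀ t → det (Slice t 0F) ≈ 0# → t (1F , 1F , 0F) ≉ 0# →
          ∃[ t′ ] t ~ t′ × Slice t′ 0F ≈ᴹ E₂₂
  toE₂₂ t sing d≉0 with inverse _ d≉0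
  ... | e , de≈1 =
    act₂ 1# (- (t (1F , 0F , 0F) * e)) 0# 1# t₁ ,
    ~-trans (~-act₁ 1# (- (t (0F , 1F , 0F) * e)) 0# e t λ x → inverse≉0 de≈1 (trans
      (solve 2 #0 (:1 :* #0 :- :- (#1 :* #0) :* :0)) x))
            (~-act₂ 1# (- (t (1F , 0F , 0F) * e)) 0# 1# t₁ λ x → 1≉0 (trans
              (solve 2 :1 (:1 :* :1 :- :- (#0 :* #1) :* :0)) x)) ,
    mat≈ (combine (t (0F , 1F , 0F) * t (1F , 0F , 0F) * e - t (0F , 0F , 0F)) de≈1
           (combine e sing (solve 5 (:1 :* (:1 :* #0 :+ :- (#1 :* #2) :* #3) :+ :- (#3 :* #2) :* (:1
             :* #1 :+ :- (#1 :* #2) :* #4) :+ (#1 :* #3 :* #2 :- #0) :* :1 :+ #2 :* :0) (:0 :+ (#1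
             :* #3 :* #2 :- #0) :* (#4 :* #2) :+ #2 :* (#0 :* #4 :- #1 :* #3)))))
         (combine (- t (0F , 1F , 0F)) de≈1
           (solve 5 (:0 :* (:1 :* #0 :+ :- (#1 :* #2) :* #3) :+ :1 :* (:1 :* #1 :+ :- (#1 :* #2) :*
           #4) :+ :- #1 :* :1) (:0 :+ :- #1 :* (#4 :* #2))))
         (combine (- (t (1F , 0F , 0F) * e)) de≈1
           (solve 5 (:1 :* (:0 :* #0 :+ #1 :* #2) :+ :- (#2 :* #1) :* (:0 :* #3 :+ #1 :* #4) :+ :-
           (#2 :* #1) :* :1) (:0 :+ :- (#2 :* #1) :* (#4 :* #1))))
         (combine 1# de≈1 (solve 5 (:0 :* (:0 :* #0 :+ #1 :* #2) :+ :1 :* (:0 :* #3 :+ #1 :* #4) :+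
           :1 :* :1) (:1 :+ :1 :* (#4 :* #1))))
    where t₁ = act₁ 1# (- (t (0F , 1F , 0F) * e)) 0# e t

  singular⇒E₂₂ : ∀ t → det (Slice t 0F) ≈ 0# → ¬ Slice t 0F ≈ᴹ O →
                 ∃[ t′ ] t ~ t′ × Slice t′ 0F ≈ᴹ E₂₂
  singular⇒E₂₂ t sing t≉0 with t (1F , 1F , 0F) ≈0?
  ... | no d≉0 = toE₂₂ t sing d≉0
  ... | yes d≈0 with t (0F , 1F , 0F) ≈0?
  ...   | no b≉0 = let t′ , s , r = toE₂₂ (flip₁ t) (combine (- 1#) sing
                        (solve 4 (#0 :* #1 :- #2 :* #3 :+ :- :1 :* :0) (:0 :+ :- :1 :* (#3 :* #2 :-
                        #1 :* #0)))) b≉0 in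
                   t′ , ~-trans (~-flip₁ t) s , r
  ...   | yes b≈0 with t (1F , 0F , 0F) ≈0?
  ...     | no c≉0 = let t′ , s , r = toE₂₂ (flip₂ t) (combine (- 1#) sing
                          (solve 4 (#0 :* #1 :- #2 :* #3 :+ :- :1 :* :0) (:0 :+ :- :1 :* (#2 :* #3
                          :- #0 :* #1)))) c≉0 in
                     t′ , ~-trans (~-flip₂ t) s , r
  ...     | yes c≈0 with t (0F , 0F , 0F) ≈0?
  ...       | yes a≈0 = ⊥-elim (t≉0 (mat≈ a≈0 b≈0 c≈0 d≈0))
  ...       | no a≉0 = let t′ , s , r = toE₂₂ (flip₂ (flip₁ t)) (combine 1# sing
                            (solve 4 (#0 :* #1 :- #2 :* #3 :+ :1 :* :0) (:0 :+ :1 :* (#1 :* #0 :- #3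
                            :* #2)))) a≉0 in
                       t′ , ~-trans (~-trans (~-flip₁ t) (~-flip₂ (flip₁ t))) s , r

-- Normal forms of spaces that contain a matrix of rank one

module NormalForms {c ℓ} (F : Field c ℓ) (em : ExcludedMiddle (c ⊔ ℓ)) where
  open Field F hiding (zero)
  open FieldLemmas F
  open Moves F
  open Representatives F
  open Classification F em

  scaleRow₀ : (x s : Carrier) → Matrix → Matrix
  scaleRow₀ x s X 0F j = s * (x * X 0F j)
  scaleRow₀ x s X 1F j = s * X 1F j

  ~-scale : ∀ x p q r t → x ≉ 0# → p ≉ 0# → q ≉ 0# → r ≉ 0# → t ~
    slices (scaleRow₀ x p (Slice t 0F)) (scaleRow₀ x q (Slice t 1F)) (scaleRow₀ x r (Slice t 2F))
  ~-scale x p q r t x≉0 p≉0 q≉0 r≉0 = ~-trans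
    (~-act₁ x 0# 0# 1# t λ e → x≉0 (trans (solve 1 #0 (#0 :* :1 :- :0 :* :0)) e))
    (~-trans (~-act₃ p 0# 0# 0# q 0# 0# 0# r (act₁ x 0# 0# 1# t) λ e →
      *-≉0 p≉0 (*-≉0 q≉0 r≉0) (trans (solve 3 (#0 :* (#1 :* #2)) (#0 :* (#1 :* #2 :- :0 :* :0) :- :0
        :* (:0 :* #2 :- :0 :* :0) :+ :0 :* (:0 :* :0 :- #1 :* :0))) e))
    (≈⇒~ (slices≈
      (λ { 0F j → solve 8 (#0 :* (#1 :* #2 :+ :0 :* #3) :+ :0 :* (#1 :* #4 :+ :0 :* #5) :+ :0 :* (#1
        :* #6 :+ :0 :* #7)) (#0 :* (#1 :* #2)) ; 1F j → solve 7 (#0 :* (:0 :* #1 :+ :1 :* #2) :+ :0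
        :* (:0 :* #3 :+ :1 :* #4) :+ :0 :* (:0 :* #5 :+ :1 :* #6)) (#0 :* #2) })
      (λ { 0F j → solve 8 (:0 :* (#0 :* #1 :+ :0 :* #2) :+ #3 :* (#0 :* #4 :+ :0 :* #5) :+ :0 :* (#0
        :* #6 :+ :0 :* #7)) (#3 :* (#0 :* #4)) ; 1F j → solve 7 (:0 :* (:0 :* #0 :+ :1 :* #1) :+ #2
        :* (:0 :* #3 :+ :1 :* #4) :+ :0 :* (:0 :* #5 :+ :1 :* #6)) (#2 :* #4) })
      (λ { 0F j → solve 8 (:0 :* (#0 :* #1 :+ :0 :* #2) :+ :0 :* (#0 :* #3 :+ :0 :* #4) :+ #5 :* (#0
        :* #6 :+ :0 :* #7)) (#5 :* (#0 :* #6)) ; 1F j → solve 7 (:0 :* (:0 :* #0 :+ :1 :* #1) :+ :0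
        :* (:0 :* #2 :+ :1 :* #3) :+ #4 :* (:0 :* #5 :+ :1 :* #6)) (#4 :* #6) }))))

  ~-lower : ∀ y q z w t → q ≉ 0# → ∀ r → r ≉ 0# → t ~
    slices (Slice t 0F) (λ i j → y * t (i , j , 0F) + q * t (i , j , 1F))
           (λ i j → z * t (i , j , 0F) + w * t (i , j , 1F) + r * t (i , j , 2F))
  ~-lower y q z w t q≉0 r r≉0 = ~-trans
    (~-act₃ 1# 0# 0# y q 0# z w r t λ e → *-≉0 q≉0 r≉0 (trans
      (solve 5 (#0 :* #1) (:1 :* (#0 :* #1 :- :0 :* #2) :- :0 :* (#3 :* #1 :- :0 :* #4) :+ :0 :* (#3
      :* #2 :- #0 :* #4))) e))
    (≈⇒~ (slices≈ (λ _ _ → solve 3 (:1 :* #0 :+ :0 :* #1 :+ :0 :* #2) #0) (λ _ _ → solve 5 (#0 :* #1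
      :+ #2 :* #3 :+ :0 :* #4) (#0 :* #1 :+ #2 :* #3)) (λ _ _ → refl)))

  addRow addColumn : Carrier → Tensor → Tensor
  addRow x t (0F , j , k)    = t (0F , j , k)
  addRow x t (1F , j , k)    = t (1F , j , k) + x * t (0F , j , k)
  addColumn x t (i , 0F , k) = t (i , 0F , k)
  addColumn x t (i , 1F , k) = t (i , 1F , k) + x * t (i , 0F , k)

  ~-addRow : ∀ x t → t ~ addRow x t
  ~-addRow x t = ~-trans (~-act₁ 1# 0# x 1# t λ e → 1≉0 (trans (solve 1 :1 (:1 :* :1 :- :0 :* #0))
    e))
    (≈⇒~ {t = addRow x t} λ { (0F , j , k) → solve 2 (:1 :* #0 :+ :0 :* #1) #0 ; (1F , j , k) →
      solve 3 (#0 :* #1 :+ :1 :* #2) (#2 :+ #0 :* #1) })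

  ~-addColumn : ∀ x t → t ~ addColumn x t
  ~-addColumn x t = ~-trans (~-act₂ 1# 0# x 1# t λ e → 1≉0 (trans
    (solve 1 :1 (:1 :* :1 :- :0 :* #0)) e))
    (≈⇒~ {t = addColumn x t} λ { (i , 0F , k) → solve 2 (:1 :* #0 :+ :0 :* #1) #0 ; (i , 1F , k) →
      solve 3 (#0 :* #1 :+ :1 :* #2) (#2 :+ #0 :* #1) })

  module _ (b₀ : Carrier) where

    -- The condition on `n` is kept for algebraically closed fields, where index `8F` is left out of
    -- the count.
    Split : Tensor → Set (c ⊔ ℓ)
    Split t = ∃[ n ] n ≢ 8F × t ~ rep b₀ n

    split-trans : ∀ {s t} → s ~ t → Split t → Split s
    split-trans s~t (n , n≢8 , t~rep) = n , n≢8 , ~-trans s~t t~rep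

    -- The entry a is the pivot for b′ and c′. Since the upper left entries of the other two slices
    -- are zero, these operations change at most the lower right corner there, and multiples of E₂₂
    -- clear that corner in the last two slices.
    ~-E₂₂-E₁₁ : ∀ a e b c d b′ c′ d′ → a * e ≈ 1# →
      slices E₂₂ (mat 0# b c d) (mat a b′ c′ d′) ~ slices E₂₂ (mat 0# b c 0#) E₁₁
    ~-E₂₂-E₁₁ a e b c d b′ c′ d′ ae≈1 =
      ~-trans (~-addRow (- (c′ * e)) s)
      (~-trans (~-addColumn (- (b′ * e)) (addRow (- (c′ * e)) s))
      (~-trans (~-lower y 1# (e * z) 0# (addColumn (- (b′ * e)) (addRow (- (c′ * e)) s))
        1≉0 e (inverse≉0 ae≈1))
      (≈⇒~ {t = slices E₂₂ (mat 0# b c 0#) E₁₁} (slices≈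
        (mat≈ (solve 0 :0 :0) (solve 2 (:0 :+ :- (#0 :* #1) :* :0) :0)
          (solve 2 (:0 :+ :- (#0 :* #1) :* :0) :0)
          (solve 3 (:1 :+ :- (#0 :* #1) :* :0 :+ :- (#2 :* #1) :* (:0 :+ :- (#0 :* #1) :* :0)) :1))
        (mat≈ (solve 6 ((#0 :* #1 :* #2 :+ #3 :* #1 :* #4 :- #5) :* :0 :+ :1 :* :0) :0)
          (solve 6 ((#0 :* #1 :* #2 :+ #3 :* #1 :* #4 :- #5) :* (:0 :+ :- (#0 :* #1) :* :0) :+ :1 :*
          (#4 :+ :- (#0 :* #1) :* :0)) #4)
          (solve 6 ((#0 :* #1 :* #2 :+ #3 :* #1 :* #4 :- #5) :* (:0 :+ :- (#3 :* #1) :* :0) :+ :1 :*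
          (#2 :+ :- (#3 :* #1) :* :0)) #2)
          (solve 6 ((#0 :* #1 :* #2 :+ #3 :* #1 :* #4 :- #5) :* (:1 :+ :- (#3 :* #1) :* :0 :+ :- (#0
          :* #1) :* (:0 :+ :- (#3 :* #1) :* :0)) :+ :1 :* (#5 :+ :- (#3 :* #1) :* #4 :+ :- (#0 :*
          #1) :* (#2 :+ :- (#3 :* #1) :* :0))) :0))
        (mat≈ (combine 1# ae≈1 (solve 5 (#0 :* (#1 :* #0 :* #2 :+ #2 :* #0 :* #1 :- #3 :- #1 :* #0
          :* (#2 :* #0 :* #4)) :* :0 :+ :0 :* :0 :+ #0 :* #4 :+ :1 :* :1) (:1 :+ :1 :* (#4 :* #0))))
              (combine (- (b′ * e)) ae≈1 (solve 6 (#0 :* (#1 :* #0 :* #2 :+ #2 :* #0 :* #1 :- #3 :-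
                #1 :* #0 :* (#2 :* #0 :* #4)) :* (:0 :+ :- (#1 :* #0) :* :0) :+ :0 :* (#5 :+ :- (#1
                :* #0) :* :0) :+ #0 :* (#1 :+ :- (#1 :* #0) :* #4) :+ :- (#1 :* #0) :* :1) (:0 :+ :-
                (#1 :* #0) :* (#4 :* #0))))
              (combine (- (c′ * e)) ae≈1 (solve 6 (#0 :* (#1 :* #0 :* #2 :+ #2 :* #0 :* #1 :- #3 :-
                #1 :* #0 :* (#2 :* #0 :* #4)) :* (:0 :+ :- (#2 :* #0) :* :0) :+ :0 :* (#5 :+ :- (#2
                :* #0) :* :0) :+ #0 :* (#2 :+ :- (#2 :* #0) :* #4) :+ :- (#2 :* #0) :* :1) (:0 :+ :-
                (#2 :* #0) :* (#4 :* #0))))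
              (solve 8 (#0 :* (#1 :* #0 :* #2 :+ #2 :* #0 :* #1 :- #3 :- #1 :* #0 :* (#2 :* #0 :*
                #4)) :* (:1 :+ :- (#2 :* #0) :* :0 :+ :- (#1 :* #0) :* (:0 :+ :- (#2 :* #0) :* :0))
                :+ :0 :* (#5 :+ :- (#2 :* #0) :* #6 :+ :- (#1 :* #0) :* (#7 :+ :- (#2 :* #0) :* :0))
                :+ #0 :* (#3 :+ :- (#2 :* #0) :* #1 :+ :- (#1 :* #0) :* (#2 :+ :- (#2 :* #0) :*
                #4))) :0))))))
      where
      s = slices E₂₂ (mat 0# b c d) (mat a b′ c′ d′)
      y = b′ * e * c + c′ * e * b - d
      z = b′ * e * c′ + c′ * e * b′ - d′ - b′ * e * (c′ * e * a)

    split-E₂₂-E₁₁ : ∀ b c → Split (slices E₂₂ (mat 0# b c 0#) E₁₁)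
    split-E₂₂-E₁₁ b c with b ≈0? | c ≈0?
    ... | yes b≈0 | yes c≈0 = 4F , (λ ()) , ≈⇒~
      (slices≈ (λ _ _ → refl) (mat≈ refl b≈0 c≈0 refl) (λ _ _ → refl))
    ... | no b≉0 | yes c≈0 = let e , be≈1 = inverse b b≉0 in
      6F , (λ ()) , ~-trans
        (~-scale 1# 1# e 1# _ 1≉0 1≉0 (inverse≉0 be≈1) 1≉0)
        (≈⇒~ {t = rep b₀ 6F} (slices≈
          (mat≈ (solve 0 (:1 :* (:1 :* :0)) :0) (solve 0 (:1 :* (:1 :* :0)) :0)
            (solve 0 (:1 :* :0) :0) (solve 0 (:1 :* :1) :1))
          (mat≈ (solve 1 (#0 :* (:1 :* :0)) :0) (combine 1# be≈1
            (solve 2 (#0 :* (:1 :* #1) :+ :1 :* :1) (:1 :+ :1 :* (#1 :* #0)))) (combine e c≈0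
            (solve 2 (#0 :* #1 :+ #0 :* :0) (:0 :+ #0 :* #1))) (solve 1 (#0 :* :0) :0))
          (mat≈ (solve 0 (:1 :* (:1 :* :1)) :1) (solve 0 (:1 :* (:1 :* :0)) :0)
            (solve 0 (:1 :* :0) :0) (solve 0 (:1 :* :0) :0))))
    ... | yes b≈0 | no c≉0 = let e , ce≈1 = inverse c c≉0 in
      6F , (λ ()) , ~-trans
        (~-scale 1# 1# e 1# _ 1≉0 1≉0 (inverse≉0 ce≈1) 1≉0)
        -- Exchanging both rows and columns turns E₂₁ into E₁₂; it also swaps E₁₁ and E₂₂, which
        -- exchanging the outer slices undoes.
        (~-trans (~-flip₁ _) (~-trans (~-flip₂ _) (~-trans (~-transpose₀₂ _)
        (≈⇒~ {t = rep b₀ 6F} (slices≈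
          (mat≈ (solve 0 (:1 :* :0) :0) (solve 0 (:1 :* :0) :0) (solve 0 (:1 :* (:1 :* :0)) :0)
            (solve 0 (:1 :* (:1 :* :1)) :1))
          (mat≈ (solve 1 (#0 :* :0) :0) (combine 1# ce≈1
            (solve 2 (#0 :* #1 :+ :1 :* :1) (:1 :+ :1 :* (#1 :* #0)))) (combine e b≈0
            (solve 2 (#0 :* (:1 :* #1) :+ #0 :* :0) (:0 :+ #0 :* #1)))
            (solve 1 (#0 :* (:1 :* :0)) :0))
          (mat≈ (solve 0 (:1 :* :1) :1) (solve 0 (:1 :* :0) :0) (solve 0 (:1 :* (:1 :* :0)) :0)
            (solve 0 (:1 :* (:1 :* :0)) :0)))))))
    ... | no b≉0 | no c≉0 =
      let e , be≈1 = inverse b b≉0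
          f , cf≈1 = inverse c c≉0
      in 7F , (λ ()) , ~-trans
        -- The first row times c/b makes the off-diagonal entries equal; the slices are then
        -- rescaled by 1, 1/c and b/c.
        (~-scale (c * e) 1# f (b * f) _ (*-≉0 c≉0 (inverse≉0 be≈1)) 1≉0
          (inverse≉0 cf≈1) (*-≉0 b≉0 (inverse≉0 cf≈1)))
        (≈⇒~ {t = rep b₀ 7F} (slices≈
          (mat≈ (solve 2 (:1 :* (#0 :* #1 :* :0)) :0) (solve 2 (:1 :* (#0 :* #1 :* :0)) :0)
            (solve 0 (:1 :* :0) :0) (solve 0 (:1 :* :1) :1))
          (mat≈ (solve 3 (#0 :* (#1 :* #2 :* :0)) :0) (combine (c * f) be≈1 (combine 1# cf≈1
            (solve 4 (#0 :* (#1 :* #2 :* #3) :+ #1 :* #0 :* :1 :+ :1 :* :1) (:1 :+ #1 :* #0 :* (#3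
            :* #2) :+ :1 :* (#1 :* #0))))) (combine 1# cf≈1
            (solve 2 (#0 :* #1 :+ :1 :* :1) (:1 :+ :1 :* (#1 :* #0)))) (solve 1 (#0 :* :0) :0))
          (mat≈ (combine (c * f) be≈1 (combine 1# cf≈1
            (solve 4 (#0 :* #1 :* (#2 :* #3 :* :1) :+ #2 :* #1 :* :1 :+ :1 :* :1) (:1 :+ #2 :* #1 :*
            (#0 :* #3) :+ :1 :* (#2 :* #1))))) (solve 4 (#0 :* #1 :* (#2 :* #3 :* :0)) :0)
            (solve 2 (#0 :* #1 :* :0) :0) (solve 2 (#0 :* #1 :* :0) :0))))

    split-E₂₂-O : ∀ d b c d′ → Split (slices E₂₂ (mat 0# 0# 0# d) (mat 0# b c d′))
    split-E₂₂-O d b c d′ = split-trans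
      (~-trans (~-lower (- d) 1# (- d′) 0# _ 1≉0 1# 1≉0)
        (≈⇒~ {t = slices E₂₂ O (mat 0# b c 0#)} (slices≈
          (mat≈ (solve 0 :0 :0) (solve 0 :0 :0) (solve 0 :0 :0) (solve 0 :1 :1)) (mat≈
            (solve 1 (:- #0 :* :0 :+ :1 :* :0) :0) (solve 1 (:- #0 :* :0 :+ :1 :* :0) :0)
            (solve 1 (:- #0 :* :0 :+ :1 :* :0) :0) (solve 1 (:- #0 :* :1 :+ :1 :* #0) :0))
          (mat≈ (solve 1 (:- #0 :* :0 :+ :0 :* :0 :+ :1 :* :0) :0)
            (solve 2 (:- #0 :* :0 :+ :0 :* :0 :+ :1 :* #1) #1)
            (solve 2 (:- #0 :* :0 :+ :0 :* :0 :+ :1 :* #1) #1)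
            (solve 2 (:- #0 :* :1 :+ :0 :* #1 :+ :1 :* #0) :0)))))
      reduced
      where
      reduced : Split (slices E₂₂ O (mat 0# b c 0#))
      reduced with b ≈0? | c ≈0?
      ... | yes b≈0 | yes c≈0 = 1F , (λ ()) , ≈⇒~
        (slices≈ (λ _ _ → refl) (λ _ _ → refl) (mat≈ refl b≈0 c≈0 refl))
      ... | no b≉0 | yes c≈0 = let e , be≈1 = inverse b b≉0 in
        9F , (λ ()) , ~-trans
          (~-scale 1# 1# 1# e _ 1≉0 1≉0 1≉0 (inverse≉0 be≈1))
          (≈⇒~ {t = rep b₀ 9F} (slices≈
            (mat≈ (solve 0 (:1 :* (:1 :* :0)) :0) (solve 0 (:1 :* (:1 :* :0)) :0)
              (solve 0 (:1 :* :0) :0) (solve 0 (:1 :* :1) :1))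
            (mat≈ (solve 0 (:1 :* (:1 :* :0)) :0) (solve 0 (:1 :* (:1 :* :0)) :0)
              (solve 0 (:1 :* :0) :0) (solve 0 (:1 :* :0) :0))
            (mat≈ (solve 1 (#0 :* (:1 :* :0)) :0) (combine 1# be≈1
              (solve 2 (#0 :* (:1 :* #1) :+ :1 :* :1) (:1 :+ :1 :* (#1 :* #0)))) (combine e c≈0
              (solve 2 (#0 :* #1 :+ #0 :* :0) (:0 :+ #0 :* #1))) (solve 1 (#0 :* :0) :0))))
      ... | yes b≈0 | no c≉0 = let e , ce≈1 = inverse c c≉0 in
        3F , (λ ()) , ~-trans
          (~-scale 1# 1# 1# e _ 1≉0 1≉0 1≉0 (inverse≉0 ce≈1))
          (≈⇒~ {t = rep b₀ 3F} (slices≈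
            (mat≈ (solve 0 (:1 :* (:1 :* :0)) :0) (solve 0 (:1 :* (:1 :* :0)) :0)
              (solve 0 (:1 :* :0) :0) (solve 0 (:1 :* :1) :1))
            (mat≈ (solve 0 (:1 :* (:1 :* :0)) :0) (solve 0 (:1 :* (:1 :* :0)) :0)
              (solve 0 (:1 :* :0) :0) (solve 0 (:1 :* :0) :0))
            (mat≈ (solve 1 (#0 :* (:1 :* :0)) :0) (combine e b≈0
              (solve 2 (#0 :* (:1 :* #1) :+ #0 :* :0) (:0 :+ #0 :* #1))) (combine 1# ce≈1
              (solve 2 (#0 :* #1 :+ :1 :* :1) (:1 :+ :1 :* (#1 :* #0)))) (solve 1 (#0 :* :0) :0))))
      ... | no b≉0 | no c≉0 =
        let e , be≈1 = inverse b b≉0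
            f , cf≈1 = inverse c c≉0
        in 5F , (λ ()) , ~-trans
          (~-scale (c * e) 1# 1# f _ (*-≉0 c≉0 (inverse≉0 be≈1)) 1≉0 1≉0 (inverse≉0 cf≈1))
          (≈⇒~ {t = rep b₀ 5F} (slices≈
            (mat≈ (solve 2 (:1 :* (#0 :* #1 :* :0)) :0) (solve 2 (:1 :* (#0 :* #1 :* :0)) :0)
              (solve 0 (:1 :* :0) :0) (solve 0 (:1 :* :1) :1))
            (mat≈ (solve 2 (:1 :* (#0 :* #1 :* :0)) :0) (solve 2 (:1 :* (#0 :* #1 :* :0)) :0)
              (solve 0 (:1 :* :0) :0) (solve 0 (:1 :* :0) :0))
            (mat≈ (solve 3 (#0 :* (#1 :* #2 :* :0)) :0) (combine (c * f) be≈1 (combine 1# cf≈1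
              (solve 4 (#0 :* (#1 :* #2 :* #3) :+ #1 :* #0 :* :1 :+ :1 :* :1) (:1 :+ #1 :* #0 :* (#3
              :* #2) :+ :1 :* (#1 :* #0))))) (combine 1# cf≈1
              (solve 2 (#0 :* #1 :+ :1 :* :1) (:1 :+ :1 :* (#1 :* #0)))) (solve 1 (#0 :* :0) :0))))

    split-E₂₂-E₂₁ : ∀ c d b c′ d′ → c ≉ 0# →
      Split (slices E₂₂ (mat 0# 0# c d) (mat 0# b c′ d′))
    split-E₂₂-E₂₁ c d b c′ d′ c≉0 with inverse c c≉0
    ... | e , ce≈1 = split-trans
      (~-trans (~-lower (- (e * d)) e (c′ * e * d - d′) (- (c′ * e)) _ (inverse≉0 ce≈1) 1# 1≉0)
        (≈⇒~ {t = slices E₂₂ E₂₁ (mat 0# b 0# 0#)} (slices≈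
          (mat≈ (solve 0 :0 :0) (solve 0 :0 :0) (solve 0 :0 :0) (solve 0 :1 :1))
          (mat≈ (solve 2 (:- (#0 :* #1) :* :0 :+ #0 :* :0) :0)
            (solve 2 (:- (#0 :* #1) :* :0 :+ #0 :* :0) :0) (combine 1# ce≈1
            (solve 3 (:- (#0 :* #1) :* :0 :+ #0 :* #2 :+ :1 :* :1) (:1 :+ :1 :* (#2 :* #0))))
            (solve 2 (:- (#0 :* #1) :* :1 :+ #0 :* #1) :0))
          (mat≈ (solve 4 ((#0 :* #1 :* #2 :- #3) :* :0 :+ :- (#0 :* #1) :* :0 :+ :1 :* :0) :0)
            (solve 5 ((#0 :* #1 :* #2 :- #3) :* :0 :+ :- (#0 :* #1) :* :0 :+ :1 :* #4) #4) (combine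
            (- c′) ce≈1 (solve 5 ((#0 :* #1 :* #2 :- #3) :* :0 :+ :- (#0 :* #1) :* #4 :+ :1 :* #0 :+
            :- #0 :* :1) (:0 :+ :- #0 :* (#4 :* #1))))
            (solve 4 ((#0 :* #1 :* #2 :- #3) :* :1 :+ :- (#0 :* #1) :* #2 :+ :1 :* #3) :0)))))
      reduced
      where
      reduced : Split (slices E₂₂ E₂₁ (mat 0# b 0# 0#))
      reduced with b ≈0?
      ... | yes b≈0 = 3F , (λ ()) , ~-trans (~-transpose₁₂ _)
        (≈⇒~ (slices≈ (λ _ _ → refl) (mat≈ refl b≈0 refl refl) (λ _ _ → refl)))
      ... | no b≉0 = let f , bf≈1 = inverse b b≉0 in
        6F , (λ ()) , ~-trans (~-scale 1# 1# 1# f _ 1≉0 1≉0 1≉0 (inverse≉0 bf≈1))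
          -- Exchanging the rows turns E₂₂, E₂₁, E₁₂ into E₁₂, E₁₁, E₂₂, which span the upper
          -- triangular matrices.
          (~-trans (~-flip₁ _) (~-trans (~-transpose₀₁ _) (~-trans (~-transpose₀₂ _)
          (≈⇒~ {t = rep b₀ 6F} (slices≈
            (mat≈ (solve 1 (#0 :* :0) :0) (solve 1 (#0 :* :0) :0) (solve 1 (#0 :* (:1 :* :0)) :0)
              (combine 1# bf≈1 (solve 2 (#0 :* (:1 :* #1) :+ :1 :* :1) (:1 :+ :1 :* (#1 :* #0)))))
            (mat≈ (solve 0 (:1 :* :0) :0) (solve 0 (:1 :* :1) :1) (solve 0 (:1 :* (:1 :* :0)) :0)
              (solve 0 (:1 :* (:1 :* :0)) :0))
            (mat≈ (solve 0 (:1 :* :1) :1) (solve 0 (:1 :* :0) :0) (solve 0 (:1 :* (:1 :* :0)) :0)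
              (solve 0 (:1 :* (:1 :* :0)) :0)))))))

    -- The main distinction is whether the image contains a matrix with nonzero upper left entry;
    -- after elimination, that entry of the last slice tells. If it is zero too, the upper right
    -- entry of the middle slice can be eliminated as well.
    E₂₂⇒split : ∀ t → Slice t 0F ≈ᴹ E₂₂ → Split t
    E₂₂⇒split t t₀ with eliminate₁ t 0F 0F
    ... | t₁ , t~t₁ , a≈0 , _ , same with t₁ (0F , 0F , 2F) ≈0?
    ...   | no a′≉0 = let e , eq = inverse _ a′≉0 in split-trans
      (~-trans t~t₁ (~-trans
        (≈⇒~ {t = slices E₂₂
            (mat 0# (t₁ (0F , 1F , 1F)) (t₁ (1F , 0F , 1F)) (t₁ (1F , 1F , 1F)))
            (mat (t₁ (0F , 0F , 2F)) (t₁ (0F , 1F , 2F)) (t₁ (1F , 0F , 2F)) (t₁ (1F , 1F , 2F)))}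
          (slices≈ (λ i j → trans (same i j) (t₀ i j))
                   (mat≈ a≈0 refl refl refl) (mat≈ refl refl refl refl)))
        (~-E₂₂-E₁₁ _ e _ _ _ _ _ _ eq)))
      (split-E₂₂-E₁₁ _ _)
    ...   | yes a′≈0 with eliminate₁ t₁ 0F 1F
    ...     | t₂ , t₁~t₂ , b≈0 , pres , same′ with pres 0F 0F a≈0 a′≈0
    ...       | a₂≈0 , a₂′≈0 = split-trans
      (~-trans t~t₁ (~-trans t₁~t₂
        (≈⇒~ {t = slices E₂₂
            (mat 0# 0# (t₂ (1F , 0F , 1F)) (t₂ (1F , 1F , 1F)))
            (mat 0# (t₂ (0F , 1F , 2F)) (t₂ (1F , 0F , 2F)) (t₂ (1F , 1F , 2F)))}
          (slices≈ (λ i j → trans (same′ i j) (trans (same i j) (t₀ i j)))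
                   (mat≈ a₂≈0 b≈0 refl refl) (mat≈ a₂′≈0 refl refl refl)))))
      reduced
      where
      reduced : Split (slices E₂₂
            (mat 0# 0# (t₂ (1F , 0F , 1F)) (t₂ (1F , 1F , 1F)))
            (mat 0# (t₂ (0F , 1F , 2F)) (t₂ (1F , 0F , 2F)) (t₂ (1F , 1F , 2F))))
      reduced with t₂ (1F , 0F , 1F) ≈0?
      ... | no c≉0  = split-E₂₂-E₂₁ _ _ _ _ _ c≉0
      ... | yes c≈0 = split-trans
        (≈⇒~ {t = slices E₂₂
            (mat 0# 0# 0# (t₂ (1F , 1F , 1F)))
            (mat 0# (t₂ (0F , 1F , 2F)) (t₂ (1F , 0F , 2F)) (t₂ (1F , 1F , 2F)))}
          (slices≈ (λ _ _ → refl) (mat≈ refl refl c≈0 refl) (λ _ _ → refl)))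
        (split-E₂₂-O _ _ _ _)

-- Spaces without nonzero singular matrices

module Companions {c ℓ} (F : Field c ℓ) (em : ExcludedMiddle (c ⊔ ℓ)) where
  open Field F hiding (zero)
  open FieldLemmas F
  open Moves F
  open Representatives F
  open Classification F em
  open NormalForms F em

  -- For a quadratic, irreducibility is the absence of roots; the polynomial is X² + d X - b = det
  -- (X I + C) for the companion matrix C.
  Irreducible : (b d : Carrier) → Set (c ⊔ ℓ)
  Irreducible b d = ∀ x → x * x + d * x ≉ b

  -- x ↦ u + v x turns a root of X² - d X - b into one of X² - d′ X - b′.
  ~-companion : ∀ b d b′ d′ u v → v ≉ 0# → d′ ≈ u + u + v * d →
                b′ ≈ v * v * b - u * u - u * v * d → companion b d ~ companion b′ d′
  ~-companion b d b′ d′ u v v≉0 d′≈ b′≈ with inverse v v≉0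
  ... | w , vw≈1 =
    ~-trans (~-act₃ 1# 0# 0# 0# 1# 0# 0# u v s λ x → v≉0 (trans
      (solve 2 #0 (:1 :* (:1 :* #0 :- :0 :* #1) :- :0 :* (:0 :* #0 :- :0 :* :0) :+ :0 :* (:0 :* #1
      :- :1 :* :0))) x))
    -- This row operation and the following column operation are inverse to each other as matrix
    -- factors, so together they conjugate: I is fixed, and u I + v C gets companion form.
    (~-trans (~-act₁ 1# (- (u * w)) 0# w s₁ λ x → inverse≉0 vw≈1 (trans
      (solve 2 #0 (:1 :* #0 :- :- (#1 :* #0) :* :0)) x))
    (~-trans (~-act₂ 1# 0# u v s₂ λ x → v≉0 (trans (solve 2 #0 (:1 :* #0 :- :0 :* #1)) x))
    (≈⇒~ {t = companion b′ d′} (slices≈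
      (mat≈ (solve 4 (:1 :* (:1 :* (:1 :* :0 :+ :0 :* :1 :+ :0 :* :0) :+ :- (#0 :* #1) :* (:1 :* :0
        :+ :0 :* :0 :+ :0 :* :1)) :+ :0 :* (:1 :* (:1 :* :0 :+ :0 :* :0 :+ :0 :* #2) :+ :- (#0 :*
        #1) :* (:1 :* :0 :+ :0 :* :1 :+ :0 :* #3))) :0)
        (solve 5 (#0 :* (:1 :* (:1 :* :0 :+ :0 :* :1 :+ :0 :* :0) :+ :- (#0 :* #1) :* (:1 :* :0 :+
        :0 :* :0 :+ :0 :* :1)) :+ #2 :* (:1 :* (:1 :* :0 :+ :0 :* :0 :+ :0 :* #3) :+ :- (#0 :* #1)
        :* (:1 :* :0 :+ :0 :* :1 :+ :0 :* #4))) :0)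
        (solve 3 (:1 :* (:0 :* (:1 :* :0 :+ :0 :* :1 :+ :0 :* :0) :+ #0 :* (:1 :* :0 :+ :0 :* :0 :+
        :0 :* :1)) :+ :0 :* (:0 :* (:1 :* :0 :+ :0 :* :0 :+ :0 :* #1) :+ #0 :* (:1 :* :0 :+ :0 :* :1
        :+ :0 :* #2))) :0) (solve 5 (#0 :* (:0 :* (:1 :* :0 :+ :0 :* :1 :+ :0 :* :0) :+ #1 :* (:1 :*
        :0 :+ :0 :* :0 :+ :0 :* :1)) :+ #2 :* (:0 :* (:1 :* :0 :+ :0 :* :0 :+ :0 :* #3) :+ #1 :* (:1
        :* :0 :+ :0 :* :1 :+ :0 :* #4))) :0))
      (mat≈ (solve 4 (:1 :* (:1 :* (:0 :* :0 :+ :1 :* :1 :+ :0 :* :0) :+ :- (#0 :* #1) :* (:0 :* :0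
        :+ :1 :* :0 :+ :0 :* :1)) :+ :0 :* (:1 :* (:0 :* :0 :+ :1 :* :0 :+ :0 :* #2) :+ :- (#0 :*
        #1) :* (:0 :* :0 :+ :1 :* :1 :+ :0 :* #3))) :1) (combine (- u) vw≈1
        (solve 5 (#0 :* (:1 :* (:0 :* :0 :+ :1 :* :1 :+ :0 :* :0) :+ :- (#0 :* #1) :* (:0 :* :0 :+
        :1 :* :0 :+ :0 :* :1)) :+ #2 :* (:1 :* (:0 :* :0 :+ :1 :* :0 :+ :0 :* #3) :+ :- (#0 :* #1)
        :* (:0 :* :0 :+ :1 :* :1 :+ :0 :* #4)) :+ :- #0 :* :1) (:0 :+ :- #0 :* (#2 :* #1))))
        (solve 3 (:1 :* (:0 :* (:0 :* :0 :+ :1 :* :1 :+ :0 :* :0) :+ #0 :* (:0 :* :0 :+ :1 :* :0 :+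
        :0 :* :1)) :+ :0 :* (:0 :* (:0 :* :0 :+ :1 :* :0 :+ :0 :* #1) :+ #0 :* (:0 :* :0 :+ :1 :* :1
        :+ :0 :* #2))) :0) (combine 1# vw≈1
        (solve 5 (#0 :* (:0 :* (:0 :* :0 :+ :1 :* :1 :+ :0 :* :0) :+ #1 :* (:0 :* :0 :+ :1 :* :0 :+
        :0 :* :1)) :+ #2 :* (:0 :* (:0 :* :0 :+ :1 :* :0 :+ :0 :* #3) :+ #1 :* (:0 :* :0 :+ :1 :* :1
        :+ :0 :* #4)) :+ :1 :* :1) (:1 :+ :1 :* (#2 :* #1)))))
      (mat≈ (combine (- u) vw≈1 (solve 5 (:1 :* (:1 :* (:0 :* :0 :+ #0 :* :1 :+ #1 :* :0) :+ :- (#0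
        :* #2) :* (:0 :* :0 :+ #0 :* :0 :+ #1 :* :1)) :+ :0 :* (:1 :* (:0 :* :0 :+ #0 :* :0 :+ #1 :*
        #3) :+ :- (#0 :* #2) :* (:0 :* :0 :+ #0 :* :1 :+ #1 :* #4)) :+ :- #0 :* :1) (:0 :+ :- #0 :*
        (#1 :* #2))))
            (combine (- 1#) b′≈ (combine (- (u * u) - u * u - u * v * d) vw≈1
              (solve 6 (#0 :* (:1 :* (:0 :* :0 :+ #0 :* :1 :+ #1 :* :0) :+ :- (#0 :* #2) :* (:0 :*
              :0 :+ #0 :* :0 :+ #1 :* :1)) :+ #1 :* (:1 :* (:0 :* :0 :+ #0 :* :0 :+ #1 :* #3) :+ :-
              (#0 :* #2) :* (:0 :* :0 :+ #0 :* :1 :+ #1 :* #4)) :+ :- :1 :* (#1 :* #1 :* #3 :- #0 :*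
              #0 :- #0 :* #1 :* #4) :+ (:- (#0 :* #0) :- #0 :* #0 :- #0 :* #1 :* #4) :* :1) (#5 :+
              :- :1 :* #5 :+ (:- (#0 :* #0) :- #0 :* #0 :- #0 :* #1 :* #4) :* (#1 :* #2)))))
            (combine 1# vw≈1 (solve 5 (:1 :* (:0 :* (:0 :* :0 :+ #0 :* :1 :+ #1 :* :0) :+ #2 :* (:0
              :* :0 :+ #0 :* :0 :+ #1 :* :1)) :+ :0 :* (:0 :* (:0 :* :0 :+ #0 :* :0 :+ #1 :* #3) :+
              #2 :* (:0 :* :0 :+ #0 :* :1 :+ #1 :* #4)) :+ :1 :* :1) (:1 :+ :1 :* (#1 :* #2))))
            (combine (- 1#) d′≈ (combine (u + u + v * d) vw≈1
              (solve 6 (#0 :* (:0 :* (:0 :* :0 :+ #0 :* :1 :+ #1 :* :0) :+ #2 :* (:0 :* :0 :+ #0 :*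
              :0 :+ #1 :* :1)) :+ #1 :* (:0 :* (:0 :* :0 :+ #0 :* :0 :+ #1 :* #3) :+ #2 :* (:0 :* :0
              :+ #0 :* :1 :+ #1 :* #4)) :+ :- :1 :* (#0 :+ #0 :+ #1 :* #4) :+ (#0 :+ #0 :+ #1 :* #4)
              :* :1) (#5 :+ :- :1 :* #5 :+ (#0 :+ #0 :+ #1 :* #4) :* (#1 :* #2))))))))))
    where
    s  = companion b d
    s₁ = act₃ 1# 0# 0# 0# 1# 0# 0# u v s
    s₂ = act₁ 1# (- (u * w)) 0# w s₁

  module _ (b₀ : Carrier) where

    -- A nonzero ξ extends to a basis, so T(ξ) is the zeroth slice of an equivalent tensor.
    -- Quantifying over the orbit lets the condition be applied directly after any move.
    SingularOnlyIfZero : Tensor → Set (c ⊔ ℓ)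
    SingularOnlyIfZero t = ∀ t′ → t ~ t′ → det (Slice t′ 0F) ≈ 0# → Slice t′ 0F ≈ᴹ O

    zeroᴹ? : (X : Matrix) → Dec (X ≈ᴹ O)
    zeroᴹ? X = map′ lower lift (em {Lift c (X ≈ᴹ O)})

    -- A root x makes x I + C singular, and its entry 1 below the diagonal shows that it is not
    -- zero. The move brings this matrix to the zeroth slice.
    companion-irreducible : ∀ {t b d} → SingularOnlyIfZero t → t ~ companion b d → Irreducible b d
    companion-irreducible {t} {b} {d} only t~ x eq = 1≉0 (trans
      (solve 1 :1 (:0 :* :0 :+ #0 :* :0 :+ :1 :* :1)) (only
      (act₃ 0# x 1# 0# 1# 0# 1# 0# 0# (companion b d))
      (~-trans t~ (~-act₃ 0# x 1# 0# 1# 0# 1# 0# 0# (companion b d)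
        λ y → -1≉0 (trans (solve 1 (:- :1) (:0 :* (:1 :* :0 :- :0 :* :0) :- #0 :* (:0 :* :0 :- :0 :*
          :1) :+ :1 :* (:0 :* :0 :- :1 :* :1))) y)))
      (combine 1# eq (solve 3 ((:0 :* :0 :+ #0 :* :1 :+ :1 :* :0) :* (:0 :* :0 :+ #0 :* :1 :+ :1 :*
        #1) :- (:0 :* :0 :+ #0 :* :0 :+ :1 :* #2) :* (:0 :* :0 :+ #0 :* :0 :+ :1 :* :1) :+ :1 :* #2)
        (:0 :+ :1 :* (#0 :* #0 :+ #1 :* #0)))) 1F 0F))

    rank-two⇒identity : ∀ X Y → det X ≉ 0# → ∃[ Y′ ] slices O X Y ~ slices O I Y′
    rank-two⇒identity X Y det≉0 with inverse (det X) det≉0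
    ... | e , eq = _ , ~-trans
      (~-act₁ (e * X 1F 1F) (- (e * X 0F 1F)) (- (e * X 1F 0F)) (e * X 0F 0F) (slices O X Y)
        λ x → inverse≉0 eq (combine (- e) eq (combine 1# x
          (solve 5 (#0 :+ :- #0 :* :1 :+ :1 :* :0) (:0 :+ :- #0 :* ((#1 :* #2 :- #3 :* #4) :* #0) :+
          :1 :* (#0 :* #2 :* (#0 :* #1) :- :- (#0 :* #3) :* :- (#0 :* #4)))))))
      (≈⇒~ {t = slices O I Y′} (slices≈
        (mat≈ (solve 3 (#0 :* #1 :* :0 :+ :- (#0 :* #2) :* :0) :0)
          (solve 3 (#0 :* #1 :* :0 :+ :- (#0 :* #2) :* :0) :0)
          (solve 3 (:- (#0 :* #1) :* :0 :+ #0 :* #2 :* :0) :0)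
          (solve 3 (:- (#0 :* #1) :* :0 :+ #0 :* #2 :* :0) :0))
        (mat≈ (combine 1# eq (solve 5 (#0 :* #1 :* #2 :+ :- (#0 :* #3) :* #4 :+ :1 :* :1) (:1 :+ :1
          :* ((#2 :* #1 :- #3 :* #4) :* #0)))) (solve 3 (#0 :* #1 :* #2 :+ :- (#0 :* #2) :* #1) :0)
          (solve 3 (:- (#0 :* #1) :* #2 :+ #0 :* #2 :* #1) :0) (combine 1# eq
          (solve 5 (:- (#0 :* #1) :* #2 :+ #0 :* #3 :* #4 :+ :1 :* :1) (:1 :+ :1 :* ((#3 :* #4 :- #2
          :* #1) :* #0)))))
        (λ _ _ → refl)))
      where Y′ = Slice (act₁ (e * X 1F 1F) (- (e * X 0F 1F)) (- (e * X 1F 0F)) (e * X 0F 0F)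
                         (slices O X Y)) 2F

    ~-subtract-identity : ∀ Z →
      slices O I Z ~ slices O I (mat 0# (Z 0F 1F) (Z 1F 0F) (Z 1F 1F - Z 0F 0F))
    ~-subtract-identity Z = ~-trans
      (~-act₃ 1# 0# 0# 0# 1# 0# 0# (- Z 0F 0F) 1# (slices O I Z) λ x → 1≉0 (trans
        (solve 1 :1 (:1 :* (:1 :* :1 :- :0 :* :- #0) :- :0 :* (:0 :* :1 :- :0 :* :0) :+ :0 :* (:0 :*
        :- #0 :- :1 :* :0))) x))
      (≈⇒~ (slices≈
        (mat≈ (solve 1 (:1 :* :0 :+ :0 :* :1 :+ :0 :* #0) :0)
          (solve 1 (:1 :* :0 :+ :0 :* :0 :+ :0 :* #0) :0)
          (solve 1 (:1 :* :0 :+ :0 :* :0 :+ :0 :* #0) :0)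
          (solve 1 (:1 :* :0 :+ :0 :* :1 :+ :0 :* #0) :0))
        (mat≈ (solve 1 (:0 :* :0 :+ :1 :* :1 :+ :0 :* #0) :1)
          (solve 1 (:0 :* :0 :+ :1 :* :0 :+ :0 :* #0) :0)
          (solve 1 (:0 :* :0 :+ :1 :* :0 :+ :0 :* #0) :0)
          (solve 1 (:0 :* :0 :+ :1 :* :1 :+ :0 :* #0) :1))
        (mat≈ (solve 1 (:0 :* :0 :+ :- #0 :* :1 :+ :1 :* #0) :0)
          (solve 2 (:0 :* :0 :+ :- #0 :* :0 :+ :1 :* #1) #1)
          (solve 2 (:0 :* :0 :+ :- #0 :* :0 :+ :1 :* #1) #1)
          (solve 2 (:0 :* :0 :+ :- #0 :* :1 :+ :1 :* #1) (#1 :- #0)))))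

    Nonsplit : Tensor → Set (c ⊔ ℓ)
    Nonsplit t = ∃[ b ] ∃[ d ] SingularOnlyIfZero t × t ~ companion b d

    module _ (t : Tensor) (only : SingularOnlyIfZero t) where

      identity-slice : ∀ b c d → t ~ slices O I (mat 0# b c d) → Split b₀ t ⊎ Nonsplit t
      identity-slice b c d t~ with c ≈0?
      ... | no c≉0 = let e , ce≈1 = inverse c c≉0 in inj₂ (b * e , d * e , only , ~-trans t~
        (~-trans (~-act₃ 1# 0# 0# 0# 1# 0# 0# 0# e (slices O I (mat 0# b c d))
          λ x → inverse≉0 ce≈1 (trans (solve 1 #0 (:1 :* (:1 :* #0 :- :0 :* :0) :- :0 :* (:0 :* #0
            :- :0 :* :0) :+ :0 :* (:0 :* :0 :- :1 :* :0))) x))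
        (≈⇒~ {t = companion (b * e) (d * e)} (slices≈
          (mat≈ (solve 0 (:1 :* :0 :+ :0 :* :1 :+ :0 :* :0) :0)
            (solve 1 (:1 :* :0 :+ :0 :* :0 :+ :0 :* #0) :0)
            (solve 1 (:1 :* :0 :+ :0 :* :0 :+ :0 :* #0) :0)
            (solve 1 (:1 :* :0 :+ :0 :* :1 :+ :0 :* #0) :0))
          (mat≈ (solve 0 (:0 :* :0 :+ :1 :* :1 :+ :0 :* :0) :1)
            (solve 1 (:0 :* :0 :+ :1 :* :0 :+ :0 :* #0) :0)
            (solve 1 (:0 :* :0 :+ :1 :* :0 :+ :0 :* #0) :0)
            (solve 1 (:0 :* :0 :+ :1 :* :1 :+ :0 :* #0) :1))
          (mat≈ (solve 1 (:0 :* :0 :+ :0 :* :1 :+ #0 :* :0) :0)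
            (solve 2 (:0 :* :0 :+ :0 :* :0 :+ #0 :* #1) (#1 :* #0)) (combine 1# ce≈1
            (solve 2 (:0 :* :0 :+ :0 :* :0 :+ #0 :* #1 :+ :1 :* :1) (:1 :+ :1 :* (#1 :* #0))))
            (solve 2 (:0 :* :0 :+ :0 :* :1 :+ #0 :* #1) (#1 :* #0)))))))
      -- For c = 0 the last slice is singular, hence zero, and only the line spanned by I remains.
      ... | yes c≈0 = inj₁ (2F , (λ ()) , ~-trans t~
        (≈⇒~ (slices≈ (λ _ _ → refl) (λ _ _ → refl)
          (only (slices (mat 0# b c d) I O) (~-trans t~ (~-transpose₀₂ _))
            (combine (- b) c≈0 (solve 3 (:0 :* #0 :- #1 :* #2 :+ :- #1 :* :0) (:0 :+ :- #1 :*
              #2)))))))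

      nonzero-slice : ∀ X Y → ¬ X ≈ᴹ O → t ~ slices O X Y → Split b₀ t ⊎ Nonsplit t
      nonzero-slice X Y X≉O t~ =
        let Z , s~ = rank-two⇒identity X Y detX≉0
        in identity-slice (Z 0F 1F) (Z 1F 0F) (Z 1F 1F - Z 0F 0F)
             (~-trans t~ (~-trans s~ (~-subtract-identity Z)))
        where
        detX≉0 : det X ≉ 0#
        detX≉0 detX≈0 = X≉O (only (slices X O Y)
          (~-trans t~ (~-transpose₀₁ (slices O X Y))) detX≈0)

      zero-slice : ∀ X Y → t ~ slices O X Y → Split b₀ t ⊎ Nonsplit t
      zero-slice X Y t~ with zeroᴹ? X | zeroᴹ? Y
      ... | no X≉O  | _       = nonzero-slice X Y X≉O t~
      ... | yes _   | no Y≉O  = nonzero-slice Y X Y≉O (~-trans t~ (~-transpose₁₂ _))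
      ... | yes X≈O | yes Y≈O = inj₁ (0F , (λ ()) , ~-trans t~
        (≈⇒~ (slices≈ (λ _ _ → refl) X≈O Y≈O)))

    -- If no nonzero matrix in the image is singular, the singular slice that elimination always
    -- provides must be zero, so that the dimension is at most two.
    classification : ∀ t → Split b₀ t ⊎ Nonsplit t
    classification t with em {∃[ t′ ] t ~ t′ × det (Slice t′ 0F) ≈ 0# × ¬ Slice t′ 0F ≈ᴹ O}
    ... | yes (t₁ , t~t₁ , sing , ≉O) =
      let t₂ , t₁~t₂ , t₂≈ = singular⇒E₂₂ t₁ sing ≉O in
      inj₁ (split-trans b₀ (~-trans t~t₁ t₁~t₂) (E₂₂⇒split b₀ t₂ t₂≈))
    ... | no none =
      let t₁ , t~t₁ , p , q = singularSlice t in
      zero-slice t only (Slice t₁ 1F) (Slice t₁ 2F) (~-trans t~t₁ (≈⇒~ (slices≈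
        (only t₁ t~t₁ (combine (t₁ (1F , 1F , 0F)) p (combine (- t₁ (1F , 0F , 0F)) q
          (solve 4 (#0 :* #1 :- #2 :* #3 :+ #1 :* :0 :+ :- #3 :* :0) (:0 :+ #1 :* #0 :+ :- #3 :*
          #2)))))
        (λ _ _ → refl) (λ _ _ → refl))))
      where
      only : SingularOnlyIfZero t
      only t′ t~t′ sing with zeroᴹ? (Slice t′ 0F)
      ... | yes ≈O = ≈O
      ... | no ≉O  = ⊥-elim (none (t′ , t~t′ , sing , ≉O))

-- Irreducible quadratic polynomials

-- Removing an omitted value from the codomain would give an injection into a smaller set.
injective⇒surjective : ∀ {n} {f : Fin n → Fin n} → (∀ {i j} → f i ≡ f j → i ≡ j) →
                       ∀ k → ∃[ i ] f i ≡ k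
injective⇒surjective {ℕ.suc n} {f} inj k with any? (λ i → f i ≟ k)
... | yes found = found
... | no k∉f = ⊥-elim (<⇒notInjective {f = λ i → punchOut (omits i)} (ℕ.n<1+n n)
  λ {i} {j} eq → inj (punchOut-injective (omits i) (omits j) eq))
  where
  omits : ∀ i → k ≢ f i
  omits i k≡fi = k∉f (i , ≡.sym k≡fi)

-- By the pigeonhole principle for f together with the bit that tells whether the value has
-- been taken before.
triple-pigeonhole : ∀ {n} (f : Fin (ℕ.suc (n ℕ.+ n)) → Fin n) →
  ∃[ i ] ∃[ j ] ∃[ k ] i ≢ j × j ≢ k × i ≢ k × f i ≡ f j × f j ≡ f k
triple-pigeonhole {n} f = conclude (pigeonhole (ℕ.n<1+n _) (join n n ∘ tag))
  where
  Repeated : Fin (ℕ.suc (n ℕ.+ n)) → Set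
  Repeated i = ∃[ j ] j < i × f j ≡ f i

  repeated? : ∀ i → Dec (Repeated i)
  repeated? i = any? λ j → (j <? i) ×-dec (f j ≟ f i)

  tag : Fin (ℕ.suc (n ℕ.+ n)) → Fin n ⊎ Fin n
  tag i with repeated? i
  ... | yes _ = inj₂ (f i)
  ... | no _  = inj₁ (f i)

  conclude : ∃[ i ] ∃[ j ] i < j × join n n (tag i) ≡ join n n (tag j) →
    ∃[ i ] ∃[ j ] ∃[ k ] i ≢ j × j ≢ k × i ≢ k × f i ≡ f j × f j ≡ f k
  conclude (j , k , j<k , eq)
    with ≡.trans (≡.sym (splitAt-join n n (tag j))) (≡.trans (≡.cong (splitAt n) eq) (splitAt-join n n (tag k)))
  ... | tags with repeated? j | repeated? k
  -- That `j` is itself a repetition supplies the third index `i`.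
  ... | yes (i , i<j , fi≡fj) | yes _ =
    i , j , k , <⇒≢ i<j , <⇒≢ j<k , <⇒≢ (<-trans i<j j<k) , fi≡fj , inj₂-injective tags
  ... | no _ | no new = ⊥-elim (new (j , j<k , inj₁-injective tags))
  ... | yes _ | no _ = case tags of λ ()
  ... | no _ | yes _ = case tags of λ ()

-- Up to scaling and translation every irreducible quadratic is X² + X - b, because in
-- characteristic two X² - a is reducible.  The substitution X ↦ (X - u)/(1 + 2u) relates the
-- polynomials with constants b and b₀.
record UniqueQuadraticExtension {c ℓ} (F : Field c ℓ) : Set (c ⊔ ℓ) where
  open Field F hiding (zero)
  field
    b₀          : Carrier
    irreducible : ∀ x → x * x + x ≉ b₀
    unique      : ∀ b → (∀ x → x * x + x ≉ b) → ∃[ u ] 1# + (u + u) ≉ 0# ×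
                  b + (u * u + u) * (1# + (b + b + b + b)) ≈ b₀
    squareRoot  : 1# + 1# ≈ 0# → ∀ a → ∃[ x ] x * x ≈ a

module Quadratic {c ℓ} (F : Field c ℓ) where
  open Field F hiding (zero)
  open FieldLemmas F

  -- In characteristic two this is the Artin-Schreier map. In every characteristic its values are
  -- the b for which X² + X - b is reducible.
  ℘ : Carrier → Carrier
  ℘ x = x * x + x

  module _ (_≈0? : ∀ x → Dec (x ≈ 0#)) where

    square≈0 : ∀ {x} → x * x ≈ 0# → x ≈ 0#
    square≈0 {x} eq with x ≈0?
    ... | yes x≈0 = x≈0
    ... | no x≉0  = *≈0⇒≈0 x≉0 eq

    -- The difference ℘ x - ℘ y is (x - y)(x + y + 1); in particular the fibres of ℘ have at most
    -- two elements.
    ℘-collision : ∀ {x y} → ¬ x ≈ y → ℘ x ≈ ℘ y → x + y + 1# ≈ 0#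
    ℘-collision {x} {y} x≉y eq = *≈0⇒≈0 {x - y}
      (λ e → x≉y (combine 1# e (solve 2 (#0 :+ :1 :* :0) (#1 :+ :1 :* (#0 :- #1))))) (combine 1# eq
        (solve 2 ((#0 :- #1) :* (#0 :+ #1 :+ :1) :+ :1 :* (#1 :* #1 :+ #1)) (:0 :+ :1 :* (#0 :* #0
        :+ #0))))

    module _ (b : Carrier) (irr : ∀ x → ℘ x ≉ b) where

      -- The new discriminant is 1 + 4 · `translate u` = (1 + 4b)(1 + 2u)².
      translate : Carrier → Carrier
      translate u = b + ℘ u * (1# + (b + b + b + b))

      -- If 4b = -1, then 2b is the double root -1/2.
      discriminant≉0 : 1# + (b + b + b + b) ≉ 0#
      discriminant≉0 D≈0 = irr (b + b) (combine b D≈0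
        (solve 1 ((#0 :+ #0) :* (#0 :+ #0) :+ (#0 :+ #0) :+ #0 :* :0) (#0 :+ #0 :* (:1 :+ (#0 :+ #0
        :+ #0 :+ #0)))))

      translate-injective : ∀ {u v} → translate u ≈ translate v → ℘ u ≈ ℘ v
      translate-injective {u} {v} eq = combine 1#
        (*≈0⇒≈0 {y = ℘ u - ℘ v} discriminant≉0 (combine 1# eq
          (solve 3 ((:1 :+ (#0 :+ #0 :+ #0 :+ #0)) :* (#1 :* #1 :+ #1 :- (#2 :* #2 :+ #2)) :+ :1 :*
          (#0 :+ (#2 :* #2 :+ #2) :* (:1 :+ (#0 :+ #0 :+ #0 :+ #0)))) (:0 :+ :1 :* (#0 :+ (#1 :* #1
          :+ #1) :* (:1 :+ (#0 :+ #0 :+ #0 :+ #0)))))))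
          (solve 2 (#0 :* #0 :+ #0 :+ :1 :* :0) (#1 :* #1 :+ #1 :+ :1 :* (#0 :* #0 :+ #0 :- (#1 :*
          #1 :+ #1))))

      translate-half : ∀ {u} → 1# + (u + u) ≈ 0# → translate u ≈ ℘ u
      translate-half {u} h≈0 = combine ((1# + (u + u)) * b) h≈0
        (solve 2 (#0 :+ (#1 :* #1 :+ #1) :* (:1 :+ (#0 :+ #0 :+ #0 :+ #0)) :+ (:1 :+ (#1 :+ #1)) :*
        #0 :* :0) (#1 :* #1 :+ #1 :+ (:1 :+ (#1 :+ #1)) :* #0 :* (:1 :+ (#1 :+ #1))))

      -- If 1 + 2u is invertible, undoing the substitution turns a common value into the root (x -
      -- u)/(1 + 2u) of the irreducible polynomial, unlike what `irr` allows. Otherwise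
      -- `translate u` is ℘ u, and x + u + 1 = x - u gives (x - u)² = 0.
      translate-meets-℘ : ∀ {x u} → ℘ x ≈ translate u → x ≈ u
      translate-meets-℘ {x} {u} eq with (1# + (u + u)) ≈0?
      ... | yes h≈0 = combine 1# (square≈0 {x - u}
        (combine 1# (trans eq (translate-half h≈0)) (combine (u - x) h≈0
          (solve 2 ((#0 :- #1) :* (#0 :- #1) :+ :1 :* (#1 :* #1 :+ #1) :+ (#1 :- #0) :* :0) (:0 :+
          :1 :* (#0 :* #0 :+ #0) :+ (#1 :- #0) :* (:1 :+ (#1 :+ #1)))))))
          (solve 2 (#0 :+ :1 :* :0) (#1 :+ :1 :* (#0 :- #1)))
      ... | no h≉0 = let e , he≈1 = inverse _ h≉0 ; r = (x - u) * e in ⊥-elim (irr r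
        (combine (e * e) eq (combine (b + b * (1# + (u + u)) * e - (x - u) * e) he≈1
          (solve 4 ((#0 :- #1) :* #2 :* ((#0 :- #1) :* #2) :+ (#0 :- #1) :* #2 :+ #2 :* #2 :* (#3 :+
          (#1 :* #1 :+ #1) :* (:1 :+ (#3 :+ #3 :+ #3 :+ #3))) :+ (#3 :+ #3 :* (:1 :+ (#1 :+ #1)) :*
          #2 :- (#0 :- #1) :* #2) :* :1) (#3 :+ #2 :* #2 :* (#0 :* #0 :+ #0) :+ (#3 :+ #3 :* (:1 :+
          (#1 :+ #1)) :* #2 :- (#0 :- #1) :* #2) :* ((:1 :+ (#1 :+ #1)) :* #2))))))

-- Finite fields: quadratics by counting

module Finite {c ℓ} (F : Field c ℓ) (q : ℕ) (card : HasCardinality (Field.setoid F) q) where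
  open Field F hiding (zero)
  open FieldLemmas F
  open Quadratic F
  open Bijection card using (to; injective; surjective)

  index : Carrier → Fin q
  index x = proj₁ (surjective x)

  to-index : ∀ x → to (index x) ≈ x
  to-index x = proj₂ (surjective x) ≡.refl

  index-injective : ∀ {x y} → index x ≡ index y → x ≈ y
  index-injective {x} {y} eq =
    trans (sym (to-index x)) (trans (reflexive (≡.cong to eq)) (to-index y))

  _≈0? : ∀ x → Dec (x ≈ 0#)
  x ≈0? = map′ (λ e → index-injective e) (λ e → injective (trans (to-index _) (trans e (sym (to-index _)))))
    (index x ≟ index 0#)

  0≉-1 : 0# ≉ - 1#
  0≉-1 e = 1≉0 (combine 1# e (solve 0 (:1 :+ :1 :* :- :1) (:0 :+ :1 :* :0)))

  -- Both 0 and -1 are mapped to 0. If ℘ were surjective, a section would be injective, hence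
  -- bijective, and ℘ would be injective.
  ℘-omits : ∃[ b ] ∀ x → ℘ x ≉ b
  ℘-omits with any? (λ z → ¬? (any? λ w → index (℘ (to w)) ≟ z))
  ... | yes (z , omitted) = to z , λ x eq → omitted (index x ,
    injective (trans (to-index _)
      (trans (+-cong (*-cong (to-index x) (to-index x)) (to-index x)) eq)))
  ... | no none = ⊥-elim (0≉-1 (index-injective collision))
    where
    section : ∀ z → ∃[ w ] index (℘ (to w)) ≡ z
    section z = decidable-stable (any? λ w → index (℘ (to w)) ≟ z) λ ∄w → none (z , ∄w)

    section-surjective : ∀ w → ∃[ z ] proj₁ (section z) ≡ w
    section-surjective = injective⇒surjective λ {z} {z′} eq →
      ≡.trans (≡.sym (proj₂ (section z)))
        (≡.trans (≡.cong (index ∘ ℘ ∘ to) eq) (proj₂ (section z′)))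

    index℘-injective : ∀ {w w′} → index (℘ (to w)) ≡ index (℘ (to w′)) → w ≡ w′
    index℘-injective {w} {w′} eq with section-surjective w | section-surjective w′
    ... | z , ≡.refl | z′ , ≡.refl = ≡.cong (proj₁ ∘ section)
      (≡.trans (≡.sym (proj₂ (section z))) (≡.trans eq (proj₂ (section z′))))

    collision : index 0# ≡ index (- 1#)
    collision = index℘-injective (injective (trans (to-index _) (trans
      (combine (to (index 0#) + 1#) (to-index 0#)
        (combine (- to (index (- 1#))) (to-index (- 1#))
          (solve 2 (#0 :* #0 :+ #0 :+ (#0 :+ :1) :* :0 :+ :- #1 :* :- :1) (#1 :* #1 :+ #1 :+ (#0 :+
          :1) :* #0 :+ :- #1 :* #1))))
      (sym (to-index _)))))

  -- In characteristic two x² - y² = (x - y)², so squaring is injective and therefore surjective.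
  squareRoot : 1# + 1# ≈ 0# → ∀ a → ∃[ x ] x * x ≈ a
  squareRoot 2≈0 a =
    let i , eq = injective⇒surjective square-injective (index a) in to i , index-injective eq
    where
    square-injective : ∀ {i j} → index (to i * to i) ≡ index (to j * to j) → i ≡ j
    square-injective {i} {j} eq = injective (combine 1# (square≈0 _≈0? {to i - to j}
      (combine 1# (index-injective eq) (combine (to j * to j - to i * to j) 2≈0
        (solve 2 ((#0 :- #1) :* (#0 :- #1) :+ :1 :* (#1 :* #1) :+ (#1 :* #1 :- #0 :* #1) :* :0) (:0
        :+ :1 :* (#0 :* #0) :+ (#1 :* #1 :- #0 :* #1) :* (:1 :+ :1))))))
        (solve 2 (#0 :+ :1 :* :0) (#1 :+ :1 :* (#0 :- #1))))

  module _ (b₀ : Carrier) (irr₀ : ∀ x → ℘ x ≉ b₀) (b : Carrier) (irr : ∀ x → ℘ x ≉ b) where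

    -- The 2q + 1 arguments are one for the constant b₀ and q for each of the maps ℘ and
    -- `translate`.
    decode : Fin (ℕ.suc (q ℕ.+ q)) → Maybe (Fin q ⊎ Fin q)
    decode 0F      = nothing
    decode (suc i) = just (splitAt q i)

    decode-injective : ∀ {i j} → decode i ≡ decode j → i ≡ j
    decode-injective {0F}    {0F}    _  = ≡.refl
    decode-injective {suc i} {suc j} eq = ≡.cong suc (≡.trans (≡.sym (join-splitAt q q i))
      (≡.trans (≡.cong (join q q) (just-injective eq)) (join-splitAt q q j)))

    value : Maybe (Fin q ⊎ Fin q) → Carrier
    value nothing         = b₀
    value (just (inj₁ x)) = ℘ (to x)
    value (just (inj₂ u)) = translate _≈0? b irr (to u)

    Connected : Set (c ⊔ ℓ)
    Connected = ∃[ u ] 1# + (u + u) ≉ 0# × translate _≈0? b irr u ≈ b₀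

    -- Where 1 + 2u = 0, `translate` agrees with ℘, which omits b₀.
    hits-b₀ : ∀ y → value (just y) ≈ b₀ → Connected
    hits-b₀ (inj₁ x) eq = ⊥-elim (irr₀ (to x) eq)
    hits-b₀ (inj₂ u) eq = to u ,
      (λ h≈0 → irr₀ (to u) (trans (sym (translate-half _≈0? b irr h≈0)) eq)) , eq

    meet : ∀ {x u} → ℘ (to x) ≈ translate _≈0? b irr (to u) → x ≡ u
    meet eq = injective (translate-meets-℘ _≈0? b irr eq)

    partner : ∀ {x y z} → x ≢ y → y ≢ z → x ≢ z →
              ℘ (to x) ≈ ℘ (to y) → ℘ (to y) ≈ ℘ (to z) → ⊥
    partner {x} {y} {z} x≢y y≢z x≢z eq₁ eq₂ = x≢z (injective (combine 1#
      (℘-collision _≈0? (x≢y ∘ injective) eq₁)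
      (combine (- 1#) (℘-collision _≈0? (y≢z ∘ injective) eq₂)
        (solve 3 (#0 :+ :1 :* :0 :+ :- :1 :* :0) (#1 :+ :1 :* (#0 :+ #2 :+ :1) :+ :- :1 :* (#2 :+ #1
        :+ :1))))))

    -- The two maps alone cannot produce a triple. Three arguments of one map are excluded by
    -- `partner`. If both maps take the value, `meet` identifies every argument of one with every
    -- argument of the other, so neither map has two. Hence b₀ takes part and is equal to another
    -- value.
    collide : ∀ {x y z} → x ≢ y → y ≢ z → x ≢ z → value x ≈ value y → value y ≈ value z → Connected
    collide {nothing} {nothing} x≢y _ _ _ _ = ⊥-elim (x≢y ≡.refl)
    collide {nothing} {just y} _ _ _ eq _ = hits-b₀ y (sym eq)
    collide {just y} {nothing} _ _ _ eq _ = hits-b₀ y eq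
    collide {just _} {just y} {nothing} _ _ _ _ eq = hits-b₀ y eq
    collide {just (inj₁ x)} {just (inj₁ y)} {just (inj₁ z)} x≢y y≢z x≢z eq₁ eq₂ = ⊥-elim (partner
      (x≢y ∘ ≡.cong (just ∘ inj₁)) (y≢z ∘ ≡.cong (just ∘ inj₁)) (x≢z ∘ ≡.cong (just ∘ inj₁)) eq₁ eq₂)
    collide {just (inj₂ x)} {just (inj₂ y)} {just (inj₂ z)} x≢y y≢z x≢z eq₁ eq₂ = ⊥-elim (partner
      (x≢y ∘ ≡.cong (just ∘ inj₂)) (y≢z ∘ ≡.cong (just ∘ inj₂)) (x≢z ∘ ≡.cong (just ∘ inj₂))
      (translate-injective _≈0? b irr eq₁) (translate-injective _≈0? b irr eq₂))
    collide {just (inj₁ x)} {just (inj₁ y)} {just (inj₂ u)} x≢y _ _ eq₁ eq₂ =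
      ⊥-elim (x≢y (≡.cong (just ∘ inj₁) (≡.trans (meet (trans eq₁ eq₂)) (≡.sym (meet eq₂)))))
    collide {just (inj₁ x)} {just (inj₂ u)} {just (inj₁ y)} _ _ x≢y eq₁ eq₂ =
      ⊥-elim (x≢y (≡.cong (just ∘ inj₁) (≡.trans (meet eq₁) (≡.sym (meet (sym eq₂))))))
    collide {just (inj₂ u)} {just (inj₁ x)} {just (inj₁ y)} _ x≢y _ eq₁ eq₂ =
      ⊥-elim (x≢y (≡.cong (just ∘ inj₁)
        (≡.trans (meet (sym eq₁)) (≡.sym (meet (trans (sym eq₂) (sym eq₁)))))))
    collide {just (inj₂ u)} {just (inj₂ v)} {just (inj₁ x)} u≢v _ _ eq₁ eq₂ =
      ⊥-elim (u≢v (≡.cong (just ∘ inj₂)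
        (≡.trans (≡.sym (meet (sym (trans eq₁ eq₂)))) (meet (sym eq₂)))))
    collide {just (inj₂ u)} {just (inj₁ x)} {just (inj₂ v)} _ _ u≢v eq₁ eq₂ =
      ⊥-elim (u≢v (≡.cong (just ∘ inj₂) (≡.trans (≡.sym (meet (sym eq₁))) (meet eq₂))))
    collide {just (inj₁ x)} {just (inj₂ u)} {just (inj₂ v)} _ u≢v _ eq₁ eq₂ =
      ⊥-elim (u≢v (≡.cong (just ∘ inj₂) (≡.trans (≡.sym (meet eq₁)) (meet (trans eq₁ eq₂)))))

    connected : Connected
    connected =
      let i , j , k , i≢j , j≢k , i≢k , eq₁ , eq₂ =
            triple-pigeonhole (index ∘ value ∘ decode)
      in collide (i≢j ∘ decode-injective) (j≢k ∘ decode-injective) (i≢k ∘ decode-injective)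
           (index-injective eq₁) (index-injective eq₂)

  uniqueQuadraticExtension : UniqueQuadraticExtension F
  uniqueQuadraticExtension = let b₀ , irr₀ = ℘-omits in record
    { b₀ = b₀ ; irreducible = irr₀ ; unique = connected b₀ irr₀ ; squareRoot = squareRoot }

-- The real field: square roots from completeness

module Real {c ℓ o} (F : Field c ℓ) (_≈0? : ∀ x → Dec (Field._≈_ F x (Field.0# F)))
            (real : IsRealField F o) where
  open Field F hiding (zero)
  open FieldLemmas F
  open Quadratic F
  open IsRealField real renaming (_≤_ to infix 4 _≤_)
  open IsTotalOrder isTotalOrder using (antisym; total; ≤-respʳ-≈; ≤-respˡ-≈)
    renaming (refl to ≤-refl; trans to ≤-trans)

  NonNeg : Carrier → Set o
  NonNeg x = 0# ≤ x

  nonNeg-resp : ∀ {x y} → x ≈ y → NonNeg x → NonNeg y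
  nonNeg-resp = ≤-respʳ-≈

  nonNeg-+ : ∀ {x y} → NonNeg x → NonNeg y → NonNeg (x + y)
  nonNeg-+ {x} {y} 0≤x 0≤y = ≤-trans 0≤y (≤-respˡ-≈ (+-identityˡ y) (+-monoˡ-≤ y 0≤x))

  ≤⇒nonNeg : ∀ {x y} → x ≤ y → NonNeg (y - x)
  ≤⇒nonNeg {x} {y} x≤y = ≤-respˡ-≈ (-‿inverseʳ x) (+-monoˡ-≤ (- x) x≤y)

  nonNeg⇒≤ : ∀ {x y} → NonNeg (y - x) → x ≤ y
  nonNeg⇒≤ {x} {y} p = ≤-respʳ-≈ (solve 2 (#0 :- #1 :+ #1) #0) (≤-respˡ-≈ (+-identityˡ x) (+-monoˡ-≤
    x p))

  nonNeg-antisym : ∀ {x} → NonNeg x → NonNeg (- x) → x ≈ 0#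
  nonNeg-antisym {x} p q = antisym (nonNeg⇒≤ (nonNeg-resp (solve 1 (:- #0) (:0 :- #0)) q)) p

  nonNeg-total : ∀ x → NonNeg x ⊎ NonNeg (- x)
  nonNeg-total x with total 0# x
  ... | inj₁ p = inj₁ p
  ... | inj₂ q = inj₂ (nonNeg-resp (+-identityˡ _) (≤⇒nonNeg q))

  nonNeg-square : ∀ x → NonNeg (x * x)
  nonNeg-square x with nonNeg-total x
  ... | inj₁ p = *-nonNeg p p
  ... | inj₂ p = nonNeg-resp (solve 1 (:- #0 :* :- #0) (#0 :* #0)) (*-nonNeg p p)

  nonNeg-1 : NonNeg 1#
  nonNeg-1 = nonNeg-resp (*-identityˡ 1#) (nonNeg-square 1#)

  nonNeg-inverse : ∀ {x y} → x * y ≈ 1# → NonNeg x → NonNeg y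
  nonNeg-inverse {x} {y} xy≈1 p =
    nonNeg-resp (combine y xy≈1 (solve 2 (#0 :* (#1 :* #1) :+ #1 :* :1) (#1 :+ #1 :* (#0 :* #1))))
      (*-nonNeg p (nonNeg-square y))

  ¬nonNeg-neg : ∀ {x} → NonNeg x → ¬ NonNeg (- (1# + x))
  ¬nonNeg-neg {x} p q = 1≉0 (nonNeg-antisym nonNeg-1 (nonNeg-resp
    (solve 1 (:- (:1 :+ #0) :+ #0) (:- :1)) (nonNeg-+ q p)))

  2≉0 : 1# + 1# ≉ 0#
  2≉0 e = ¬nonNeg-neg nonNeg-1 (nonNeg-resp (combine 1# e
    (solve 0 (:0 :+ :1 :* :0) (:- (:1 :+ :1) :+ :1 :* (:1 :+ :1)))) ≤-refl)

  module SquareRoot (a : Carrier) (a≥0 : NonNeg a) where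

    Below : Carrier → Set o
    Below x = x * x ≤ a

    -- If z = x - (a + 1) were nonnegative, then a - x² = -(1 + a + a² + z² + 2(a + 1)z) would be
    -- negative.
    bounded : ∀ {x} → Below x → x ≤ a + 1#
    bounded {x} x²≤a = [ nonNeg⇒≤ , (λ q → ⊥-elim (¬nonNeg-neg
        (nonNeg-+ (nonNeg-+ a≥0 (nonNeg-square a))
          (nonNeg-+ (nonNeg-square z) (*-nonNeg (nonNeg-+ a+1≥0 a+1≥0) q)))
        (nonNeg-resp (solve 2 (#0 :- #1 :* #1) (:- (:1 :+ (#0 :+ #0 :* #0 :+ (:- (#0 :+ :1 :- #1) :*
          :- (#0 :+ :1 :- #1) :+ (#0 :+ :1 :+ (#0 :+ :1)) :* :- (#0 :+ :1 :- #1)))))) (≤⇒nonNeg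
          x²≤a)))) ]′ (nonNeg-total (a + 1# - x))
      where
      z = - (a + 1# - x)
      a+1≥0 = nonNeg-+ a≥0 nonNeg-1

    module Supremum (s : Carrier) (s-upper : ∀ {x} → Below x → x ≤ s)
                    (s-least : ∀ {b} → (∀ {x} → Below x → x ≤ b) → s ≤ b) where

      s≥0 : NonNeg s
      s≥0 = s-upper (nonNeg⇒≤ (nonNeg-resp (solve 1 #0 (#0 :- :0 :* :0)) a≥0))

      M≥0 : NonNeg (s + s + a)
      M≥0 = nonNeg-+ (nonNeg-+ s≥0 s≥0) a≥0

      M≉0 : 1# + (s + s + a) ≉ 0#
      M≉0 e = ¬nonNeg-neg M≥0 (nonNeg-resp (combine 1# e
        (solve 2 (:0 :+ :1 :* :0) (:- (:1 :+ (#0 :+ #0 :+ #1)) :+ :1 :* (:1 :+ (#0 :+ #0 :+ #1)))))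
        ≤-refl)

      -- If s² ≤ a then s + (a - s²)/(1 + 2s + a) still has a square below a.
      not-too-small : NonNeg (a - s * s) → ∀ m → (1# + (s + s + a)) * m ≈ 1# → s * s ≈ a
      not-too-small δ≥0 m Mm≈1 = combine (- 1#) δ≈0
        (solve 2 (#0 :* #0 :+ :- :1 :* :0) (#1 :+ :- :1 :* (#1 :- #0 :* #0)))
        where
        δ = a - s * s
        ε = δ * m

        m≥0 : NonNeg m
        m≥0 = nonNeg-inverse Mm≈1 (nonNeg-+ nonNeg-1 M≥0)

        -- Since (1 + 2s + a)ε = δ, one has a - (s + ε)² = ε(1 + a - ε). The second factor times 1 +
        -- 2s + a is 2s(1 + a) + (1 + a) + a² + s².
        slack≥0 : NonNeg (1# + a - ε)
        slack≥0 = nonNeg-resp (combine (1# + a) Mm≈1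
          (solve 3 (#0 :* ((#1 :+ #1) :* (:1 :+ #2) :+ (:1 :+ #2) :+ #2 :* #2 :+ #1 :* #1) :+ (:1 :+
          #2) :* :1) (:1 :+ #2 :- (#2 :- #1 :* #1) :* #0 :+ (:1 :+ #2) :* ((:1 :+ (#1 :+ #1 :+ #2))
          :* #0)))) (*-nonNeg m≥0
          (nonNeg-+ (nonNeg-+ (nonNeg-+ (*-nonNeg (nonNeg-+ s≥0 s≥0) (nonNeg-+ nonNeg-1 a≥0))
                                        (nonNeg-+ nonNeg-1 a≥0))
                              (nonNeg-square a))
                    (nonNeg-square s)))

        below : Below (s + ε)
        below = nonNeg⇒≤ (nonNeg-resp (combine δ Mm≈1
          (solve 3 ((#0 :- #1 :* #1) :* #2 :* (:1 :+ #0 :- (#0 :- #1 :* #1) :* #2) :+ (#0 :- #1 :*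
          #1) :* :1) (#0 :- (#1 :+ (#0 :- #1 :* #1) :* #2) :* (#1 :+ (#0 :- #1 :* #1) :* #2) :+ (#0
          :- #1 :* #1) :* ((:1 :+ (#1 :+ #1 :+ #0)) :* #2))))
          (*-nonNeg (*-nonNeg δ≥0 m≥0) slack≥0))

        ε≈0 : ε ≈ 0#
        ε≈0 = nonNeg-antisym (*-nonNeg δ≥0 m≥0) (nonNeg-resp
          (solve 3 (#0 :- (#0 :+ (#1 :- #0 :* #0) :* #2)) (:- ((#1 :- #0 :* #0) :* #2))) (≤⇒nonNeg
          (s-upper below)))

        δ≈0 : δ ≈ 0#
        δ≈0 = combine (- δ) Mm≈1 (combine (1# + (s + s + a)) ε≈0
          (solve 3 (#0 :- #1 :* #1 :+ :- (#0 :- #1 :* #1) :* :1 :+ (:1 :+ (#1 :+ #1 :+ #0)) :* :0)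
          (:0 :+ :- (#0 :- #1 :* #1) :* ((:1 :+ (#1 :+ #1 :+ #0)) :* #2) :+ (:1 :+ (#1 :+ #1 :+ #0))
          :* ((#0 :- #1 :* #1) :* #2))))

      -- If a ≤ s² then the Newton step s - (s² - a)/(2s) is still an upper bound.
      not-too-large : NonNeg (s * s - a) → ∀ h → (s + s) * h ≈ 1# → s * s ≈ a
      not-too-large δ≥0 h 2sh≈1 = combine 1# δ≈0
        (solve 2 (#0 :* #0 :+ :1 :* :0) (#1 :+ :1 :* (#0 :* #0 :- #1)))
        where
        δ = s * s - a
        b = s - δ * h

        h≥0 : NonNeg h
        h≥0 = nonNeg-inverse 2sh≈1 (nonNeg-+ s≥0 s≥0)

        b≥0 : NonNeg b
        b≥0 = nonNeg-resp (combine s 2sh≈1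
          (solve 3 (#0 :* (#1 :* #1 :+ #2) :+ #1 :* :1) (#1 :- (#1 :* #1 :- #2) :* #0 :+ #1 :* ((#1
          :+ #1) :* #0))))
          (*-nonNeg h≥0 (nonNeg-+ (nonNeg-square s) a≥0))

        -- Here b² = a + (δh)². If z = x - b is nonnegative, then -z² = (a - x²) + (δh)² + 2bz is
        -- nonnegative too, so z = 0.
        upper : ∀ {x} → Below x → x ≤ b
        upper {x} x²≤a = [ nonNeg⇒≤ ,
            (λ q → nonNeg⇒≤ (nonNeg-resp (combine 1# (z≈0 q)
              (solve 4 (:0 :+ :1 :* :0) (#0 :- (#0 :* #0 :- #1) :* #2 :- #3 :+ :1 :* :- (#0 :- (#0
              :* #0 :- #1) :* #2 :- #3)))) ≤-refl)) ]′
          (nonNeg-total (b - x))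
          where
          z = - (b - x)
          z≈0 : NonNeg z → z ≈ 0#
          z≈0 q = square≈0 _≈0? (nonNeg-antisym (nonNeg-square z)
            (nonNeg-resp (combine δ 2sh≈1 (solve 4 (#0 :- #1 :* #1 :+ ((#2 :* #2 :- #0) :* #3 :*
              ((#2 :* #2 :- #0) :* #3) :+ (#2 :- (#2 :* #2 :- #0) :* #3 :+ (#2 :- (#2 :* #2 :- #0)
              :* #3)) :* :- (#2 :- (#2 :* #2 :- #0) :* #3 :- #1)) :+ (#2 :* #2 :- #0) :* :1) (:- (:-
              (#2 :- (#2 :* #2 :- #0) :* #3 :- #1) :* :- (#2 :- (#2 :* #2 :- #0) :* #3 :- #1)) :+
              (#2 :* #2 :- #0) :* ((#2 :+ #2) :* #3))))
              (nonNeg-+ (≤⇒nonNeg x²≤a)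
                (nonNeg-+ (nonNeg-square (δ * h)) (*-nonNeg (nonNeg-+ b≥0 b≥0) q)))))

        δh≈0 : δ * h ≈ 0#
        δh≈0 = nonNeg-antisym (*-nonNeg δ≥0 h≥0)
          (nonNeg-resp (solve 3 (#0 :- (#0 :* #0 :- #1) :* #2 :- #0) (:- ((#0 :* #0 :- #1) :* #2)))
            (≤⇒nonNeg (s-least upper)))

        δ≈0 : δ ≈ 0#
        δ≈0 = combine (- δ) 2sh≈1 (combine (s + s) δh≈0
          (solve 3 (#0 :* #0 :- #1 :+ :- (#0 :* #0 :- #1) :* :1 :+ (#0 :+ #0) :* :0) (:0 :+ :- (#0
          :* #0 :- #1) :* ((#0 :+ #0) :* #2) :+ (#0 :+ #0) :* ((#0 :* #0 :- #1) :* #2))))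

      s²≈a : s * s ≈ a
      s²≈a with nonNeg-total (a - s * s) | s ≈0?
      ... | inj₁ δ≥0 | _ = not-too-small δ≥0 _ (proj₂ (inverse _ M≉0))
      ... | inj₂ δ≤0 | no s≉0 = not-too-large (nonNeg-resp
        (solve 2 (:- (#0 :- #1 :* #1)) (#1 :* #1 :- #0)) δ≤0) _ (proj₂ (inverse (s + s)
        λ e → s≉0 (*≈0⇒≈0 2≉0 (combine 1# e
          (solve 1 ((:1 :+ :1) :* #0 :+ :1 :* :0) (:0 :+ :1 :* (#0 :+ #0)))))))
      -- The Newton step divides by 2s; for s = 0 the inequalities a ≤ s² and 0 ≤ a give a = 0
      -- directly.
      ... | inj₂ δ≤0 | yes s≈0 = combine (- 1#) (nonNeg-antisym
        (nonNeg-resp (combine s s≈0 (solve 2 (#0 :+ #1 :* :0) (#0 :- #1 :* #1 :+ #1 :* #1))) a≥0)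
          δ≤0) (solve 2 (#0 :* #0 :+ :- :1 :* :0) (#1 :+ :- :1 :* (#1 :- #0 :* #0)))

  squareRoot : ∀ a → NonNeg a → ∃[ s ] s * s ≈ a
  squareRoot a a≥0 =
    let open SquareRoot a a≥0
        s , upper , least = complete Below (0# , nonNeg⇒≤ (nonNeg-resp
          (solve 1 #0 (#0 :- :0 :* :0)) a≥0)) (a + 1# , bounded)
    in s , Supremum.s²≈a s upper least

  module _ (half : Carrier) (2half≈1 : (1# + 1#) * half ≈ 1#) where

    -- The target X² + X + 1 has discriminant -3. With D = 1 + 4b, g = -1/D and v² = -3/D, the
    -- choice 1 + 2u = v gives D(1 + 2u)² = -3.
    connect : ∀ b → (∀ x → ℘ x ≉ b) → ∀ g v → - (1# + (b + b + b + b)) * g ≈ 1# →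
              v * v ≈ g + g + g → ∃[ u ] 1# + (u + u) ≉ 0# ×
              b + ℘ u * (1# + (b + b + b + b)) ≈ - 1#
    connect b irr g v -Dg≈1 v²≈3g =
      (v - 1#) * half ,
      (λ e → v≉0 (combine 1# e (combine (1# - v) 2half≈1
        (solve 2 (#0 :+ :1 :* :0 :+ (:1 :- #0) :* :1) (:0 :+ :1 :* (:1 :+ ((#0 :- :1) :* #1 :+ (#0
        :- :1) :* #1)) :+ (:1 :- #0) :* ((:1 :+ :1) :* #1)))))) ,
      combine (D * half * half) v²≈3g
        (combine (- (1# + 1# + 1#) * half * half) -Dg≈1
          (combine (D * (1# - v) * half - (1# + b) * (1# + (1# + 1#) * half)) 2half≈1
            (solve 4 (#0 :+ ((#1 :- :1) :* #2 :* ((#1 :- :1) :* #2) :+ (#1 :- :1) :* #2) :* (:1 :+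
            (#0 :+ #0 :+ #0 :+ #0)) :+ (:1 :+ (#0 :+ #0 :+ #0 :+ #0)) :* #2 :* #2 :* (#3 :+ #3 :+
            #3) :+ :- (:1 :+ :1 :+ :1) :* #2 :* #2 :* :1 :+ ((:1 :+ (#0 :+ #0 :+ #0 :+ #0)) :* (:1
            :- #1) :* #2 :- (:1 :+ #0) :* (:1 :+ (:1 :+ :1) :* #2)) :* :1) (:- :1 :+ (:1 :+ (#0 :+
            #0 :+ #0 :+ #0)) :* #2 :* #2 :* (#1 :* #1) :+ :- (:1 :+ :1 :+ :1) :* #2 :* #2 :* (:- (:1
            :+ (#0 :+ #0 :+ #0 :+ #0)) :* #3) :+ ((:1 :+ (#0 :+ #0 :+ #0 :+ #0)) :* (:1 :- #1) :* #2
            :- (:1 :+ #0) :* (:1 :+ (:1 :+ :1) :* #2)) :* ((:1 :+ :1) :* #2)))))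
      where
      D = 1# + (b + b + b + b)
      v≉0 : v ≉ 0#
      v≉0 v≈0 = ¬nonNeg-neg (nonNeg-+ nonNeg-1 nonNeg-1) (nonNeg-resp
        (combine (- v * D) v≈0 (combine D v²≈3g (combine (- (1# + 1# + 1#)) -Dg≈1
          (solve 3 (:0 :+ :- #0 :* (:1 :+ (#1 :+ #1 :+ #1 :+ #1)) :* :0 :+ (:1 :+ (#1 :+ #1 :+ #1 :+
          #1)) :* (#2 :+ #2 :+ #2) :+ :- (:1 :+ :1 :+ :1) :* :1) (:- (:1 :+ (:1 :+ :1)) :+ :- #0 :*
          (:1 :+ (#1 :+ #1 :+ #1 :+ #1)) :* #0 :+ (:1 :+ (#1 :+ #1 :+ #1 :+ #1)) :* (#0 :* #0) :+ :-
          (:1 :+ :1 :+ :1) :* (:- (:1 :+ (#1 :+ #1 :+ #1 :+ #1)) :* #2)))))) ≤-refl)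

    square⇒reducible : ∀ b s → s * s ≈ 1# + (b + b + b + b) → ℘ ((s - 1#) * half) ≈ b
    square⇒reducible b s s²≈D = combine (half * half) s²≈D
      (combine ((1# - s) * half + b * (1# + (1# + 1#) * half)) 2half≈1
        (solve 3 ((#0 :- :1) :* #1 :* ((#0 :- :1) :* #1) :+ (#0 :- :1) :* #1 :+ #1 :* #1 :* (:1 :+
        (#2 :+ #2 :+ #2 :+ #2)) :+ ((:1 :- #0) :* #1 :+ #2 :* (:1 :+ (:1 :+ :1) :* #1)) :* :1) (#2
        :+ #1 :* #1 :* (#0 :* #0) :+ ((:1 :- #0) :* #1 :+ #2 :* (:1 :+ (:1 :+ :1) :* #1)) :* ((:1 :+
        :1) :* #1))))

    unique : ∀ b → (∀ x → ℘ x ≉ b) → ∃[ u ] 1# + (u + u) ≉ 0# ×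
             b + ℘ u * (1# + (b + b + b + b)) ≈ - 1#
    unique b irr with nonNeg-total (1# + (b + b + b + b))
    ... | inj₁ D≥0 =
      let s , s²≈D = squareRoot _ D≥0 in ⊥-elim (irr _ (square⇒reducible b s s²≈D))
    ... | inj₂ -D≥0 =
      let g , -Dg≈1 = inverse _ (-‿≉0 (discriminant≉0 _≈0? b irr))
          g≥0 = nonNeg-inverse -Dg≈1 -D≥0
          v , v²≈3g = squareRoot (g + g + g) (nonNeg-+ (nonNeg-+ g≥0 g≥0) g≥0)
      in connect b irr g v -Dg≈1 v²≈3g

  uniqueQuadraticExtension : UniqueQuadraticExtension F
  uniqueQuadraticExtension = record
    { b₀ = - 1#
    -- Because 4(x² + x + 1) = 3 + (1 + 2x)² is positive.
    ; irreducible = λ x eq → ¬nonNeg-neg (nonNeg-+ nonNeg-1 (nonNeg-+ nonNeg-1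
        (nonNeg-square (1# + (x + x)))))
        (nonNeg-resp (combine (1# + 1# + (1# + 1#)) eq
          (solve 1 (:0 :+ (:1 :+ :1 :+ (:1 :+ :1)) :* :- :1) (:- (:1 :+ (:1 :+ (:1 :+ (:1 :+ (#0 :+
          #0)) :* (:1 :+ (#0 :+ #0))))) :+ (:1 :+ :1 :+ (:1 :+ :1)) :* (#0 :* #0 :+ #0)))) ≤-refl)
    ; unique = let half , 2half≈1 = inverse (1# + 1#) 2≉0 in unique half 2half≈1
    ; squareRoot = λ 2≈0 → ⊥-elim (2≉0 2≈0)
    }

-- Completion of the classification

module Nonsplit {c ℓ} (F : Field c ℓ) (em : ExcludedMiddle (c ⊔ ℓ)) where
  open Field F hiding (zero)
  open FieldLemmas F
  open Moves F
  open Representatives F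
  open Classification F em
  open NormalForms F em
  open Companions F em

  quadratic-root : IsAlgebraicallyClosed F → ∀ b d → ∃[ x ] x * x + d * x ≈ b
  quadratic-root closed b d =
    let x , eq = closed 2 (s≤s z≤n) coefficient 1≉0 in x , rearrange x eq
    where
    coefficient : Fin 3 → Carrier
    coefficient 0F = - b
    coefficient 1F = d
    coefficient 2F = 1#

    -- The left side is the form to which the sum in `IsAlgebraicallyClosed` reduces in degree 2.
    rearrange : ∀ x → - b * 1# + (d * (x * 1#) + (1# * (x * (x * 1#)) + 0#)) ≈ 0# →
                x * x + d * x ≈ b
    rearrange x eq = combine 1# eq (solve 3 (#0 :* #0 :+ #1 :* #0 :+ :1 :* :0) (#2 :+ :1 :* (:- #2
      :* :1 :+ (#1 :* (#0 :* :1) :+ (:1 :* (#0 :* (#0 :* :1)) :+ :0)))))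

  classification-closed : IsAlgebraicallyClosed F → ∀ b₀ t → Split b₀ t
  classification-closed closed b₀ t with classification b₀ t
  ... | inj₁ split = split
  ... | inj₂ (b , d , only , t~) = let x , eq = quadratic-root closed b d in
    ⊥-elim (companion-irreducible b₀ only t~ x eq)

  module _ (quadratics : UniqueQuadraticExtension F) where
    open UniqueQuadraticExtension quadratics

    unit-trace : ∀ {t b d e} → t ~ companion b d → d * e ≈ 1# → ∃[ b′ ] t ~ companion b′ 1#
    unit-trace {t} {b} {d} {e} t~ de≈1 = b′ , ~-trans t~
      (~-companion b d b′ 1# 0# e (inverse≉0 de≈1) (combine (- 1#) de≈1
        (solve 2 (:1 :+ :- :1 :* :1) (:0 :+ :0 :+ #0 :* #1 :+ :- :1 :* (#1 :* #0)))) refl)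
      where b′ = e * e * b - 0# * 0# - 0# * e * d

    zero-trace : ∀ {t b d e} → t ~ companion b d → d ≈ 0# → (1# + 1#) * e ≈ 1# →
                 ∃[ b′ ] t ~ companion b′ 1#
    zero-trace {t} {b} {d} {e} t~ d≈0 twice≈1 = b′ , ~-trans t~
      (~-companion b d b′ 1# e 1# 1≉0 (combine (- 1#) twice≈1 (combine (- 1#) d≈0
        (solve 2 (:1 :+ :- :1 :* :1 :+ :- :1 :* :0) (#0 :+ #0 :+ :1 :* #1 :+ :- :1 :* ((:1 :+ :1) :*
        #0) :+ :- :1 :* #1)))) refl)
      where b′ = 1# * 1# * b - e * e - e * 1# * d

    normalise-trace : ∀ {t} → Nonsplit b₀ t → ∃[ b ] t ~ companion b 1#
    normalise-trace (b , d , only , t~) with d ≈0? | (1# + 1#) ≈0?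
    ... | no d≉0  | _       = unit-trace t~ (proj₂ (inverse d d≉0))
    ... | yes d≈0 | no 2≉0  = zero-trace t~ d≈0 (proj₂ (inverse (1# + 1#) 2≉0))
    ... | yes d≈0 | yes 2≈0 = let x , x²≈b = squareRoot 2≈0 b in
      ⊥-elim (companion-irreducible b₀ only t~ x (combine x d≈0 (combine 1# x²≈b
        (solve 3 (#0 :* #0 :+ #1 :* #0 :+ #0 :* :0 :+ :1 :* #2) (#2 :+ #0 :* #1 :+ :1 :* (#0 :*
        #0))))))

    companion-connected : ∀ {t b u} → t ~ companion b 1# → 1# + (u + u) ≉ 0# →
      b + (u * u + u) * (1# + (b + b + b + b)) ≈ b₀ → t ~ rep b₀ 8F
    companion-connected {t} {b} {u} t~ v≉0 eq = ~-trans t~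
      (~-companion b 1# b₀ 1# (- u) (1# + (u + u)) v≉0
        (solve 1 :1 (:- #0 :- #0 :+ (:1 :+ (#0 :+ #0)) :* :1)) (combine (- 1#) eq
        (solve 3 (#0 :+ :- :1 :* #0) ((:1 :+ (#1 :+ #1)) :* (:1 :+ (#1 :+ #1)) :* #2 :- :- #1 :* :-
        #1 :- :- #1 :* (:1 :+ (#1 :+ #1)) :* :1 :+ :- :1 :* (#2 :+ (#1 :* #1 :+ #1) :* (:1 :+ (#2 :+
        #2 :+ #2 :+ #2)))))))

    nonsplit⇒rep : ∀ {t} → Nonsplit b₀ t → t ~ rep b₀ 8F
    nonsplit⇒rep ns@(_ , _ , only , _) =
      let b , t~ = normalise-trace ns
          u , v≉0 , eq = unique b (λ x eq →
            companion-irreducible b₀ only t~ x (trans (+-congˡ (*-identityˡ x)) eq))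
      in companion-connected t~ v≉0 eq

    classification-all : ∀ t → ∃[ n ] t ~ rep b₀ n
    classification-all t with classification b₀ t
    ... | inj₁ (n , _ , t~) = n , t~
    ... | inj₂ ns           = 8F , nonsplit⇒rep ns

-- Pure tensors and the structure of G

module Parallel {c ℓ} (F : Field c ℓ) (em : ExcludedMiddle (c ⊔ ℓ)) where
  open Field F hiding (zero)
  open FieldLemmas F
  open Classification F em using (_≈0?)

  private variable I J : Set

  cancel : ∀ {x y z} → x ≉ 0# → x * y ≈ x * z → y ≈ z
  cancel {x} {y} {z} x≉0 eq =
    combine 1# (*≈0⇒≈0 {y = y - z} x≉0 (combine 1# eq
      (solve 3 (#0 :* (#1 :- #2) :+ :1 :* (#0 :* #2)) (:0 :+ :1 :* (#0 :* #1)))))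
      (solve 2 (#0 :+ :1 :* :0) (#1 :+ :1 :* (#0 :- #1)))

  factors≉0 : ∀ {x y z} → x * y ≈ z → z ≉ 0# → x ≉ 0# × y ≉ 0#
  factors≉0 {x} {y} xy≈z z≉0 =
    (λ x≈0 → z≉0 (trans (sym xy≈z) (trans (*-congʳ x≈0) (zeroˡ y)))) ,
    (λ y≈0 → z≉0 (trans (sym xy≈z) (trans (*-congˡ y≈0) (zeroʳ x))))

  Nonzero : (I → Carrier) → Set ℓ
  Nonzero v = ∃[ i ] v i ≉ 0#

  nonzero : (v : I → Carrier) → ¬ (∀ i → v i ≈ 0#) → Nonzero v
  nonzero v v≉0 with em {Lift c (Nonzero v)}
  ... | yes (lift nz) = nz
  ... | no ¬nz = ⊥-elim (v≉0 zeros)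
    where
    zeros : ∀ i → v i ≈ 0#
    zeros i with v i ≈0?
    ... | yes vi≈0 = vi≈0
    ... | no vi≉0  = ⊥-elim (¬nz (lift (i , vi≉0)))

  infix 4 _∥_
  -- Proportionality as vanishing of all 2 × 2 minors. The zero vector is parallel to every vector,
  -- hence the nonzero middle vector in `∥-trans`.
  _∥_ : (v w : I → Carrier) → Set ℓ
  v ∥ w = ∀ i j → v i * w j ≈ v j * w i

  ∥-refl : (v : I → Carrier) → v ∥ v
  ∥-refl v i j = *-comm (v i) (v j)

  ∥-sym : {v w : I → Carrier} → v ∥ w → w ∥ v
  ∥-sym v∥w i j = combine 1# (v∥w j i)
    (solve 4 (#0 :* #1 :+ :1 :* (#2 :* #3)) (#3 :* #2 :+ :1 :* (#1 :* #0)))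

  ∥-trans : {v w z : I → Carrier} → Nonzero w → v ∥ w → w ∥ z → v ∥ z
  ∥-trans {v = v} {w} {z} (k , wk≉0) v∥w w∥z i j = cancel wk≉0
    (combine (z j) (v∥w i k) (combine (- z i) (v∥w j k) (combine (v k) (w∥z i j)
      (solve 8 (#0 :* (#1 :* #2) :+ #2 :* (#3 :* #4) :+ :- #5 :* (#3 :* #6) :+ #3 :* (#6 :* #5)) (#0
      :* (#7 :* #5) :+ #2 :* (#1 :* #0) :+ :- #5 :* (#7 :* #0) :+ #3 :* (#4 :* #2))))))

  ⟨_,_,_⟩ : (a b c : Carrier) → Fin 3 → Carrier
  ⟨ a , b , c ⟩ 0F = a
  ⟨ a , b , c ⟩ 1F = b
  ⟨ a , b , c ⟩ 2F = c

  infixr 7 _⊗_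
  _⊗_ : (I → Carrier) → (J → Carrier) → I × J → Carrier
  (v ⊗ w) (i , j) = v i * w j

  -- Parallel nonzero vectors have the same support, so v′ is nonzero at i and w′ at j. Fixing one
  -- factor at such a coordinate and cancelling leaves the minors of the other.
  ∥-factors : {v v′ : I → Carrier} {w w′ : J → Carrier} →
    Nonzero v → Nonzero v′ → Nonzero w → Nonzero w′ → v ⊗ w ∥ v′ ⊗ w′ → v ∥ v′ × w ∥ w′
  ∥-factors {v = v} {v′} {w} {w′} (i , vi≉0) (i′ , v′i′≉0) (j , wj≉0) (j′ , w′j′≉0) par =
    (λ k k′ → cancel (*-≉0 wj≉0 w′j≉0) (combine 1# (par (k , j) (k′ , j))
      (solve 6 (#0 :* #1 :* (#2 :* #3) :+ :1 :* (#4 :* #0 :* (#5 :* #1))) (#0 :* #1 :* (#4 :* #5) :+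
      :1 :* (#2 :* #0 :* (#3 :* #1)))))) ,
    (λ k k′ → cancel (*-≉0 vi≉0 v′i≉0) (combine 1# (par (i , k) (i , k′))
      (solve 6 (#0 :* #1 :* (#2 :* #3) :+ :1 :* (#0 :* #4 :* (#1 :* #5))) (#0 :* #1 :* (#4 :* #5) :+
      :1 :* (#0 :* #2 :* (#1 :* #3))))))
    where
    nz = factors≉0 (sym (par (i , j) (i′ , j′))) (*-≉0 (*-≉0 vi≉0 wj≉0) (*-≉0 v′i′≉0 w′j′≉0))
    v′i≉0 = proj₁ (factors≉0 refl (proj₂ nz))
    w′j≉0 = proj₂ (factors≉0 refl (proj₂ nz))

  -- The 2 × 2 minors of v ⊗ w + v′ ⊗ w′ are the products of a minor of (v , v′)
  -- with a minor of (w , w′).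
  ∥-sum : {v v′ v″ : I → Carrier} {w w′ w″ : J → Carrier} →
    (∀ i j → v i * w j + v′ i * w′ j ≈ v″ i * w″ j) → v ∥ v′ ⊎ w ∥ w′
  ∥-sum {v = v} {v′} {v″} {w} {w′} {w″} h with em {Lift c (v ∥ v′)}
  ... | yes (lift v∥v′) = inj₁ v∥v′
  ... | no v∦v′ = inj₂ w∥w′
    where
    w∥w′ : w ∥ w′
    w∥w′ j j′ with (w j * w′ j′ - w j′ * w′ j) ≈0?
    ... | yes e = combine 1# e (solve 4 (#0 :* #1 :+ :1 :* :0) (#2 :* #3 :+ :1 :* (#0 :* #1 :- #2 :*
      #3)))
    ... | no minor≉0 = ⊥-elim (v∦v′ (lift λ i i′ → cancel minor≉0
      (combine (v i′ * w j′ + v′ i′ * w′ j′) (h i j)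
      (combine (v″ i * w″ j) (h i′ j′)
      (combine (- (v i * w j′ + v′ i * w′ j′)) (h i′ j)
      (combine (- (v″ i′ * w″ j)) (h i j′)
        (solve 12 ((#0 :* #1 :- #2 :* #3) :* (#4 :* #5) :+ (#6 :* #2 :+ #5 :* #1) :* (#7 :* #8) :+
        #7 :* #8 :* (#9 :* #10) :+ :- (#4 :* #2 :+ #11 :* #1) :* (#9 :* #8) :+ :- (#9 :* #8) :* (#7
        :* #10)) ((#0 :* #1 :- #2 :* #3) :* (#6 :* #11) :+ (#6 :* #2 :+ #5 :* #1) :* (#4 :* #0 :+
        #11 :* #3) :+ #7 :* #8 :* (#6 :* #2 :+ #5 :* #1) :+ :- (#4 :* #2 :+ #11 :* #1) :* (#6 :* #0
        :+ #5 :* #3) :+ :- (#9 :* #8) :* (#4 :* #2 :+ #11 :* #1)))))))))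

  -- Three tensors that depend on one coordinate of size 2 only.
  planar⇒dependent : (f : Fin 3 → I → Carrier) (σ : Fin 2 → I) (π : I → Fin 2)
    (κ : I → Carrier) {d : Carrier} → d ≉ 0# →
    (∀ k m → d * f k m ≈ κ m * f k (σ (π m))) →
    (∀ (y : Fin 3 → Carrier) → (∀ m → y 0F * f 0F m + y 1F * f 1F m + y 2F * f 2F m ≈ 0#) → ∀ k → y k ≈ 0#) → ⊥
  planar⇒dependent f σ π κ {d} d≉0 planar independent = 1≉0
    (independent ⟨ 1# , 0# , 0# ⟩
      (λ m → *≈0⇒≈0 d≉0 (combine 1# (planar 0F m) (combine (κ m) (β₀≈0 (π m))
        (solve 6 (#0 :* (:1 :* #1 :+ :0 :* #2 :+ :0 :* #3) :+ :1 :* (#4 :* #5) :+ #4 :* :0) (:0 :+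
        :1 :* (#0 :* #1) :+ #4 :* #5))))) 0F)
    where
    β : Fin 3 → Fin 2 → Carrier
    β k j = f k (σ j)

    extend : ∀ (y : Fin 3 → Carrier) → (∀ j → y 0F * β 0F j + y 1F * β 1F j + y 2F * β 2F j ≈ 0#) → ∀ k → y k ≈ 0#
    extend y h = independent y λ m → *≈0⇒≈0 d≉0
      (combine (y 0F) (planar 0F m) (combine (y 1F) (planar 1F m) (combine (y 2F) (planar 2F m)
        (combine (κ m) (h (π m)) (solve 11 (#0 :* (#1 :* #2 :+ #3 :* #4 :+ #5 :* #6) :+ #1 :* (#7 :*
          #8) :+ #3 :* (#7 :* #9) :+ #5 :* (#7 :* #10) :+ #7 :* :0) (:0 :+ #1 :* (#0 :* #2) :+ #3 :*
          (#0 :* #4) :+ #5 :* (#0 :* #6) :+ #7 :* (#1 :* #8 :+ #3 :* #9 :+ #5 :* #10)))))))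

    minor : Fin 3 → Fin 3 → Carrier
    minor k l = β k 0F * β l 1F - β k 1F * β l 0F

    -- The three maximal minors of a 3 × 2 matrix are the coefficients of a relation between its
    -- rows; independence makes them zero. Given this, β 1F j and - β 0F j are the coefficients of
    -- another relation, which yields `β₀≈0`.
    β₀∥β₁ : β 0F 0F * β 1F 1F - β 0F 1F * β 1F 0F ≈ 0#
    β₀∥β₁ = extend ⟨ minor 1F 2F , minor 2F 0F , minor 0F 1F ⟩
      (λ { 0F → solve 6 ((#0 :* #1 :- #2 :* #3) :* #4 :+ (#3 :* #5 :- #1 :* #4) :* #0 :+ (#4 :* #2
        :- #5 :* #0) :* #3) :0 ; 1F → solve 6 ((#0 :* #1 :- #2 :* #3) :* #4 :+ (#3 :* #4 :- #1 :*
        #5) :* #2 :+ (#5 :* #2 :- #4 :* #0) :* #1) :0 }) 2F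

    β₀≈0 : ∀ j → β 0F j ≈ 0#
    β₀≈0 j = combine (- 1#) (extend ⟨ β 1F j , - β 0F j , 0# ⟩ (vanish j) 1F)
      (solve 1 (#0 :+ :- :1 :* :0) (:0 :+ :- :1 :* :- #0))
      where
      vanish : ∀ j j′ → β 1F j * β 0F j′ + - β 0F j * β 1F j′ + 0# * β 2F j′ ≈ 0#
      vanish 0F 0F = solve 3 (#0 :* #1 :+ :- #1 :* #0 :+ :0 :* #2) :0
      vanish 0F 1F = combine (- 1#) β₀∥β₁
        (solve 5 (#0 :* #1 :+ :- #2 :* #3 :+ :0 :* #4 :+ :- :1 :* :0) (:0 :+ :- :1 :* (#2 :* #3 :-
        #1 :* #0)))
      vanish 1F 0F = combine 1# β₀∥β₁ (solve 5 (#0 :* #1 :+ :- #2 :* #3 :+ :0 :* #4 :+ :1 :* :0) (:0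
        :+ :1 :* (#1 :* #0 :- #2 :* #3)))
      vanish 1F 1F = solve 3 (#0 :* #1 :+ :- #1 :* #0 :+ :0 :* #2) :0

-- The combinatorics of three pure tensors any two of which have a pure sum: X, Y and Z say
-- that two of them agree up to a scalar in the first, second or third factor.
module TwoSharedFactors {a ℓ} {A : Set a} (X Y Z : A → A → Set ℓ)
  (X-sym : ∀ {p q} → X p q → X q p) (Y-sym : ∀ {p q} → Y p q → Y q p) (Z-sym : ∀ {p q} → Z p q → Z q p)
  (X-trans : ∀ {p q r} → X p q → X q r → X p r) (Y-trans : ∀ {p q r} → Y p q → Y q r → Y p r)
  (Z-trans : ∀ {p q r} → Z p q → Z q r → Z p r) where

  Shares : A → A → Set ℓ
  Shares p q = (X p q × Y p q) ⊎ (X p q × Z p q) ⊎ (Y p q × Z p q)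

  Distinct : A → A → Set ℓ
  Distinct p q = ¬ (X p q × Y p q × Z p q)

  -- If p and q agree in X and Z, they differ in Y, so r cannot agree in Y with both. It therefore
  -- agrees in X and Z with one of them, and hence with both.
  exclude : ∀ {p q r} → Distinct p q → Distinct p r → Shares p r → Shares q r →
            ¬ (X p q × Z p q × X p r × Z p r) → ¬ (X p q × Z p q)
  exclude pq pr (inj₁ (x , y)) (inj₁ (_ , y′)) _ (x₀ , z₀) = pq (x₀ , Y-trans y (Y-sym y′) , z₀)
  exclude pq pr (inj₁ (x , y)) (inj₂ (inj₁ (_ , z′))) _ (x₀ , z₀) = pr (x , y , Z-trans z₀ z′)
  exclude pq pr (inj₁ (x , y)) (inj₂ (inj₂ (y′ , _))) _ (x₀ , z₀) = pq (x₀ , Y-trans y (Y-sym y′) , z₀)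
  exclude pq pr (inj₂ (inj₁ (x , z))) _ all (x₀ , z₀) = all (x₀ , z₀ , x , z)
  exclude pq pr (inj₂ (inj₂ (y , z))) (inj₁ (_ , y′)) _ (x₀ , z₀) = pq (x₀ , Y-trans y (Y-sym y′) , z₀)
  exclude pq pr (inj₂ (inj₂ (y , z))) (inj₂ (inj₁ (x′ , _))) _ (x₀ , z₀) = pr (X-trans x₀ x′ , y , z)
  exclude pq pr (inj₂ (inj₂ (y , z))) (inj₂ (inj₂ (y′ , _))) _ (x₀ , z₀) = pq (x₀ , Y-trans y (Y-sym y′) , z₀)

-- Images of the subspaces a ⊗ b ⊗ 𝔽³

module Blocks {c ℓ} (F : Field c ℓ) (em : ExcludedMiddle (c ⊔ ℓ)) where
  open Field F hiding (zero)
  open FieldLemmas F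
  open Moves F
  open Parallel F em
  open Tensors F 2 2 3
  open GeneralLinear {F = F} V using (GL; module GL; module Subgroup)
  open GL

  e≉0 : ∀ {n} (i : Fin n) → Nonzero (e i)
  e≉0 i = i , λ eq → 1≉0 (trans (sym (e-diagonal i)) eq)

  record PureTensor : Set (c ⊔ ℓ) where
    field
      u : Fin 2 → Carrier
      v : Fin 2 → Carrier
      w : Fin 3 → Carrier
      u≉0 : Nonzero u
      v≉0 : Nonzero v
      w≉0 : Nonzero w

    tensor : Tensor
    tensor = pure u v w

  open PureTensor

  pureTensor : ∀ {t} → Fundamental t → ∃[ p ] ∀ m → t m ≈ tensor p m
  pureTensor (u , v , w , u≉0 , v≉0 , w≉0 , eq) = record
    { u = u ; v = v ; w = w
    ; u≉0 = nonzero u u≉0 ; v≉0 = nonzero v v≉0 ; w≉0 = nonzero w w≉0 } , eq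

  fundamental : ∀ {u v w} → Nonzero u → Nonzero v → Nonzero w → Fundamental (pure u v w)
  fundamental (_ , u≉0) (_ , v≉0) (_ , w≉0) =
    _ , _ , _ , (λ z → u≉0 (z _)) , (λ z → v≉0 (z _)) , (λ z → w≉0 (z _)) , λ _ → refl

  X Y Z : PureTensor → PureTensor → Set ℓ
  X p q = u p ∥ u q
  Y p q = v p ∥ v q
  Z p q = w p ∥ w q

  X-sym : ∀ {p q} → X p q → X q p
  X-sym = ∥-sym
  Y-sym : ∀ {p q} → Y p q → Y q p
  Y-sym = ∥-sym
  Z-sym : ∀ {p q} → Z p q → Z q p
  Z-sym = ∥-sym
  X-trans : ∀ {p q r} → X p q → X q r → X p r
  X-trans {q = q} = ∥-trans (u≉0 q)
  Y-trans : ∀ {p q r} → Y p q → Y q r → Y p r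
  Y-trans {q = q} = ∥-trans (v≉0 q)
  Z-trans : ∀ {p q r} → Z p q → Z q r → Z p r
  Z-trans {q = q} = ∥-trans (w≉0 q)

  module XYZ = TwoSharedFactors X Y Z
    (λ {p} {q} → X-sym {p} {q}) (λ {p} {q} → Y-sym {p} {q}) (λ {p} {q} → Z-sym {p} {q})
    (λ {p} {q} {r} → X-trans {p} {q} {r}) (λ {p} {q} {r} → Y-trans {p} {q} {r})
    (λ {p} {q} {r} → Z-trans {p} {q} {r})
  module YXZ = TwoSharedFactors Y X Z
    (λ {p} {q} → Y-sym {p} {q}) (λ {p} {q} → X-sym {p} {q}) (λ {p} {q} → Z-sym {p} {q})
    (λ {p} {q} {r} → Y-trans {p} {q} {r}) (λ {p} {q} {r} → X-trans {p} {q} {r})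
    (λ {p} {q} {r} → Z-trans {p} {q} {r})
  open XYZ using (Shares; Distinct)

  swapXY : ∀ {p q} → Shares p q → YXZ.Shares p q
  swapXY (inj₁ (x , y))        = inj₁ (y , x)
  swapXY (inj₂ (inj₁ (x , z))) = inj₂ (inj₂ (x , z))
  swapXY (inj₂ (inj₂ (y , z))) = inj₂ (inj₁ (y , z))

  -- The minors of the flattenings u ⊗ (v ⊗ w) and v ⊗ (u ⊗ w) each leave an alternative; the
  -- combinations give agreement in two factors.
  shares : ∀ p q r → (∀ m → tensor p m + tensor q m ≈ tensor r m) → Shares p q
  shares p q r eq
    with ∥-sum {v = u p} {u q} {u r} {v p ⊗ w p} {v q ⊗ w q} {v r ⊗ w r}
           (λ { i (j , k) → combine 1# (eq (i , j , k))
             (solve 9 (#0 :* (#1 :* #2) :+ #3 :* (#4 :* #5) :+ :1 :* (#6 :* #7 :* #8)) (#6 :* (#7 :*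
             #8) :+ :1 :* (#0 :* #1 :* #2 :+ #3 :* #4 :* #5))) })
       | ∥-sum {v = v p} {v q} {v r} {u p ⊗ w p} {u q ⊗ w q} {u r ⊗ w r}
           (λ { j (i , k) → combine 1# (eq (i , j , k))
             (solve 9 (#0 :* (#1 :* #2) :+ #3 :* (#4 :* #5) :+ :1 :* (#6 :* #7 :* #8)) (#7 :* (#6 :*
             #8) :+ :1 :* (#1 :* #0 :* #2 :+ #4 :* #3 :* #5))) })
  ... | inj₁ x | inj₁ y = inj₁ (x , y)
  ... | inj₁ _ | inj₂ xz =
    inj₂ (inj₁ (∥-factors (u≉0 p) (u≉0 q) (w≉0 p) (w≉0 q) xz))
  ... | inj₂ yz | _ =
    inj₂ (inj₂ (∥-factors (v≉0 p) (v≉0 q) (w≉0 p) (w≉0 q) yz))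

  tensor-∥ : ∀ p q → X p q × Y p q × Z p q → tensor p ∥ tensor q
  tensor-∥ p q (x , y , z) (i , j , k) (i′ , j′ , k′) =
    combine (v p j * w p k * v q j′ * w q k′) (x i i′)
    (combine (u p i′ * u q i * w p k * w q k′) (y j j′)
    (combine (u p i′ * u q i * v p j′ * v q j) (z k k′)
      (solve 12 (#0 :* #1 :* #2 :* (#3 :* #4 :* #5) :+ #1 :* #2 :* #4 :* #5 :* (#6 :* #7) :+ #6 :*
      #7 :* #2 :* #5 :* (#8 :* #9) :+ #6 :* #7 :* #8 :* #9 :* (#10 :* #11)) (#6 :* #8 :* #10 :* (#7
      :* #9 :* #11) :+ #1 :* #2 :* #4 :* #5 :* (#0 :* #3) :+ #6 :* #7 :* #2 :* #5 :* (#1 :* #4) :+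
      #6 :* #7 :* #8 :* #9 :* (#2 :* #5)))))

  tensor≉0 : ∀ p → Nonzero (tensor p)
  tensor≉0 p = let i , ui≉0 = u≉0 p ; j , vj≉0 = v≉0 p ; k , wk≉0 = w≉0 p in
    (i , j , k) , *-≉0 (*-≉0 ui≉0 vj≉0) wk≉0

  module _ (g : GL) (g∈G : Subgroup.Member G g) where

    image : ∀ {u v w} → Nonzero u → Nonzero v → Nonzero w → Fundamental (⟦ g ⟧ (pure u v w))
    image u≉0 v≉0 w≉0 = Equivalence.to (g∈G _) (fundamental u≉0 v≉0 w≉0)

    expand₃ : ∀ u v x m → ⟦ g ⟧ (pure u v x) m ≈
      x 0F * ⟦ g ⟧ (pure u v (e 0F)) m + x 1F * ⟦ g ⟧ (pure u v (e 1F)) m +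
      x 2F * ⟦ g ⟧ (pure u v (e 2F)) m
    expand₃ u v x m = begin
      ⟦ g ⟧ (pure u v x) m
        ≈⟨ ⟦⟧-cong g (λ { (i , j , 0F) → solve 5 (#0 :* #1 :* #2) (#2 :* (#0 :* #1 :* :1) :+ #3 :*
          (#0 :* #1 :* :0) :+ #4 :* (#0 :* #1 :* :0)) ; (i , j , 1F) → solve 5 (#0 :* #1 :* #2) (#3
          :* (#0 :* #1 :* :0) :+ #2 :* (#0 :* #1 :* :1) :+ #4 :* (#0 :* #1 :* :0)) ; (i , j , 2F) →
          solve 5 (#0 :* #1 :* #2) (#3 :* (#0 :* #1 :* :0) :+ #4 :* (#0 :* #1 :* :0) :+ #2 :* (#0 :*
          #1 :* :1)) }) m ⟩
      ⟦ g ⟧ (λ m → (x 0F * pure u v (e 0F) m + x 1F * pure u v (e 1F) m) + x 2F * pure u v (e 2F) m) m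
        ≈⟨ +ᴹ-homo g _ _ m ⟩
      ⟦ g ⟧ (λ m → x 0F * pure u v (e 0F) m + x 1F * pure u v (e 1F) m) m +
      ⟦ g ⟧ (λ m → x 2F * pure u v (e 2F) m) m
        ≈⟨ +-cong (+ᴹ-homo g _ _ m) (*ₗ-homo g _ _ m) ⟩
      (⟦ g ⟧ (λ m → x 0F * pure u v (e 0F) m) m + ⟦ g ⟧ (λ m → x 1F * pure u v (e 1F) m) m) +
      x 2F * ⟦ g ⟧ (pure u v (e 2F)) m
        ≈⟨ +-congʳ (+-cong (*ₗ-homo g _ _ m) (*ₗ-homo g _ _ m)) ⟩
      x 0F * ⟦ g ⟧ (pure u v (e 0F)) m + x 1F * ⟦ g ⟧ (pure u v (e 1F)) m +
      x 2F * ⟦ g ⟧ (pure u v (e 2F)) m ∎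
      where open import Relation.Binary.Reasoning.Setoid setoid

    g-zero : ∀ {t} → (∀ m → ⟦ g ⟧ t m ≈ 0#) → ∀ m → t m ≈ 0#
    g-zero {t} eq = injective g (λ m → trans (eq m) (sym (0ᴹ-homo g m)))

    module Block (a b : Fin 2 → Carrier) (a≉0 : Nonzero a) (b≉0 : Nonzero b) (p : Fin 3 → PureTensor)
                 (f≈p : ∀ k m → ⟦ g ⟧ (pure a b (e k)) m ≈ tensor (p k) m) where

      f : Fin 3 → Tensor
      f k = ⟦ g ⟧ (pure a b (e k))

      sum-e : ∀ k m → e k 0F * f 0F m + e k 1F * f 1F m + e k 2F * f 2F m ≈ f k m
      sum-e k m = sym (expand₃ a b (e k) m)

      independent : ∀ (y : Fin 3 → Carrier) →
        (∀ m → y 0F * f 0F m + y 1F * f 1F m + y 2F * f 2F m ≈ 0#) → ∀ k → y k ≈ 0#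
      independent y eq k = let i , ai≉0 = a≉0 ; j , bj≉0 = b≉0 in
        *≈0⇒≈0 (*-≉0 ai≉0 bj≉0)
          (g-zero (λ m → trans (expand₃ a b y m) (eq m)) (i , j , k))

      -- The hypothesis `e k l ≈ 0#` encodes k ≠ l. For fixed m the combination f l m · f k - f k m
      -- · f l vanishes, so independence makes its coefficients zero.
      f-∥ : ∀ k l → e k l ≈ 0# → f k ∥ f l → ∀ m → f k m ≈ 0#
      f-∥ k l ekl≈0 par m = combine (f l m) ekl≈0 (combine (- f k m) (e-diagonal l)
        (combine (- 1#) (independent (λ j → f l m * e k j + - f k m * e l j)
          (λ m′ → combine (f l m) (sum-e k m′) (combine (- f k m) (sum-e l m′)
            (combine 1# (par m′ m) (solve 13 ((#0 :* #1 :+ :- #2 :* #3) :* #4 :+ (#0 :* #5 :+ :- #2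
              :* #6) :* #7 :+ (#0 :* #8 :+ :- #2 :* #9) :* #10 :+ #0 :* #11 :+ :- #2 :* #12 :+ :1 :*
              (#2 :* #12)) (:0 :+ #0 :* (#1 :* #4 :+ #5 :* #7 :+ #8 :* #10) :+ :- #2 :* (#3 :* #4 :+
              #6 :* #7 :+ #9 :* #10) :+ :1 :* (#11 :* #0)))))) l)
              (solve 4 (#0 :+ #1 :* :0 :+ :- #0 :* :1 :+ :- :1 :* :0) (:0 :+ #1 :* #2 :+ :- #0 :* #3
              :+ :- :1 :* (#1 :* #2 :+ :- #0 :* #3)))))

      distinct : ∀ k l → e k l ≈ 0# → Distinct (p k) (p l)
      distinct k l ekl≈0 xyz = let m , ≉0 = tensor≉0 (p k) in
        ≉0 (trans (sym (f≈p k m)) (f-∥ k l ekl≈0 par m))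
        where
        par : f k ∥ f l
        par m m′ = trans (*-cong (f≈p k m) (f≈p l m′))
          (trans (tensor-∥ (p k) (p l) xyz m m′) (sym (*-cong (f≈p k m′) (f≈p l m))))

      shares-pair : ∀ k l → e k l ≈ 0# → Shares (p k) (p l)
      shares-pair k l ekl≈0 =
        let r , r≈ = pureTensor (image {w = λ j → e k j + e l j} a≉0 b≉0 e+e≉0)
        in shares (p k) (p l) r λ m → trans (sum-of m) (r≈ m)
        where
        e+e≉0 : Nonzero (λ j → e k j + e l j)
        e+e≉0 = l , λ eq → 1≉0
          (trans (sym (e-diagonal l)) (combine (- 1#) ekl≈0 (combine 1# eq
            (solve 2 (#0 :+ :- :1 :* :0 :+ :1 :* :0) (:0 :+ :- :1 :* #1 :+ :1 :* (#1 :+ #0))))))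

        sum-of : ∀ m → tensor (p k) m + tensor (p l) m ≈ ⟦ g ⟧ (pure a b (λ j → e k j + e l j)) m
        sum-of m = trans (sym (+-cong (f≈p k m) (f≈p l m)))
          (trans (+-cong (expand₃ a b (e k) m) (expand₃ a b (e l) m))
            (trans (solve 9 (#0 :* #1 :+ #2 :* #3 :+ #4 :* #5 :+ (#6 :* #1 :+ #7 :* #3 :+ #8 :* #5))
              ((#0 :+ #6) :* #1 :+ (#2 :+ #7) :* #3 :+ (#4 :+ #8) :* #5)) (sym (expand₃ a b (λ j → e
              k j + e l j) m))))

      -- Otherwise the three independent images would lie in u ⊗ 𝔽² ⊗ w, which has dimension two.
      not-all-XZ : ¬ (∀ k → X (p 0F) (p k) × Z (p 0F) (p k))
      not-all-XZ xz = let i , ui≉0 = u≉0 (p 0F) ; k , wk≉0 = w≉0 (p 0F) in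
        planar⇒dependent f (λ j → i , j , k) (λ { (_ , j , _) → j })
          (λ { (i′ , _ , k′) → u (p 0F) i′ * w (p 0F) k′ }) (*-≉0 ui≉0 wk≉0)
          (λ { l (i′ , j , k′) → planar i k l i′ j k′ })
          independent
        where
        planar : ∀ i k l i′ j k′ →
          u (p 0F) i * w (p 0F) k * f l (i′ , j , k′) ≈ u (p 0F) i′ * w (p 0F) k′ * f l (i , j , k)
        planar i k l i′ j k′ =
          combine (u (p 0F) i * w (p 0F) k) (f≈p l (i′ , j , k′))
          (combine (- (u (p 0F) i′ * w (p 0F) k′)) (f≈p l (i , j , k))
          (combine (w (p 0F) k * v (p l) j * w (p l) k′) (proj₁ (xz l) i i′)
          (combine (u (p 0F) i′ * v (p l) j * u (p l) i) (proj₂ (xz l) k k′)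
            (solve 11 (#0 :* #1 :* #2 :+ #0 :* #1 :* (#3 :* #4 :* #5) :+ :- (#6 :* #7) :* (#8 :* #4
            :* #9) :+ #1 :* #4 :* #5 :* (#6 :* #8) :+ #6 :* #4 :* #8 :* (#7 :* #9)) (#6 :* #7 :* #10
            :+ #0 :* #1 :* #2 :+ :- (#6 :* #7) :* #10 :+ #1 :* #4 :* #5 :* (#0 :* #3) :+ #6 :* #4 :*
            #8 :* (#1 :* #5))))))

      not-all-YZ : ¬ (∀ k → Y (p 0F) (p k) × Z (p 0F) (p k))
      not-all-YZ yz = let j , vj≉0 = v≉0 (p 0F) ; k , wk≉0 = w≉0 (p 0F) in
        planar⇒dependent f (λ i → i , j , k) (λ { (i , _ , _) → i })
          (λ { (_ , j′ , k′) → v (p 0F) j′ * w (p 0F) k′ }) (*-≉0 vj≉0 wk≉0)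
          (λ { l (i , j′ , k′) → planar j k l i j′ k′ })
          independent
        where
        planar : ∀ j k l i j′ k′ →
          v (p 0F) j * w (p 0F) k * f l (i , j′ , k′) ≈ v (p 0F) j′ * w (p 0F) k′ * f l (i , j , k)
        planar j k l i j′ k′ =
          combine (v (p 0F) j * w (p 0F) k) (f≈p l (i , j′ , k′))
          (combine (- (v (p 0F) j′ * w (p 0F) k′)) (f≈p l (i , j , k))
          (combine (w (p 0F) k * u (p l) i * w (p l) k′) (proj₁ (yz l) j j′)
          (combine (v (p 0F) j′ * u (p l) i * v (p l) j) (proj₂ (yz l) k k′)
            (solve 11 (#0 :* #1 :* #2 :+ #0 :* #1 :* (#3 :* #4 :* #5) :+ :- (#6 :* #7) :* (#3 :* #8
            :* #9) :+ #1 :* #3 :* #5 :* (#6 :* #8) :+ #6 :* #3 :* #8 :* (#7 :* #9)) (#6 :* #7 :* #10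
            :+ #0 :* #1 :* #2 :+ :- (#6 :* #7) :* #10 :+ #1 :* #3 :* #5 :* (#0 :* #4) :+ #6 :* #3 :*
            #8 :* (#1 :* #5))))))

      module _ (k l : Fin 3) (0k : e 0F k ≈ 0#) (0l : e 0F l ≈ 0#) (kl : e k l ≈ 0#)
               (cases : (P : Fin 3 → Set ℓ) → P 0F → P k → P l → ∀ m → P m) where

        -- If the third factor were shared, `exclude` would reduce to the situation in which all
        -- three tensors share it together with one other factor; `cases` says that `0F`, `k` and
        -- `l` are all the indices.
        XY-of : Shares (p 0F) (p k) → X (p 0F) (p k) × Y (p 0F) (p k)
        XY-of (inj₁ xy) = xy
        XY-of (inj₂ (inj₁ xz)) = ⊥-elim (XYZ.exclude {p 0F} {p k} {p l}
          (distinct 0F k 0k) (distinct 0F l 0l) (shares-pair 0F l 0l) (shares-pair k l kl)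
          (λ { (x₁ , z₁ , x₂ , z₂) → not-all-XZ (cases (λ m → X (p 0F) (p m) × Z (p 0F) (p m))
            (∥-refl (u (p 0F)) , ∥-refl (w (p 0F))) (x₁ , z₁) (x₂ , z₂)) }) xz)
        XY-of (inj₂ (inj₂ yz)) = ⊥-elim (YXZ.exclude {p 0F} {p k} {p l}
          (λ { (y , x , z) → distinct 0F k 0k (x , y , z) })
          (λ { (y , x , z) → distinct 0F l 0l (x , y , z) })
          (swapXY {p 0F} {p l} (shares-pair 0F l 0l)) (swapXY {p k} {p l} (shares-pair k l kl))
          (λ { (y₁ , z₁ , y₂ , z₂) → not-all-YZ (cases (λ m → Y (p 0F) (p m) × Z (p 0F) (p m))
            (∥-refl (v (p 0F)) , ∥-refl (w (p 0F))) (y₁ , z₁) (y₂ , z₂)) }) yz)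

      XY : ∀ k → X (p 0F) (p k) × Y (p 0F) (p k)
      XY 0F = ∥-refl (u (p 0F)) , ∥-refl (v (p 0F))
      XY 1F = XY-of 1F 2F refl refl refl (λ { P x y z 0F → x ; P x y z 1F → y ; P x y z 2F → z })
        (shares-pair 0F 1F refl)
      XY 2F = XY-of 2F 1F refl refl refl (λ { P x y z 0F → x ; P x y z 1F → z ; P x y z 2F → y })
        (shares-pair 0F 2F refl)

    record BlockImage (a b : Fin 2 → Carrier) : Set (c ⊔ ℓ) where
      field
        a′ b′ : Fin 2 → Carrier
        n     : Fin 3 → Fin 3 → Carrier
        a′≉0  : Nonzero a′
        b′≉0  : Nonzero b′
        maps  : ∀ k i j l → ⟦ g ⟧ (pure a b (e k)) (i , j , l) ≈ a′ i * b′ j * n k l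

      φ : (Fin 3 → Carrier) → Fin 3 → Carrier
      φ x l = x 0F * n 0F l + x 1F * n 1F l + x 2F * n 2F l

      maps-φ : ∀ x i j l → ⟦ g ⟧ (pure a b x) (i , j , l) ≈ a′ i * b′ j * φ x l
      maps-φ x i j l = trans (expand₃ a b x (i , j , l))
        (combine (x 0F) (maps 0F i j l) (combine (x 1F) (maps 1F i j l)
          (combine (x 2F) (maps 2F i j l) (solve 11 (#0 :* #1 :+ #2 :* #3 :+ #4 :* #5 :+ #0 :* (#6
            :* #7 :* #8) :+ #2 :* (#6 :* #7 :* #9) :+ #4 :* (#6 :* #7 :* #10)) (#6 :* #7 :* (#0 :*
            #8 :+ #2 :* #9 :+ #4 :* #10) :+ #0 :* #1 :+ #2 :* #3 :+ #4 :* #5)))))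

    blockImage : ∀ a b → Nonzero a → Nonzero b → BlockImage a b
    blockImage a b a≉0 b≉0 =
      let i₀ , ui₀≉0 = u≉0 (p 0F)
          j₀ , vj₀≉0 = v≉0 (p 0F)
          h , eq = inverse _ (*-≉0 ui₀≉0 vj₀≉0)
      in record
        { a′ = u (p 0F) ; b′ = v (p 0F)
        -- The scalars by which u and v of `p k` differ from those of `p 0F` are read off at i₀ and
        -- j₀ and moved to the third factor.
        ; n = λ k l → u (p k) i₀ * v (p k) j₀ * h * w (p k) l
        ; a′≉0 = u≉0 (p 0F) ; b′≉0 = v≉0 (p 0F)
        ; maps = λ k i j l → trans (f≈p k (i , j , l))
            (rescale (u (p 0F) i₀) (u (p 0F) i) (v (p 0F) j₀) (v (p 0F) j)
              (u (p k) i₀) (u (p k) i) (v (p k) j₀) (v (p k) j) (w (p k) l) h eq (proj₁ (XY k) i₀ i) (proj₂ (XY k) j₀ j))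
        }
      where
      p : Fin 3 → PureTensor
      p k = proj₁ (pureTensor (image a≉0 b≉0 (e≉0 k)))

      f≈p : ∀ k m → ⟦ g ⟧ (pure a b (e k)) m ≈ tensor (p k) m
      f≈p k = proj₂ (pureTensor (image a≉0 b≉0 (e≉0 k)))

      open Block a b a≉0 b≉0 p f≈p using (XY)

      rescale : ∀ x₀ x y₀ y x₀′ x′ y₀′ y′ z h → x₀ * y₀ * h ≈ 1# →
                x₀ * x′ ≈ x * x₀′ → y₀ * y′ ≈ y * y₀′ →
                x′ * y′ * z ≈ x * y * (x₀′ * y₀′ * h * z)
      rescale x₀ x y₀ y x₀′ x′ y₀′ y′ z h eq px py =
        combine (- (x′ * y′ * z)) eq (combine (y₀ * y′ * h * z) px
          (combine (x * x₀′ * h * z) py (solve 10 (#0 :* #1 :* #2 :+ :- (#0 :* #1 :* #2) :* :1 :+ #3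
            :* #1 :* #4 :* #2 :* (#5 :* #6) :+ #5 :* #6 :* #4 :* #2 :* (#7 :* #8)) (#5 :* #7 :* (#6
            :* #8 :* #4 :* #2) :+ :- (#0 :* #1 :* #2) :* (#9 :* #3 :* #4) :+ #3 :* #1 :* #4 :* #2 :*
            (#9 :* #0) :+ #5 :* #6 :* #4 :* #2 :* (#3 :* #1)))))

-- Elements of G as Kronecker products

module Kronecker {c ℓ} (F : Field c ℓ) (em : ExcludedMiddle (c ⊔ ℓ)) where
  open Field F hiding (zero)
  open FieldLemmas F
  open Moves F
  open Representatives F using (Matrix)
  open Classification F em using (_≈0?)
  open Parallel F em
  open Blocks F em
  open Tensors F 2 2 3
  open GeneralLinear {F = F} V using (GL; module GL; module Subgroup; _⁻¹ᴳ)
  open GL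

  ∥⇒multiple : ∀ {I : Set} {v w : I → Carrier} → Nonzero v → v ∥ w → ∃[ r ] ∀ i → w i ≈ r * v i
  ∥⇒multiple {v = v} {w} (i , vi≉0) v∥w =
    let h , eq = inverse _ vi≉0 in w i * h , λ j → rescale (v i) (v j) (w i) (w j) h eq (v∥w i j)
    where
    rescale : ∀ v₀ v w₀ w h → v₀ * h ≈ 1# → v₀ * w ≈ v * w₀ → w ≈ w₀ * h * v
    rescale v₀ v w₀ w h eq p = combine (- w) eq (combine h p
      (solve 5 (#0 :+ :- #0 :* :1 :+ #1 :* (#2 :* #3)) (#3 :* #1 :* #2 :+ :- #0 :* (#4 :* #1) :+ #1
      :* (#4 :* #0))))

  module _ (g : GL) (g∈G : Subgroup.Member G g) where

    g⁻¹∈G : Subgroup.Member G (g ⁻¹ᴳ)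
    g⁻¹∈G = Subgroup.⁻¹-closed G {g} g∈G

    -- Otherwise g⁻¹ would map a ⊗ b ⊗ 𝔽³ to two different spaces of that shape.
    blocks-independent : ∀ {u v u′ v′ a b a′ b′} {w w′ z z′ : Fin 3 → Carrier} i j i′ j′ k →
      Nonzero a → Nonzero b →
      (∀ m → ⟦ g ⟧ (pure u v z) m ≈ pure a b w m) →
      (∀ m → ⟦ g ⟧ (pure u′ v′ z′) m ≈ pure a′ b′ w′ m) →
      a ⊗ b ∥ a′ ⊗ b′ →
      u i * v j * z k ≉ 0# → u i′ * v j′ * z k ≈ 0# → u′ i′ * v′ j′ * z′ k ≉ 0# → ⊥
    blocks-independent {u} {v} {u′} {v′} {a} {b} {a′} {b′} {w} {w′} {z} {z′}
      i j i′ j′ k a≉0@(i₀ , ai₀≉0) b≉0@(j₀ , bj₀≉0) gz gz′ par ≉0 ≈0 ≉0′ =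
      contradict (â i) (â i′) (b̂ j) (b̂ j′) (φ w k) (φ (λ l → scale * w′ l) k)
        (maps⁻¹ {u} {v} {z} w (λ m → gz m) i j k) (maps⁻¹ {u} {v} {z} w (λ m → gz m) i′ j′ k)
        (maps⁻¹ {u′} {v′} {z′} (λ l → scale * w′ l)
          (λ { (x , y , l) → trans (gz′ (x , y , l))
            (rescale (a i₀) (b j₀) (a x) (b y) (a′ i₀) (b′ j₀) (a′ x) (b′ y) (w′ l) h eq
              (par (i₀ , j₀) (x , y))) }) i′ j′ k)
      where
      open BlockImage (blockImage (g ⁻¹ᴳ) g⁻¹∈G a b a≉0 b≉0) renaming (a′ to â; b′ to b̂)
      h = proj₁ (inverse _ (*-≉0 ai₀≉0 bj₀≉0))
      eq = proj₂ (inverse _ (*-≉0 ai₀≉0 bj₀≉0))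
      scale = a′ i₀ * b′ j₀ * h

      maps⁻¹ : ∀ {u v z} y → (∀ m → ⟦ g ⟧ (pure u v z) m ≈ pure a b y m) →
               ∀ i j k → u i * v j * z k ≈ â i * b̂ j * φ y k
      maps⁻¹ {u} {v} {z} y eq i j k = trans (sym (inverseʳ g (pure u v z) (i , j , k)))
        (trans (⟦⟧-cong (g ⁻¹ᴳ) eq (i , j , k)) (maps-φ y i j k))

      rescale : ∀ a₀ b₀ a b a₀′ b₀′ a′ b′ w h → a₀ * b₀ * h ≈ 1# →
                (a₀ * b₀) * (a′ * b′) ≈ (a * b) * (a₀′ * b₀′) →
                a′ * b′ * w ≈ a * b * (a₀′ * b₀′ * h * w)
      rescale a₀ b₀ a b a₀′ b₀′ a′ b′ w h eq p =
        combine (- (a′ * b′ * w)) eq (combine (h * w) p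
          (solve 10 (#0 :* #1 :* #2 :+ :- (#0 :* #1 :* #2) :* :1 :+ #3 :* #2 :* (#4 :* #5 :* (#6 :*
          #7))) (#4 :* #5 :* (#6 :* #7 :* #3 :* #2) :+ :- (#0 :* #1 :* #2) :* (#8 :* #9 :* #3) :+ #3
          :* #2 :* (#8 :* #9 :* (#0 :* #1)))))

      -- Both preimages have the first two factors â and b̂. At (i′ , j′) the first preimage
      -- vanishes although x ≠ 0, so â i′ · b̂ j′ = 0, and the second vanishes there as well.
      contradict : ∀ a a′ b b′ x y → u i * v j * z k ≈ a * b * x →
        u i′ * v j′ * z k ≈ a′ * b′ * x → u′ i′ * v′ j′ * z′ k ≈ a′ * b′ * y → ⊥
      contradict a a′ b b′ x y p q r = ≉0′ (trans r (trans (*-congʳ ab≈0) (zeroˡ y)))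
        where
        x≉0 : x ≉ 0#
        x≉0 x≈0 = ≉0 (trans p (trans (*-congˡ x≈0) (zeroʳ _)))
        ab≈0 : a′ * b′ ≈ 0#
        ab≈0 = *≈0⇒≈0 x≉0 (trans (*-comm x _) (trans (sym q) ≈0))

    module _ {u v : Fin 2 → Carrier} (u≉0 : Nonzero u) (v≉0 : Nonzero v) (B : BlockImage g g∈G u v) where
      open BlockImage B

      φ-injective : ∀ x → (∀ l → φ x l ≈ 0#) → ∀ k → x k ≈ 0#
      φ-injective x φx≈0 k = let i , ui≉0 = u≉0 ; j , vj≉0 = v≉0 in
        *≈0⇒≈0 (*-≉0 ui≉0 vj≉0) (g-zero g g∈G {pure u v x} (λ { (i , j , l) →
          trans (maps-φ x i j l) (trans (*-congˡ (φx≈0 l)) (zeroʳ _)) }) (i , j , k))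

      φ≉0 : ∀ {x} → Nonzero x → Nonzero (φ x)
      φ≉0 {x} (k , xk≉0) = nonzero (φ x) λ φx≈0 → xk≉0 (φ-injective x φx≈0 k)

      φ-e : ∀ k l → φ (e k) l ≈ n k l
      φ-e 0F l = solve 3 (:1 :* #0 :+ :0 :* #1 :+ :0 :* #2) #0
      φ-e 1F l = solve 3 (:0 :* #0 :+ :1 :* #1 :+ :0 :* #2) #1
      φ-e 2F l = solve 3 (:0 :* #0 :+ :0 :* #1 :+ :1 :* #2) #2

      n≉0 : ∀ k → Nonzero (n k)
      n≉0 k = let l , ≉0 = φ≉0 (e≉0 k) in l , λ ≈0 → ≉0 (trans (φ-e k l) ≈0)

      n∦n : ∀ k l → e k l ≈ 0# → ¬ n k ∥ n l
      n∦n k l ekl≈0 par = let m , nkm≉0 = n≉0 k in nkm≉0 (zeros m)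
        where
        zeros : ∀ m → n k m ≈ 0#
        zeros m = combine (n l m) ekl≈0 (combine (- n k m) (e-diagonal l) (combine (- 1#)
          (φ-injective (λ j → n l m * e k j + - n k m * e l j) (λ m′ →
            combine (n l m) (φ-e k m′) (combine (- n k m) (φ-e l m′)
              (combine 1# (par m′ m) (solve 13 ((#0 :* #1 :+ :- #2 :* #3) :* #4 :+ (#0 :* #5 :+ :-
                #2 :* #6) :* #7 :+ (#0 :* #8 :+ :- #2 :* #9) :* #10 :+ #0 :* #11 :+ :- #2 :* #12 :+
                :1 :* (#2 :* #12)) (:0 :+ #0 :* (#1 :* #4 :+ #5 :* #7 :+ #8 :* #10) :+ :- #2 :* (#3
                :* #4 :+ #6 :* #7 :+ #9 :* #10) :+ :1 :* (#11 :* #0)))))) l)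
                (solve 4 (#0 :+ #1 :* :0 :+ :- #0 :* :1 :+ :- :1 :* :0) (:0 :+ #1 :* #2 :+ :- #0 :*
                #3 :+ :- :1 :* (#1 :* #2 :+ :- #0 :* #3)))))

    module _ {u v u′ v′ : Fin 2 → Carrier}
             (u≉0 : Nonzero u) (v≉0 : Nonzero v) (u′≉0 : Nonzero u′) (v′≉0 : Nonzero v′)
             (B : BlockImage g g∈G u v) (B′ : BlockImage g g∈G u′ v′) where
      private
        module B  = BlockImage B
        module B′ = BlockImage B′

      module _ (φ∥φ : ∀ {x} → Nonzero x → B.φ x ∥ B′.φ x) where

        n∥n : ∀ k → B.n k ∥ B′.n k
        n∥n k i j = trans (sym (*-cong (φ-e u≉0 v≉0 B k i) (φ-e u′≉0 v′≉0 B′ k j)))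
          (trans (φ∥φ (e≉0 k) i j) (*-cong (φ-e u≉0 v≉0 B k j) (φ-e u′≉0 v′≉0 B′ k i)))

        module _ (r : Fin 3 → Carrier) (scaled : ∀ k l → B′.n k l ≈ r k * B.n k l) where

          -- As for a linear map all of whose vectors are eigenvectors: at e_k + e_l the parallel
          -- vectors are n_k + n_l and r_k n_k + r_l n_l, so r_k - r_l annihilates every minor of
          -- the independent vectors n_k and n_l.
          r-equal : ∀ k l → e k l ≈ 0# → r k ≈ r l
          r-equal k l ekl≈0 with (r k - r l) ≈0?
          ... | yes eq = combine 1# eq (solve 2 (#0 :+ :1 :* :0) (#1 :+ :1 :* (#0 :- #1)))
          ... | no ≉0 = ⊥-elim (n∦n u≉0 v≉0 B k l ekl≈0 λ i j → cancel ≉0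
            (minors (B.n k i) (B.n k j) (B.n l i) (B.n l j) (r k) (r l) (expanded i j)))
            where
            x : Fin 3 → Carrier
            x j = e k j + e l j

            x≉0 : Nonzero x
            x≉0 = l , λ eq → 1≉0
              (trans (sym (e-diagonal l)) (combine (- 1#) ekl≈0 (combine 1# eq
                (solve 2 (#0 :+ :- :1 :* :0 :+ :1 :* :0) (:0 :+ :- :1 :* #1 :+ :1 :* (#1 :+ #0))))))

            φx : ∀ i → B.φ x i ≈ B.n k i + B.n l i
            φx i = combine 1# (φ-e u≉0 v≉0 B k i) (combine 1# (φ-e u≉0 v≉0 B l i)
              (solve 11 ((#0 :+ #1) :* #2 :+ (#3 :+ #4) :* #5 :+ (#6 :+ #7) :* #8 :+ :1 :* #9 :+ :1
              :* #10) (#9 :+ #10 :+ :1 :* (#0 :* #2 :+ #3 :* #5 :+ #6 :* #8) :+ :1 :* (#1 :* #2 :+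
              #4 :* #5 :+ #7 :* #8))))

            φ′x : ∀ i → B′.φ x i ≈ r k * B.n k i + r l * B.n l i
            φ′x i = combine 1# (trans (φ-e u′≉0 v′≉0 B′ k i) (scaled k i))
              (combine 1# (trans (φ-e u′≉0 v′≉0 B′ l i) (scaled l i))
                (solve 13 ((#0 :+ #1) :* #2 :+ (#3 :+ #4) :* #5 :+ (#6 :+ #7) :* #8 :+ :1 :* (#9 :*
                #10) :+ :1 :* (#11 :* #12)) (#9 :* #10 :+ #11 :* #12 :+ :1 :* (#0 :* #2 :+ #3 :* #5
                :+ #6 :* #8) :+ :1 :* (#1 :* #2 :+ #4 :* #5 :+ #7 :* #8))))

            expanded : ∀ i j → (B.n k i + B.n l i) * (r k * B.n k j + r l * B.n l j) ≈
                               (B.n k j + B.n l j) * (r k * B.n k i + r l * B.n l i)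
            expanded i j = trans (sym (*-cong (φx i) (φ′x j)))
              (trans (φ∥φ x≉0 i j) (*-cong (φx j) (φ′x i)))

            minors : ∀ ki kj li lj rk rl →
              (ki + li) * (rk * kj + rl * lj) ≈ (kj + lj) * (rk * ki + rl * li) →
              (rk - rl) * (ki * lj) ≈ (rk - rl) * (kj * li)
            minors ki kj li lj rk rl eq = combine (- 1#) eq
              (solve 6 ((#0 :- #1) :* (#2 :* #3) :+ :- :1 :* ((#4 :+ #3) :* (#0 :* #2 :+ #1 :* #5)))
              ((#0 :- #1) :* (#4 :* #5) :+ :- :1 :* ((#2 :+ #5) :* (#0 :* #4 :+ #1 :* #3))))

          r-constant : ∀ k → r 0F ≈ r k
          r-constant 0F = refl
          r-constant 1F = r-equal 0F 1F refl
          r-constant 2F = r-equal 0F 2F refl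

        proportional : ∃[ r ] ∀ k l → B′.n k l ≈ r * B.n k l
        proportional = r 0F , λ k l → trans (scaled k l) (*-congʳ (sym (r-constant r scaled k)))
          where
          multiple : ∀ k → ∃[ r ] ∀ l → B′.n k l ≈ r * B.n k l
          multiple k = ∥⇒multiple (n≉0 u≉0 v≉0 B k) (n∥n k)

          r : Fin 3 → Carrier
          r k = proj₁ (multiple k)

          scaled : ∀ k l → B′.n k l ≈ r k * B.n k l
          scaled k = proj₂ (multiple k)

    -- The form M ⊗ N on basis vectors. By `n₀≉0` the vector N e₀ is nonzero, so the rank of M X can
    -- be tested on M X ⊗ N e₀.
    record KroneckerForm : Set (c ⊔ ℓ) where
      field
        m    : Fin 2 → Fin 2 → Matrix
        n    : Fin 3 → Fin 3 → Carrier
        n₀≉0 : Nonzero (n 0F)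
        maps : ∀ p q k i j l → ⟦ g ⟧ (pure (e p) (e q) (e k)) (i , j , l) ≈ m p q i j * n k l

    additive₁ : ∀ {u u′ v x} → Nonzero (λ i → u i + u′ i) → Nonzero v → Nonzero x →
      Fundamental (λ m → ⟦ g ⟧ (pure u v x) m + ⟦ g ⟧ (pure u′ v x) m)
    additive₁ {u} {u′} {v} {x} u≉0 v≉0 x≉0 = Fundamental-resp
      (λ m → trans (⟦⟧-cong g {y = λ m → pure u v x m + pure u′ v x m} (λ { (i , j , k) → solve 4
        ((#0 :+ #1) :* #2 :* #3) (#0 :* #2 :* #3 :+ #1 :* #2 :* #3) }) m)
        (+ᴹ-homo g (pure u v x) (pure u′ v x) m))
      (image g g∈G u≉0 v≉0 x≉0)

    additive₂ : ∀ {u v v′ x} → Nonzero u → Nonzero (λ j → v j + v′ j) → Nonzero x →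
      Fundamental (λ m → ⟦ g ⟧ (pure u v x) m + ⟦ g ⟧ (pure u v′ x) m)
    additive₂ {u} {v} {v′} {x} u≉0 v≉0 x≉0 = Fundamental-resp
      (λ m → trans (⟦⟧-cong g {y = λ m → pure u v x m + pure u v′ x m} (λ { (i , j , k) → solve 4
        (#0 :* (#1 :+ #2) :* #3) (#0 :* #1 :* #3 :+ #0 :* #2 :* #3) }) m)
        (+ᴹ-homo g (pure u v x) (pure u v′ x) m))
      (image g g∈G u≉0 v≉0 x≉0)

    e₀+e₁≉0 : Nonzero (λ i → e {2} 0F i + e 1F i)
    e₀+e₁≉0 = 0F , λ eq → 1≉0 (trans (sym (+-identityʳ 1#)) eq)

    module _ (block : ∀ p q → BlockImage g g∈G (e p) (e q)) where
      private module Blk p q = BlockImage (block p q)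

      module _ (p q p′ q′ : Fin 2) (≉0 : e p p * e q q * 1# ≉ 0#) (≈0 : e p p′ * e q q′ * 1# ≈ 0#)
               (≉0′ : e p′ p′ * e q′ q′ * 1# ≉ 0#) where

        -- By `∥-sum` either the third factors of the two images are parallel or their first two
        -- factors are. The latter contradicts `blocks-independent`; the module hypotheses encode (p
        -- , q) ≠ (p′ , q′).
        φ-∥ : ∀ {x} (r : PureTensor) →
          (∀ m → ⟦ g ⟧ (pure (e p) (e q) x) m + ⟦ g ⟧ (pure (e p′) (e q′) x) m ≈ PureTensor.tensor r m) →
          Blk.φ p q x ∥ Blk.φ p′ q′ x
        φ-∥ {x} r r≈ = conclude (∥-sum {v = Blk.φ p q x} {Blk.φ p′ q′ x} {PureTensor.w r}
          {Blk.a′ p q ⊗ Blk.b′ p q} {Blk.a′ p′ q′ ⊗ Blk.b′ p′ q′} {PureTensor.u r ⊗ PureTensor.v r}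
          λ { l (i , j) → trans
            (trans (+-cong (*-comm _ _) (*-comm _ _))
              (sym (+-cong (Blk.maps-φ p q x i j l) (Blk.maps-φ p′ q′ x i j l))))
            (trans (r≈ (i , j , l)) (*-comm _ _)) })
          where
          conclude : Blk.φ p q x ∥ Blk.φ p′ q′ x ⊎ Blk.a′ p q ⊗ Blk.b′ p q ∥ Blk.a′ p′ q′ ⊗ Blk.b′ p′ q′ →
                     Blk.φ p q x ∥ Blk.φ p′ q′ x
          conclude (inj₁ par) = par
          conclude (inj₂ par) = ⊥-elim (blocks-independent {e p} {e q} {e p′} {e q′}
            {Blk.a′ p q} {Blk.b′ p q} {Blk.a′ p′ q′} {Blk.b′ p′ q′}
            {Blk.φ p q (e 0F)} {Blk.φ p′ q′ (e 0F)} {e 0F} {e 0F} p q p′ q′ 0F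
            (Blk.a′≉0 p q) (Blk.b′≉0 p q)
            (λ { (i , j , l) → Blk.maps-φ p q (e 0F) i j l })
            (λ { (i , j , l) → Blk.maps-φ p′ q′ (e 0F) i j l }) par ≉0 ≈0 ≉0′)

        adjacent : (∀ {x} → Nonzero x → Fundamental (λ m →
            ⟦ g ⟧ (pure (e p) (e q) x) m + ⟦ g ⟧ (pure (e p′) (e q′) x) m)) →
          ∃[ r ] ∀ k l → Blk.n p′ q′ k l ≈ r * Blk.n p q k l
        adjacent fund = proportional (e≉0 p) (e≉0 q) (e≉0 p′) (e≉0 q′) (block p q) (block p′ q′)
          λ x≉0 → let r , r≈ = pureTensor (fund x≉0) in φ-∥ r r≈

      -- Two blocks with a common index are comparable because e_p ⊗ e_q + e_p′ ⊗ e_q′ is then pure.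
      -- Three such comparisons connect all four blocks, and the ratios along the paths from (0F ,
      -- 0F) are absorbed into `m`.
      assemble : (∃[ r ] ∀ k l → Blk.n 1F 0F k l ≈ r * Blk.n 0F 0F k l) →
                 (∃[ r ] ∀ k l → Blk.n 0F 1F k l ≈ r * Blk.n 0F 0F k l) →
                 (∃[ r ] ∀ k l → Blk.n 1F 1F k l ≈ r * Blk.n 1F 0F k l) → KroneckerForm
      assemble (r , n₁₀) (s , n₀₁) (t , n₁₁) = record
        { m = λ p q i j → scale p q * (Blk.a′ p q i * Blk.b′ p q j)
        ; n = Blk.n 0F 0F
        ; n₀≉0 = n≉0 (e≉0 0F) (e≉0 0F) (block 0F 0F) 0F
        ; maps = λ p q k i j l → trans (Blk.maps p q k i j l)
            (trans (*-congˡ (n-scale p q k l)) (shuffle _ _ _ _))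
        }
        where
        scale : Fin 2 → Fin 2 → Carrier
        scale 0F 0F = 1#
        scale 1F 0F = r
        scale 0F 1F = s
        scale 1F 1F = t * r

        n-scale : ∀ p q k l → Blk.n p q k l ≈ scale p q * Blk.n 0F 0F k l
        n-scale 0F 0F k l = sym (*-identityˡ _)
        n-scale 1F 0F k l = n₁₀ k l
        n-scale 0F 1F k l = n₀₁ k l
        n-scale 1F 1F k l = trans (n₁₁ k l) (trans (*-congˡ (n₁₀ k l)) (sym (*-assoc _ _ _)))

        shuffle : ∀ x y z w → x * y * (z * w) ≈ z * (x * y) * w
        shuffle x y z w = solve 4 (#0 :* #1 :* (#2 :* #3)) (#2 :* (#0 :* #1) :* #3)

      unit≉0 : 1# * 1# * 1# ≉ 0#
      unit≉0 eq = 1≉0 (trans (solve 0 :1 (:1 :* :1 :* :1)) eq)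

      assembled : KroneckerForm
      assembled = assemble
        (adjacent 0F 0F 1F 0F unit≉0 (solve 0 (:0 :* :1 :* :1) :0) unit≉0 (additive₁ e₀+e₁≉0 (e≉0
          0F)))
        (adjacent 0F 0F 0F 1F unit≉0 (solve 0 (:1 :* :0 :* :1) :0) unit≉0 (additive₂ (e≉0 0F)
          e₀+e₁≉0))
        (adjacent 1F 0F 1F 1F unit≉0 (solve 0 (:1 :* :0 :* :1) :0) unit≉0 (additive₂ (e≉0 1F)
          e₀+e₁≉0))

    kroneckerForm : KroneckerForm
    kroneckerForm = assembled λ p q → blockImage g g∈G (e p) (e q) (e≉0 p) (e≉0 q)

-- Invariants

module Invariants {c ℓ} (F : Field c ℓ) (em : ExcludedMiddle (c ⊔ ℓ)) where
  open Field F hiding (zero)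
  open FieldLemmas F
  open Moves F
  open Representatives F using (Matrix; det; _≈ᴹ_; O; mat≈)
  open Parallel F em
  open Blocks F em using (module PureTensor; pureTensor; fundamental; e≉0; expand₃; g-zero)
  open Kronecker F em
  open Tensors F 2 2 3
  open GeneralLinear {F = F} V using (GL; module GL; module Subgroup)
  open GL

  T : Tensor → (Fin 3 → Carrier) → Matrix
  T t ξ i j = ξ 0F * t (i , j , 0F) + ξ 1F * t (i , j , 1F) + ξ 2F * t (i , j , 2F)

  _⊠_ : Matrix → (Fin 3 → Carrier) → Tensor
  (X ⊠ y) (i , j , k) = X i j * y k

  det-cong : ∀ {X Y} → X ≈ᴹ Y → det X ≈ det Y
  det-cong eq = +-cong (*-cong (eq 0F 0F) (eq 1F 1F)) (-‿cong (*-cong (eq 0F 1F) (eq 1F 0F)))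

  -- Properties of the image W of T relative to the quadric det = 0. `AllSingular` and `Anisotropic`
  -- say that W lies on it or avoids it outside 0, and the third ranks bound dim W. `SingularClosed`
  -- separates a line tangent to the quadric from a secant. Two singular matrices with singular sum
  -- span a totally singular subspace, so `SingularLinesRigid` says that the section contains no
  -- projective line, which separates a smooth conic from a pair of lines.
  AllSingular Anisotropic ThirdRank≤1 ThirdRank≤2 SingularClosed SingularLinesRigid FirstRank≤1 :
    Tensor → Set (c ⊔ ℓ)
  AllSingular t = ∀ ξ → det (T t ξ) ≈ 0#
  Anisotropic t = ∀ ξ → det (T t ξ) ≈ 0# → T t ξ ≈ᴹ O
  ThirdRank≤1 t = ∃[ X ] ∃[ y ] ∀ m → t m ≈ (X ⊠ y) m
  ThirdRank≤2 t = ∃[ X ] ∃[ y ] ∃[ X′ ] ∃[ y′ ] ∀ m → t m ≈ (X ⊠ y) m + (X′ ⊠ y′) m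
  SingularClosed t = ∀ ξ η → det (T t ξ) ≈ 0# → det (T t η) ≈ 0# → det (T t (λ k → ξ k + η k)) ≈ 0#
  SingularLinesRigid t = ∀ ξ η → det (T t ξ) ≈ 0# → det (T t η) ≈ 0# →
    det (T t (λ k → ξ k + η k)) ≈ 0# →
    ∃[ α ] ∃[ β ] (α ≉ 0# ⊎ β ≉ 0#) × (∀ i j → α * T t ξ i j + β * T t η i j ≈ 0#)
  FirstRank≤1 t = ∃ λ (a : Fin 2 → Carrier) → ∃ λ (s : Fin 2 → Fin 3 → Carrier) → ∀ i j k → t (i , j , k) ≈ a i * s j k

  -- A nonzero entry X p q serves as pivot: X is its column q times its row p, divided by X p q.
  singular-factors : ∀ X → det X ≈ 0# → ¬ X ≈ᴹ O →
    ∃[ u ] ∃[ v ] Nonzero u × Nonzero v × (∀ i j → X i j ≈ u i * v j)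
  singular-factors X detX≈0 X≉O =
    let (p , q) , Xpq≉0 = nonzero (λ { (i , j) → X i j })
          (λ zeros → X≉O (mat≈ (zeros (0F , 0F)) (zeros (0F , 1F)) (zeros (1F , 0F)) (zeros (1F , 1F))))
        h , eq = inverse _ Xpq≉0
    in (λ i → X i q) , (λ j → X p j * h) , (p , Xpq≉0) , (q , λ e → 1≉0 (trans (sym eq) e)) ,
       λ i j → divide (X p q) (X i q) (X p j) (X i j) h eq (minor p q i j)
    where
    minor : ∀ p q i j → X i q * X p j ≈ X i j * X p q
    minor 0F 0F 0F j  = solve 2 (#0 :* #1) (#1 :* #0)
    minor 0F 0F 1F 0F = solve 2 (#0 :* #1) (#0 :* #1)
    minor 0F 0F 1F 1F = combine (- 1#) detX≈0
      (solve 4 (#0 :* #1 :+ :- :1 :* :0) (#2 :* #3 :+ :- :1 :* (#3 :* #2 :- #1 :* #0)))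
    minor 0F 1F 0F j  = solve 2 (#0 :* #1) (#1 :* #0)
    minor 0F 1F 1F 0F = combine 1# detX≈0
      (solve 4 (#0 :* #1 :+ :1 :* :0) (#2 :* #3 :+ :1 :* (#1 :* #0 :- #3 :* #2)))
    minor 0F 1F 1F 1F = solve 2 (#0 :* #1) (#0 :* #1)
    minor 1F 0F 0F 0F = solve 2 (#0 :* #1) (#0 :* #1)
    minor 1F 0F 0F 1F = combine 1# detX≈0
      (solve 4 (#0 :* #1 :+ :1 :* :0) (#2 :* #3 :+ :1 :* (#0 :* #1 :- #2 :* #3)))
    minor 1F 0F 1F j  = solve 2 (#0 :* #1) (#1 :* #0)
    minor 1F 1F 0F 0F = combine (- 1#) detX≈0
      (solve 4 (#0 :* #1 :+ :- :1 :* :0) (#2 :* #3 :+ :- :1 :* (#2 :* #3 :- #0 :* #1)))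
    minor 1F 1F 0F 1F = solve 2 (#0 :* #1) (#0 :* #1)
    minor 1F 1F 1F j  = solve 2 (#0 :* #1) (#1 :* #0)

    divide : ∀ pq iq pj ij h → pq * h ≈ 1# → iq * pj ≈ ij * pq → ij ≈ iq * (pj * h)
    divide pq iq pj ij h eq p = combine (- ij) eq (combine (- h) p
      (solve 5 (#0 :+ :- #0 :* :1 :+ :- #1 :* (#0 :* #2)) (#3 :* (#4 :* #1) :+ :- #0 :* (#2 :* #1)
      :+ :- #1 :* (#3 :* #4))))

  pure⇒singular : ∀ {X y k} → y k ≉ 0# → Fundamental (X ⊠ y) → det X ≈ 0#
  pure⇒singular {X} {y} {k} yk≉0 fund =
    let r , r≈ = pureTensor fund in vanish r (λ i j → r≈ (i , j , k))
    where
    open PureTensor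
    vanish : ∀ r → (∀ i j → X i j * y k ≈ u r i * v r j * w r k) → det X ≈ 0#
    vanish r eq = *≈0⇒≈0 yk≉0 (*≈0⇒≈0 yk≉0
      (combine (X 1F 1F * y k) (eq 0F 0F) (combine (u r 0F * v r 0F * w r k) (eq 1F 1F)
      (combine (- (X 1F 0F * y k)) (eq 0F 1F) (combine (- (u r 0F * v r 1F * w r k)) (eq 1F 0F)
        (solve 10 (#0 :* (#0 :* (#1 :* #2 :- #3 :* #4)) :+ #2 :* #0 :* (#5 :* #6 :* #7) :+ #5 :* #6
        :* #7 :* (#8 :* #9 :* #7) :+ :- (#4 :* #0) :* (#5 :* #9 :* #7) :+ :- (#5 :* #9 :* #7) :* (#8
        :* #6 :* #7)) (:0 :+ #2 :* #0 :* (#1 :* #0) :+ #5 :* #6 :* #7 :* (#2 :* #0) :+ :- (#4 :* #0)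
        :* (#3 :* #0) :+ :- (#5 :* #9 :* #7) :* (#4 :* #0))))))))

  singular⇒pure : ∀ {X y} → det X ≈ 0# → ¬ X ≈ᴹ O → Nonzero y → Fundamental (X ⊠ y)
  singular⇒pure {X} {y} detX≈0 X≉O y≉0 =
    let u , v , u≉0 , v≉0 , X≈ = singular-factors X detX≈0 X≉O
    in Fundamental-resp {s = pure u v y} (λ { (i , j , k) → *-congʳ (sym (X≈ i j)) })
         (fundamental u≉0 v≉0 y≉0)

  module _ (g : GL) (g∈G : Subgroup.Member G g) (form : KroneckerForm g g∈G) where
    open KroneckerForm form

    M : Matrix → Matrix
    M X i j = X 0F 0F * m 0F 0F i j + X 0F 1F * m 0F 1F i j + X 1F 0F * m 1F 0F i j + X 1F 1F * m 1F 1F i j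

    N Nᵀ : (Fin 3 → Carrier) → Fin 3 → Carrier
    N y l  = y 0F * n 0F l + y 1F * n 1F l + y 2F * n 2F l
    Nᵀ ξ k = ξ 0F * n k 0F + ξ 1F * n k 1F + ξ 2F * n k 2F

    fibre : Tensor → Fin 2 → Fin 2 → Fin 3 → Carrier
    fibre t p q k = t (p , q , k)

    maps-fibre : ∀ t p q i j l → ⟦ g ⟧ (pure (e p) (e q) (fibre t p q)) (i , j , l) ≈
                                 m p q i j * N (fibre t p q) l
    maps-fibre t p q i j l = trans (expand₃ g g∈G (e p) (e q) (fibre t p q) (i , j , l))
      (combine (t (p , q , 0F)) (maps p q 0F i j l) (combine (t (p , q , 1F)) (maps p q 1F i j l)
        (combine (t (p , q , 2F)) (maps p q 2F i j l)
          (solve 10 (#0 :* #1 :+ #2 :* #3 :+ #4 :* #5 :+ #0 :* (#6 :* #7) :+ #2 :* (#6 :* #8) :+ #4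
          :* (#6 :* #9)) (#6 :* (#0 :* #7 :+ #2 :* #8 :+ #4 :* #9) :+ #0 :* #1 :+ #2 :* #3 :+ #4 :*
          #5)))))

    expand : ∀ t i j l → ⟦ g ⟧ t (i , j , l) ≈
      m 0F 0F i j * N (fibre t 0F 0F) l + m 0F 1F i j * N (fibre t 0F 1F) l +
      m 1F 0F i j * N (fibre t 1F 0F) l + m 1F 1F i j * N (fibre t 1F 1F) l
    expand t i j l = begin
      ⟦ g ⟧ t (i , j , l)
        ≈⟨ ⟦⟧-cong g {y = λ x → part 0F 0F x + part 0F 1F x + part 1F 0F x + part 1F 1F x}
             (λ { (0F , 0F , k) → solve 4 #0 (:1 :* :1 :* #0 :+ :1 :* :0 :* #1 :+ :0 :* :1 :* #2 :+
               :0 :* :0 :* #3) ; (0F , 1F , k) → solve 4 #0 (:1 :* :0 :* #1 :+ :1 :* :1 :* #0 :+ :0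
               :* :0 :* #2 :+ :0 :* :1 :* #3)
                ; (1F , 0F , k) → solve 4 #0 (:0 :* :1 :* #1 :+ :0 :* :0 :* #2 :+ :1 :* :1 :* #0 :+
                  :1 :* :0 :* #3) ; (1F , 1F , k) → solve 4 #0 (:0 :* :0 :* #1 :+ :0 :* :1 :* #2 :+
                  :1 :* :0 :* #3 :+ :1 :* :1 :* #0) }) (i , j , l) ⟩
      ⟦ g ⟧ (λ x → part 0F 0F x + part 0F 1F x + part 1F 0F x + part 1F 1F x) (i , j , l)
        ≈⟨ +ᴹ-homo g (λ x → part 0F 0F x + part 0F 1F x + part 1F 0F x) (part 1F 1F) (i , j , l) ⟩
      ⟦ g ⟧ (λ x → part 0F 0F x + part 0F 1F x + part 1F 0F x) (i , j , l) + ⟦ g ⟧ (part 1F 1F) (i , j , l)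
        ≈⟨ +-congʳ (+ᴹ-homo g (λ x → part 0F 0F x + part 0F 1F x) (part 1F 0F) (i , j , l)) ⟩
      ⟦ g ⟧ (λ x → part 0F 0F x + part 0F 1F x) (i , j , l) + ⟦ g ⟧ (part 1F 0F) (i , j , l)
        + ⟦ g ⟧ (part 1F 1F) (i , j , l)
        ≈⟨ +-congʳ (+-congʳ (+ᴹ-homo g (part 0F 0F) (part 0F 1F) (i , j , l))) ⟩
      ⟦ g ⟧ (part 0F 0F) (i , j , l) + ⟦ g ⟧ (part 0F 1F) (i , j , l) + ⟦ g ⟧ (part 1F 0F) (i , j , l)
        + ⟦ g ⟧ (part 1F 1F) (i , j , l)
        ≈⟨ +-cong (+-cong (+-cong (maps-fibre t 0F 0F i j l) (maps-fibre t 0F 1F i j l))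
             (maps-fibre t 1F 0F i j l)) (maps-fibre t 1F 1F i j l) ⟩
      m 0F 0F i j * N (fibre t 0F 0F) l + m 0F 1F i j * N (fibre t 0F 1F) l +
      m 1F 0F i j * N (fibre t 1F 0F) l + m 1F 1F i j * N (fibre t 1F 1F) l ∎
      where
      open import Relation.Binary.Reasoning.Setoid setoid
      part : Fin 2 → Fin 2 → Tensor
      part p q = pure (e p) (e q) (fibre t p q)

    maps-⊠ : ∀ X y x → ⟦ g ⟧ (X ⊠ y) x ≈ (M X ⊠ N y) x
    maps-⊠ X y (i , j , l) = trans (expand (X ⊠ y) i j l)
      (solve 14 (#0 :* (#1 :* #2 :* #3 :+ #1 :* #4 :* #5 :+ #1 :* #6 :* #7) :+ #8 :* (#9 :* #2 :* #3
      :+ #9 :* #4 :* #5 :+ #9 :* #6 :* #7) :+ #10 :* (#11 :* #2 :* #3 :+ #11 :* #4 :* #5 :+ #11 :*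
      #6 :* #7) :+ #12 :* (#13 :* #2 :* #3 :+ #13 :* #4 :* #5 :+ #13 :* #6 :* #7)) ((#1 :* #0 :+ #9
      :* #8 :+ #11 :* #10 :+ #13 :* #12) :* (#2 :* #3 :+ #4 :* #5 :+ #6 :* #7)))

    M-cong : ∀ {X Y} → X ≈ᴹ Y → M X ≈ᴹ M Y
    M-cong eq i j = +-cong (+-cong (+-cong (*-congʳ (eq 0F 0F)) (*-congʳ (eq 0F 1F)))
      (*-congʳ (eq 1F 0F))) (*-congʳ (eq 1F 1F))

    adjoint : ∀ t ξ p q → let y = N (fibre t p q) in
      ξ 0F * y 0F + ξ 1F * y 1F + ξ 2F * y 2F ≈ T t (Nᵀ ξ) p q
    adjoint t ξ p q = solve 15 (#0 :* (#1 :* #2 :+ #3 :* #4 :+ #5 :* #6) :+ #7 :* (#1 :* #8 :+ #3 :*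
      #9 :+ #5 :* #10) :+ #11 :* (#1 :* #12 :+ #3 :* #13 :+ #5 :* #14)) ((#0 :* #2 :+ #7 :* #8 :+
      #11 :* #12) :* #1 :+ (#0 :* #4 :+ #7 :* #9 :+ #11 :* #13) :* #3 :+ (#0 :* #6 :+ #7 :* #10 :+
      #11 :* #14) :* #5)

    -- Moving N to the argument as its transpose makes the image of g t the set of M-images of
    -- contractions of t, so invariants of W need only be compared under M.
    T-image : ∀ t ξ → T (⟦ g ⟧ t) ξ ≈ᴹ M (T t (Nᵀ ξ))
    T-image t ξ i j = trans
      (collect (m 0F 0F i j) (m 0F 1F i j) (m 1F 0F i j) (m 1F 1F i j) (y 0F 0F) (y 0F 1F) (y 1F 0F) (y 1F 1F)
        (expand t i j))
      (+-cong (+-cong (+-cong (*-comm-adjoint 0F 0F) (*-comm-adjoint 0F 1F)) (*-comm-adjoint 1F 0F))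
        (*-comm-adjoint 1F 1F))
      where
      y : Fin 2 → Fin 2 → Fin 3 → Carrier
      y p q = N (fibre t p q)

      *-comm-adjoint : ∀ p q → m p q i j * (ξ 0F * y p q 0F + ξ 1F * y p q 1F + ξ 2F * y p q 2F) ≈
                               T t (Nᵀ ξ) p q * m p q i j
      *-comm-adjoint p q = trans (*-comm _ _) (*-congʳ (adjoint t ξ p q))

      collect : ∀ {x : Fin 3 → Carrier} a b c d (u v w z : Fin 3 → Carrier) →
        (∀ l → x l ≈ a * u l + b * v l + c * w l + d * z l) →
        ξ 0F * x 0F + ξ 1F * x 1F + ξ 2F * x 2F ≈
        a * (ξ 0F * u 0F + ξ 1F * u 1F + ξ 2F * u 2F) + b * (ξ 0F * v 0F + ξ 1F * v 1F + ξ 2F * v 2F) +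
        c * (ξ 0F * w 0F + ξ 1F * w 1F + ξ 2F * w 2F) + d * (ξ 0F * z 0F + ξ 1F * z 1F + ξ 2F * z 2F)
      collect a b c d u v w z eq = trans
        (+-cong (+-cong (*-congˡ (eq 0F)) (*-congˡ (eq 1F))) (*-congˡ (eq 2F)))
          (solve 19 (#0 :* (#1 :* #2 :+ #3 :* #4 :+ #5 :* #6 :+ #7 :* #8) :+ #9 :* (#1 :* #10 :+ #3
          :* #11 :+ #5 :* #12 :+ #7 :* #13) :+ #14 :* (#1 :* #15 :+ #3 :* #16 :+ #5 :* #17 :+ #7 :*
          #18)) (#1 :* (#0 :* #2 :+ #9 :* #10 :+ #14 :* #15) :+ #3 :* (#0 :* #4 :+ #9 :* #11 :+ #14
          :* #16) :+ #5 :* (#0 :* #6 :+ #9 :* #12 :+ #14 :* #17) :+ #7 :* (#0 :* #8 :+ #9 :* #13 :+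
          #14 :* #18)))

    M-zero : ∀ {X} → X ≈ᴹ O → M X ≈ᴹ O
    M-zero {X} eq = mat≈ (vanish 0F 0F) (vanish 0F 1F) (vanish 1F 0F) (vanish 1F 1F)
      where
      vanish : ∀ i j → M X i j ≈ 0#
      vanish i j = combine (m 0F 0F i j) (eq 0F 0F) (combine (m 0F 1F i j) (eq 0F 1F)
        (combine (m 1F 0F i j) (eq 1F 0F) (combine (m 1F 1F i j) (eq 1F 1F)
          (solve 8 (#0 :* #1 :+ #2 :* #3 :+ #4 :* #5 :+ #6 :* #7 :+ #1 :* :0 :+ #3 :* :0 :+ #5 :* :0
          :+ #7 :* :0) (:0 :+ #1 :* #0 :+ #3 :* #2 :+ #5 :* #4 :+ #7 :* #6)))))

    M-injective : ∀ {X} → M X ≈ᴹ O → X ≈ᴹ O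
    M-injective {X} MX≈O = mat≈ (vanish 0F 0F) (vanish 0F 1F) (vanish 1F 0F) (vanish 1F 1F)
      where
      entry : ∀ i j → M X i j ≈ 0#
      entry 0F 0F = MX≈O 0F 0F
      entry 0F 1F = MX≈O 0F 1F
      entry 1F 0F = MX≈O 1F 0F
      entry 1F 1F = MX≈O 1F 1F

      vanish : ∀ i j → X i j ≈ 0#
      vanish i j = trans (sym (*-identityʳ _)) (g-zero g g∈G {X ⊠ e 0F}
        (λ { (i , j , l) → trans (maps-⊠ X (e 0F) (i , j , l)) (trans (*-congʳ (entry i j)) (zeroˡ _)) })
        (i , j , 0F))

    zero? : ∀ X → Dec (X ≈ᴹ O)
    zero? X = map′ lower lift (em {Lift c (X ≈ᴹ O)})

    det-zero : ∀ {X} → X ≈ᴹ O → det X ≈ 0#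
    det-zero eq = trans (det-cong eq) (solve 0 (:0 :* :0 :- :0 :* :0) :0)

    N-e₀ : ∀ l → N (e 0F) l ≈ n 0F l
    N-e₀ l = solve 3 (:1 :* #0 :+ :0 :* #1 :+ :0 :* #2) #0

    N-e₀≉0 : Nonzero (N (e 0F))
    N-e₀≉0 = let l , nl≉0 = n₀≉0 in l , λ eq → nl≉0 (trans (sym (N-e₀ l)) eq)

    -- For nonzero X, singularity means that X ⊗ e₀ is pure; g keeps it pure, and its image is M X ⊗
    -- N e₀ with N e₀ ≠ 0.
    M-singular : ∀ X → det X ≈ 0# → det (M X) ≈ 0#
    M-singular X detX≈0 with zero? X
    ... | yes X≈O = det-zero {M X} (M-zero {X} X≈O)
    ... | no X≉O = pure⇒singular {M X} {N (e 0F)} (proj₂ N-e₀≉0)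
      (Fundamental-resp (maps-⊠ X (e 0F)) (Equivalence.to (g∈G (X ⊠ e 0F))
        (singular⇒pure {X} {e 0F} detX≈0 X≉O (e≉0 0F))))

    M-singular⁻¹ : ∀ X → det (M X) ≈ 0# → det X ≈ 0#
    M-singular⁻¹ X detMX≈0 with zero? (M X)
    ... | yes MX≈O = det-zero {X} (M-injective {X} MX≈O)
    ... | no MX≉O = pure⇒singular {X} {e 0F} {0F} 1≉0 (Equivalence.from (g∈G (X ⊠ e 0F))
      (Fundamental-resp (λ x → sym (maps-⊠ X (e 0F) x))
        (singular⇒pure {M X} {N (e 0F)} detMX≈0 MX≉O N-e₀≉0)))

    module _ {t t′ : Tensor} (gt≈t′ : ∀ x → ⟦ g ⟧ t x ≈ t′ x) where

      T-cong : ∀ ξ → T (⟦ g ⟧ t) ξ ≈ᴹ T t′ ξ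
      T-cong ξ i j = +-cong (+-cong (*-congˡ (gt≈t′ (i , j , 0F))) (*-congˡ (gt≈t′ (i , j , 1F))))
        (*-congˡ (gt≈t′ (i , j , 2F)))

      T-maps : ∀ ξ → T t′ ξ ≈ᴹ M (T t (Nᵀ ξ))
      T-maps ξ i j = trans (sym (T-cong ξ i j)) (T-image t ξ i j)

      Nᵀ-+ : ∀ ξ η → T t′ (λ k → ξ k + η k) ≈ᴹ M (T t (λ k → Nᵀ ξ k + Nᵀ η k))
      Nᵀ-+ ξ η i j = trans (T-maps (λ k → ξ k + η k) i j)
        (M-cong {T t (Nᵀ (λ k → ξ k + η k))} {T t (λ k → Nᵀ ξ k + Nᵀ η k)}
          (λ p q → +-cong (+-cong (*-congʳ (additive 0F)) (*-congʳ (additive 1F))) (*-congʳ (additive 2F))) i j)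
        where
        additive : ∀ k → Nᵀ (λ l → ξ l + η l) k ≈ Nᵀ ξ k + Nᵀ η k
        additive k = solve 9 ((#0 :+ #1) :* #2 :+ (#3 :+ #4) :* #5 :+ (#6 :+ #7) :* #8) (#0 :* #2 :+
          #3 :* #5 :+ #6 :* #8 :+ (#1 :* #2 :+ #4 :* #5 :+ #7 :* #8))

      det-from : ∀ ξ X → T t′ ξ ≈ᴹ M X → det X ≈ 0# → det (T t′ ξ) ≈ 0#
      det-from ξ X eq detX≈0 = trans (det-cong {T t′ ξ} {M X} eq) (M-singular X detX≈0)

      det-to : ∀ ξ X → T t′ ξ ≈ᴹ M X → det (T t′ ξ) ≈ 0# → det X ≈ 0#
      det-to ξ X eq det≈0 = M-singular⁻¹ X (trans (sym (det-cong {T t′ ξ} {M X} eq)) det≈0)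

      allSingular : AllSingular t → AllSingular t′
      allSingular all ξ = det-from ξ (T t (Nᵀ ξ)) (T-maps ξ) (all (Nᵀ ξ))

      anisotropic : Anisotropic t → Anisotropic t′
      anisotropic aniso ξ det≈0 i j =
        trans (T-maps ξ i j) (M-zero (aniso (Nᵀ ξ) (det-to ξ (T t (Nᵀ ξ)) (T-maps ξ) det≈0)) i j)

      thirdRank≤1 : ThirdRank≤1 t → ThirdRank≤1 t′
      thirdRank≤1 (X , y , eq) = M X , N y , λ x → trans (sym (gt≈t′ x))
        (trans (⟦⟧-cong g eq x) (maps-⊠ X y x))

      thirdRank≤2 : ThirdRank≤2 t → ThirdRank≤2 t′
      thirdRank≤2 (X , y , X′ , y′ , eq) = M X , N y , M X′ , N y′ , λ x → trans (sym (gt≈t′ x))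
        (trans (⟦⟧-cong g eq x) (trans (+ᴹ-homo g (X ⊠ y) (X′ ⊠ y′) x)
          (+-cong (maps-⊠ X y x) (maps-⊠ X′ y′ x))))

      singularClosed : SingularClosed t → SingularClosed t′
      singularClosed closed ξ η p q = det-from (λ k → ξ k + η k) (T t (λ k → Nᵀ ξ k + Nᵀ η k)) (Nᵀ-+ ξ η)
        (closed (Nᵀ ξ) (Nᵀ η) (det-to ξ (T t (Nᵀ ξ)) (T-maps ξ) p) (det-to η (T t (Nᵀ η)) (T-maps η) q))

      singularLinesRigid : SingularLinesRigid t → SingularLinesRigid t′
      singularLinesRigid rigid ξ η p q r =
        let α , β , ≉0 , eq = rigid (Nᵀ ξ) (Nᵀ η) (det-to ξ (T t (Nᵀ ξ)) (T-maps ξ) p) (det-to η (T t (Nᵀ η)) (T-maps η) q)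
              (det-to (λ k → ξ k + η k) (T t (λ k → Nᵀ ξ k + Nᵀ η k)) (Nᵀ-+ ξ η) r)
        in α , β , ≉0 , λ i j → trans (+-cong (*-congˡ (T-maps ξ i j)) (*-congˡ (T-maps η i j)))
             (linear α β (T t (Nᵀ ξ)) (T t (Nᵀ η)) eq i j)
        where
        linear : ∀ α β X Y → (∀ i j → α * X i j + β * Y i j ≈ 0#) →
                 ∀ i j → α * M X i j + β * M Y i j ≈ 0#
        linear α β X Y eq i j = combine (m 0F 0F i j) (eq 0F 0F) (combine (m 0F 1F i j) (eq 0F 1F)
          (combine (m 1F 0F i j) (eq 1F 0F) (combine (m 1F 1F i j) (eq 1F 1F)
            (solve 14 (#0 :* (#1 :* #2 :+ #3 :* #4 :+ #5 :* #6 :+ #7 :* #8) :+ #9 :* (#10 :* #2 :+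
            #11 :* #4 :+ #12 :* #6 :+ #13 :* #8) :+ #2 :* :0 :+ #4 :* :0 :+ #6 :* :0 :+ #8 :* :0)
            (:0 :+ #2 :* (#0 :* #1 :+ #9 :* #10) :+ #4 :* (#0 :* #3 :+ #9 :* #11) :+ #6 :* (#0 :* #5
            :+ #9 :* #12) :+ #8 :* (#0 :* #7 :+ #9 :* #13))))))

-- Separation of the representatives

module Separation {c ℓ} (F : Field c ℓ) (em : ExcludedMiddle (c ⊔ ℓ)) where
  open Field F hiding (zero)
  open FieldLemmas F
  open Moves F
  open Representatives F
  open Classification F em using (_≈0?)
  open Quadratic F using (square≈0)
  open Invariants F em
  open Kronecker F em using (kroneckerForm)
  open Tensors F 2 2 3
  open GeneralLinear {F = F} V using (GL; module GL; module Subgroup)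
  open GL

  infix 4 _~ᴳ_
  _~ᴳ_ : Tensor → Tensor → Set (c ⊔ ℓ)
  _~ᴳ_ = Setoid._≈_ (Subgroup.orbits G)

  ~ᴳ-sym : ∀ {s t} → s ~ᴳ t → t ~ᴳ s
  ~ᴳ-sym {s} {t} = Setoid.sym (Subgroup.orbits G) {s} {t}

  ~⇒~ᴳ : ∀ {s t} → s ~ t → s ~ᴳ t
  ~⇒~ᴳ (sameOrbit (g , g∈H , eq)) = g , H⊆G {g} g∈H , eq

  G-Invariant : (Tensor → Set (c ⊔ ℓ)) → Set (c ⊔ ℓ)
  G-Invariant P = ∀ {s t} → s ~ᴳ t → P s → P t

  allSingular-invariant : G-Invariant AllSingular
  allSingular-invariant {s} {t} (g , g∈G , eq) =
    allSingular g g∈G (kroneckerForm g g∈G) {s} {t} eq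

  anisotropic-invariant : G-Invariant Anisotropic
  anisotropic-invariant {s} {t} (g , g∈G , eq) =
    anisotropic g g∈G (kroneckerForm g g∈G) {s} {t} eq

  thirdRank≤1-invariant : G-Invariant ThirdRank≤1
  thirdRank≤1-invariant {s} {t} (g , g∈G , eq) =
    thirdRank≤1 g g∈G (kroneckerForm g g∈G) {s} {t} eq

  thirdRank≤2-invariant : G-Invariant ThirdRank≤2
  thirdRank≤2-invariant {s} {t} (g , g∈G , eq) =
    thirdRank≤2 g g∈G (kroneckerForm g g∈G) {s} {t} eq

  singularClosed-invariant : G-Invariant SingularClosed
  singularClosed-invariant {s} {t} (g , g∈G , eq) =
    singularClosed g g∈G (kroneckerForm g g∈G) {s} {t} eq

  singularLinesRigid-invariant : G-Invariant SingularLinesRigid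
  singularLinesRigid-invariant {s} {t} (g , g∈G , eq) =
    singularLinesRigid g g∈G (kroneckerForm g g∈G) {s} {t} eq

  decide : Set (c ⊔ ℓ) → Bool
  decide P = does (em {P})

  decide-true : ∀ {P} → P → decide P ≡ true
  decide-true = dec-true em

  decide-false : ∀ {P} → ¬ P → decide P ≡ false
  decide-false = dec-false em

  decide-cong : ∀ {P Q} → (P → Q) → (Q → P) → decide P ≡ decide Q
  decide-cong {P} {Q} f g with em {P}
  ... | yes p = ≡.sym (decide-true (f p))
  ... | no ¬p = ≡.sym (decide-false (¬p ∘ g))

  -- Transport in one direction suffices because the orbit relation is symmetric.
  decide-invariant : ∀ {P} → G-Invariant P → ∀ {s t} → s ~ᴳ t → decide (P s) ≡ decide (P t)
  decide-invariant {P} inv {s} {t} s~t =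
    decide-cong (inv {s} {t} s~t) (inv {t} {s} (~ᴳ-sym {s} {t} s~t))

  -- h decides FirstRank≤1, the only invariant here that G does not preserve.
  tree : (a b c₁ c₂ e f h : Bool) → Fin 10
  tree true  true  _     _     _     _     _     = 0F
  tree true  false true  _     _     _     _     = 1F
  tree true  false false _     _     _     true  = 3F
  tree true  false false _     _     _     false = 9F
  tree false true  true  _     _     _     _     = 2F
  tree false true  false _     _     _     _     = 8F
  tree false false _     true  true  _     _     = 5F
  tree false false _     true  false _     _     = 4F
  tree false false _     false _     true  _     = 7F
  tree false false _     false _     false _     = 6F

  -- The Boolean is a parameter so that one code serves both groups: the decision of `FirstRank≤1`
  -- for H, the constant `true` for G.
  code : Bool → Tensor → Fin 10
  code h t = tree (decide (AllSingular t)) (decide (Anisotropic t)) (decide (ThirdRank≤1 t))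
    (decide (ThirdRank≤2 t)) (decide (SingularClosed t)) (decide (SingularLinesRigid t)) h

  tree-cong : ∀ {a a′ b b′ c₁ c₁′ c₂ c₂′ e e′ f f′ h h′} → a ≡ a′ → b ≡ b′ → c₁ ≡ c₁′ →
              c₂ ≡ c₂′ → e ≡ e′ → f ≡ f′ → h ≡ h′ → tree a b c₁ c₂ e f h ≡ tree a′ b′ c₁′ c₂′ e′ f′ h′
  tree-cong ≡.refl ≡.refl ≡.refl ≡.refl ≡.refl ≡.refl ≡.refl = ≡.refl

  code-invariant : ∀ h {s t} → s ~ᴳ t → code h s ≡ code h t
  code-invariant h {s} {t} s~t = tree-cong
    (decide-invariant {AllSingular} allSingular-invariant {s} {t} s~t)
    (decide-invariant {Anisotropic} anisotropic-invariant {s} {t} s~t)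
    (decide-invariant {ThirdRank≤1} thirdRank≤1-invariant {s} {t} s~t)
    (decide-invariant {ThirdRank≤2} thirdRank≤2-invariant {s} {t} s~t)
    (decide-invariant {SingularClosed} singularClosed-invariant {s} {t} s~t)
    (decide-invariant {SingularLinesRigid} singularLinesRigid-invariant {s} {t} s~t)
    ≡.refl

  -- Expanding a ⊗ s along the second factor gives pure tensors with the common first factor a,
  -- which an induced map sends to g₁ a.
  ~-firstRank≤1 : ∀ {s t} → s ~ t → FirstRank≤1 s → FirstRank≤1 t
  ~-firstRank≤1 {s} {t} (sameOrbit (g , (g₁ , g₂ , g₃ , induces) , gs≈t)) (a , r , s≈) =
    GL₁.GL.⟦ g₁ ⟧ a , r′ , λ i j k → trans (sym (gs≈t (i , j , k)))
      (trans (⟦⟧-cong g {y = λ x → pure a (e 0F) (r 0F) x + pure a (e 1F) (r 1F) x}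
        (λ { (i , 0F , k) → trans (s≈ i 0F k)
          (solve 3 (#0 :* #1) (#0 :* :1 :* #1 :+ #0 :* :0 :* #2)) ; (i , 1F , k) → trans (s≈ i 1F k)
          (solve 3 (#0 :* #1) (#0 :* :0 :* #2 :+ #0 :* :1 :* #1)) }) (i , j , k))
      (trans (+ᴹ-homo g (pure a (e 0F) (r 0F)) (pure a (e 1F) (r 1F)) (i , j , k))
      (trans (+-cong (induces a (e 0F) (r 0F) (i , j , k)) (induces a (e 1F) (r 1F) (i , j , k)))
        (solve 5 (#0 :* #1 :* #2 :+ #0 :* #3 :* #4) (#0 :* (#1 :* #2 :+ #3 :* #4))))))
    where
    r′ : Fin 2 → Fin 3 → Carrier
    r′ j k = GL₂.GL.⟦ g₂ ⟧ (e 0F) j * GL₃.GL.⟦ g₃ ⟧ (r 0F) k + GL₂.GL.⟦ g₂ ⟧ (e 1F) j * GL₃.GL.⟦ g₃ ⟧ (r 1F) k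

  -- A matrix of rank at most one has zero minors: (x y)(x′ y′) = (x y′)(x′ y).
  minor-obstruction : ∀ {x y x′ y′} → 1# ≈ x * y → 1# ≈ x′ * y′ → 0# ≈ x * y′ → ⊥
  minor-obstruction {x} {y} {x′} {y′} p q r =
    1≉0 (combine 1# p (combine (x * y) q (combine (- (x′ * y)) r
      (solve 4 (:1 :+ :1 :* (#0 :* #1) :+ #0 :* #1 :* (#2 :* #3) :+ :- (#2 :* #1) :* (#0 :* #3)) (:0
      :+ :1 :* :1 :+ #0 :* #1 :* :1 :+ :- (#2 :* #1) :* :0)))))

  -- The determinant of a sum of two 3 × 3 matrices of rank one vanishes identically.
  identity-obstruction : ∀ (X X′ y y′ : Fin 3 → Carrier) →
    (∀ i k → e i k ≈ X i * y k + X′ i * y′ k) → ⊥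
  identity-obstruction X X′ y y′ eq = 1≉0 (begin
    1#                                                       ≈⟨ solve 0 :1 (:1 :* (:1 :* :1 :- :0 :*
      :0) :- :0 :* (:0 :* :1 :- :0 :* :0) :+ :0 :* (:0 :* :0 :- :1 :* :0)) ⟩
    det₃ (δ 0F 0F) (δ 0F 1F) (δ 0F 2F) (δ 1F 0F) (δ 1F 1F) (δ 1F 2F) (δ 2F 0F) (δ 2F 1F) (δ 2F 2F)
      ≈⟨ +-cong (+-cong (*-cong (eq 0F 0F) (minor 1F 2F)) (-‿cong (*-cong (eq 0F 1F) (minor 0F 2F))))
           (*-cong (eq 0F 2F) (minor 0F 1F)) ⟩
    det₃ (q 0F 0F) (q 0F 1F) (q 0F 2F) (q 1F 0F) (q 1F 1F) (q 1F 2F) (q 2F 0F) (q 2F 1F) (q 2F 2F)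
      ≈⟨ solve 12 ((#0 :* #1 :+ #2 :* #3) :* ((#4 :* #5 :+ #6 :* #7) :* (#8 :* #9 :+ #10 :* #11) :-
        (#4 :* #9 :+ #6 :* #11) :* (#8 :* #5 :+ #10 :* #7)) :- (#0 :* #5 :+ #2 :* #7) :* ((#4 :* #1
        :+ #6 :* #3) :* (#8 :* #9 :+ #10 :* #11) :- (#4 :* #9 :+ #6 :* #11) :* (#8 :* #1 :+ #10 :*
        #3)) :+ (#0 :* #9 :+ #2 :* #11) :* ((#4 :* #1 :+ #6 :* #3) :* (#8 :* #5 :+ #10 :* #7) :- (#4
        :* #5 :+ #6 :* #7) :* (#8 :* #1 :+ #10 :* #3))) :0 ⟩
    0# ∎)
    where
    open import Relation.Binary.Reasoning.Setoid setoid
    δ q : Fin 3 → Fin 3 → Carrier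
    δ = e
    q i k = X i * y k + X′ i * y′ k
    minor : ∀ k l → det₂ (δ 1F k) (δ 1F l) (δ 2F k) (δ 2F l) ≈ det₂ (q 1F k) (q 1F l) (q 2F k) (q 2F l)
    minor k l = +-cong (*-cong (eq 1F k) (eq 2F l)) (-‿cong (*-cong (eq 1F l) (eq 2F k)))

  module _ (b : Carrier) where

    R : Fin 10 → Tensor
    R = rep b

    allSingular₀ : AllSingular (R 0F)
    allSingular₀ ξ = solve 3 ((#0 :* :0 :+ #1 :* :0 :+ #2 :* :0) :* (#0 :* :0 :+ #1 :* :0 :+ #2 :*
      :0) :- (#0 :* :0 :+ #1 :* :0 :+ #2 :* :0) :* (#0 :* :0 :+ #1 :* :0 :+ #2 :* :0)) :0
    allSingular₁ : AllSingular (R 1F)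
    allSingular₁ ξ = solve 3 ((#0 :* :0 :+ #1 :* :0 :+ #2 :* :0) :* (#0 :* :1 :+ #1 :* :0 :+ #2 :*
      :0) :- (#0 :* :0 :+ #1 :* :0 :+ #2 :* :0) :* (#0 :* :0 :+ #1 :* :0 :+ #2 :* :0)) :0
    allSingular₃ : AllSingular (R 3F)
    allSingular₃ ξ = solve 3 ((#0 :* :0 :+ #1 :* :0 :+ #2 :* :0) :* (#0 :* :1 :+ #1 :* :0 :+ #2 :*
      :0) :- (#0 :* :0 :+ #1 :* :0 :+ #2 :* :0) :* (#0 :* :0 :+ #1 :* :0 :+ #2 :* :1)) :0
    allSingular₉ : AllSingular (R 9F)
    allSingular₉ ξ = solve 3 ((#0 :* :0 :+ #1 :* :0 :+ #2 :* :0) :* (#0 :* :1 :+ #1 :* :0 :+ #2 :*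
      :0) :- (#0 :* :0 :+ #1 :* :0 :+ #2 :* :1) :* (#0 :* :0 :+ #1 :* :0 :+ #2 :* :0)) :0

    e₀+e₂ : Fin 3 → Carrier
    e₀+e₂ k = e 0F k + e 2F k

    ¬allSingular₂ : ¬ AllSingular (R 2F)
    ¬allSingular₂ all = 1≉0 (trans (solve 0 :1 ((:0 :* :0 :+ :1 :* :1 :+ :0 :* :0) :* (:0 :* :0 :+
      :1 :* :1 :+ :0 :* :0) :- (:0 :* :0 :+ :1 :* :0 :+ :0 :* :0) :* (:0 :* :0 :+ :1 :* :0 :+ :0 :*
      :0))) (all (e 1F)))
    ¬allSingular₄ : ¬ AllSingular (R 4F)
    ¬allSingular₄ all = 1≉0 (trans (solve 0 :1 (((:1 :+ :0) :* :0 :+ (:0 :+ :0) :* :0 :+ (:0 :+ :1)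
      :* :1) :* ((:1 :+ :0) :* :1 :+ (:0 :+ :0) :* :0 :+ (:0 :+ :1) :* :0) :- ((:1 :+ :0) :* :0 :+
      (:0 :+ :0) :* :0 :+ (:0 :+ :1) :* :0) :* ((:1 :+ :0) :* :0 :+ (:0 :+ :0) :* :0 :+ (:0 :+ :1)
      :* :0))) (all e₀+e₂))
    ¬allSingular₅ : ¬ AllSingular (R 5F)
    ¬allSingular₅ all = 1≉0 (combine (- 1#) (all (e 2F))
      (solve 0 (:1 :+ :- :1 :* :0) (:0 :+ :- :1 :* ((:0 :* :0 :+ :0 :* :0 :+ :1 :* :0) :* (:0 :* :1
      :+ :0 :* :0 :+ :1 :* :0) :- (:0 :* :0 :+ :0 :* :0 :+ :1 :* :1) :* (:0 :* :0 :+ :0 :* :0 :+ :1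
      :* :1)))))
    ¬allSingular₆ : ¬ AllSingular (R 6F)
    ¬allSingular₆ all = 1≉0 (trans (solve 0 :1 (((:1 :+ :0) :* :0 :+ (:0 :+ :0) :* :0 :+ (:0 :+ :1)
      :* :1) :* ((:1 :+ :0) :* :1 :+ (:0 :+ :0) :* :0 :+ (:0 :+ :1) :* :0) :- ((:1 :+ :0) :* :0 :+
      (:0 :+ :0) :* :1 :+ (:0 :+ :1) :* :0) :* ((:1 :+ :0) :* :0 :+ (:0 :+ :0) :* :0 :+ (:0 :+ :1)
      :* :0))) (all e₀+e₂))
    ¬allSingular₇ : ¬ AllSingular (R 7F)
    ¬allSingular₇ all = 1≉0 (trans (solve 0 :1 (((:1 :+ :0) :* :0 :+ (:0 :+ :0) :* :0 :+ (:0 :+ :1)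
      :* :1) :* ((:1 :+ :0) :* :1 :+ (:0 :+ :0) :* :0 :+ (:0 :+ :1) :* :0) :- ((:1 :+ :0) :* :0 :+
      (:0 :+ :0) :* :1 :+ (:0 :+ :1) :* :0) :* ((:1 :+ :0) :* :0 :+ (:0 :+ :0) :* :1 :+ (:0 :+ :1)
      :* :0))) (all e₀+e₂))
    ¬allSingular₈ : ¬ AllSingular (R 8F)
    ¬allSingular₈ all = 1≉0 (trans (solve 1 :1 ((:0 :* :0 :+ :1 :* :1 :+ :0 :* :0) :* (:0 :* :0 :+
      :1 :* :1 :+ :0 :* :1) :- (:0 :* :0 :+ :1 :* :0 :+ :0 :* #0) :* (:0 :* :0 :+ :1 :* :0 :+ :0 :*
      :1))) (all (e 1F)))

    E₂₂-isotropic : ∀ {Y Z} → ¬ Anisotropic (slices E₂₂ Y Z)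
    E₂₂-isotropic {Y} {Z} aniso = 1≉0 (trans (solve 2 :1 (:1 :* :1 :+ :0 :* #0 :+ :0 :* #1)) (aniso
      (e 0F) (solve 8 ((:1 :* :0 :+ :0 :* #0 :+ :0 :* #1) :* (:1 :* :1 :+ :0 :* #2 :+ :0 :* #3) :-
      (:1 :* :0 :+ :0 :* #4 :+ :0 :* #5) :* (:1 :* :0 :+ :0 :* #6 :+ :0 :* #7)) :0) 1F 1F))

    anisotropic₀ : Anisotropic (R 0F)
    anisotropic₀ ξ _ = mat≈ (solve 3 (#0 :* :0 :+ #1 :* :0 :+ #2 :* :0) :0)
      (solve 3 (#0 :* :0 :+ #1 :* :0 :+ #2 :* :0) :0)
      (solve 3 (#0 :* :0 :+ #1 :* :0 :+ #2 :* :0) :0)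
      (solve 3 (#0 :* :0 :+ #1 :* :0 :+ #2 :* :0) :0)

    anisotropic₂ : Anisotropic (R 2F)
    anisotropic₂ ξ det≈0 = mat≈ (combine 1# ξ₁≈0
      (solve 3 (#0 :* :0 :+ #1 :* :1 :+ #2 :* :0 :+ :1 :* :0) (:0 :+ :1 :* #1)))
      (solve 3 (#0 :* :0 :+ #1 :* :0 :+ #2 :* :0) :0)
      (solve 3 (#0 :* :0 :+ #1 :* :0 :+ #2 :* :0) :0) (combine 1# ξ₁≈0
      (solve 3 (#0 :* :0 :+ #1 :* :1 :+ #2 :* :0 :+ :1 :* :0) (:0 :+ :1 :* #1)))
      where
      ξ₁≈0 : ξ 1F ≈ 0#
      ξ₁≈0 = square≈0 _≈0? (combine 1# det≈0
        (solve 3 (#0 :* #0 :+ :1 :* :0) (:0 :+ :1 :* ((#1 :* :0 :+ #0 :* :1 :+ #2 :* :0) :* (#1 :*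
        :0 :+ #0 :* :1 :+ #2 :* :0) :- (#1 :* :0 :+ #0 :* :0 :+ #2 :* :0) :* (#1 :* :0 :+ #0 :* :0
        :+ #2 :* :0)))))

    -- The determinant is ξ₁² + ξ₁ξ₂ - b ξ₂². If it vanishes with ξ₂ ≠ 0, then ξ₁/ξ₂ is a root; for
    -- ξ₂ = 0 it is ξ₁².
    anisotropic₈ : (∀ x → x * x + x ≉ b) → Anisotropic (R 8F)
    anisotropic₈ irr ξ det≈0 = mat≈ (combine 1# ξ₁≈0
      (solve 3 (#0 :* :0 :+ #1 :* :1 :+ #2 :* :0 :+ :1 :* :0) (:0 :+ :1 :* #1))) (combine b ξ₂≈0
      (solve 4 (#0 :* :0 :+ #1 :* :0 :+ #2 :* #3 :+ #3 :* :0) (:0 :+ #3 :* #2)))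
      (combine 1# ξ₂≈0 (solve 3 (#0 :* :0 :+ #1 :* :0 :+ #2 :* :1 :+ :1 :* :0) (:0 :+ :1 :* #2)))
        (combine 1# ξ₁≈0 (combine 1# ξ₂≈0
        (solve 3 (#0 :* :0 :+ #1 :* :1 :+ #2 :* :1 :+ :1 :* :0 :+ :1 :* :0) (:0 :+ :1 :* #1 :+ :1 :*
        #2))))
      where
      root : ∀ h → ξ 2F * h ≈ 1# → ξ 1F * h * (ξ 1F * h) + ξ 1F * h ≈ b
      root h eq = combine (h * h) det≈0 (combine (b * (1# + ξ 2F * h) - ξ 1F * h) eq
        (solve 5 (#0 :* #1 :* (#0 :* #1) :+ #0 :* #1 :+ #1 :* #1 :* :0 :+ (#2 :* (:1 :+ #3 :* #1) :-
        #0 :* #1) :* :1) (#2 :+ #1 :* #1 :* ((#4 :* :0 :+ #0 :* :1 :+ #3 :* :0) :* (#4 :* :0 :+ #0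
        :* :1 :+ #3 :* :1) :- (#4 :* :0 :+ #0 :* :0 :+ #3 :* #2) :* (#4 :* :0 :+ #0 :* :0 :+ #3 :*
        :1)) :+ (#2 :* (:1 :+ #3 :* #1) :- #0 :* #1) :* (#3 :* #1))))

      ξ₂≈0 : ξ 2F ≈ 0#
      ξ₂≈0 with ξ 2F ≈0?
      ... | yes ≈0 = ≈0
      ... | no ≉0 = let h , eq = inverse (ξ 2F) ≉0 in ⊥-elim (irr (ξ 1F * h) (root h eq))

      ξ₁≈0 : ξ 1F ≈ 0#
      ξ₁≈0 = square≈0 _≈0? (combine 1# det≈0 (combine (b * ξ 2F - ξ 1F) ξ₂≈0
        (solve 4 (#0 :* #0 :+ :1 :* :0 :+ (#1 :* #2 :- #0) :* :0) (:0 :+ :1 :* ((#3 :* :0 :+ #0 :*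
        :1 :+ #2 :* :0) :* (#3 :* :0 :+ #0 :* :1 :+ #2 :* :1) :- (#3 :* :0 :+ #0 :* :0 :+ #2 :* #1)
        :* (#3 :* :0 :+ #0 :* :0 :+ #2 :* :1)) :+ (#1 :* #2 :- #0) :* #2))))

    thirdRank≤1₁ : ThirdRank≤1 (R 1F)
    thirdRank≤1₁ = E₂₂ , e 0F , slices≈
      (mat≈ (solve 0 :0 (:0 :* :1)) (solve 0 :0 (:0 :* :1)) (solve 0 :0 (:0 :* :1))
        (solve 0 :1 (:1 :* :1))) (mat≈ (solve 0 :0 (:0 :* :0)) (solve 0 :0 (:0 :* :0))
        (solve 0 :0 (:0 :* :0)) (solve 0 :0 (:1 :* :0))) (mat≈ (solve 0 :0 (:0 :* :0))
        (solve 0 :0 (:0 :* :0)) (solve 0 :0 (:0 :* :0)) (solve 0 :0 (:1 :* :0)))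
    thirdRank≤1₂ : ThirdRank≤1 (R 2F)
    thirdRank≤1₂ = I , e 1F , slices≈
      (mat≈ (solve 0 :0 (:1 :* :0)) (solve 0 :0 (:0 :* :0)) (solve 0 :0 (:0 :* :0))
        (solve 0 :0 (:1 :* :0))) (mat≈ (solve 0 :1 (:1 :* :1)) (solve 0 :0 (:0 :* :1))
        (solve 0 :0 (:0 :* :1)) (solve 0 :1 (:1 :* :1))) (mat≈ (solve 0 :0 (:1 :* :0))
        (solve 0 :0 (:0 :* :0)) (solve 0 :0 (:0 :* :0)) (solve 0 :0 (:1 :* :0)))

    ¬thirdRank≤1₃ : ¬ ThirdRank≤1 (R 3F)
    ¬thirdRank≤1₃ (X , y , eq) = minor-obstruction (eq (1F , 1F , 0F)) (eq (1F , 0F , 2F)) (eq (1F , 1F , 2F))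
    ¬thirdRank≤1₉ : ¬ ThirdRank≤1 (R 9F)
    ¬thirdRank≤1₉ (X , y , eq) = minor-obstruction (eq (1F , 1F , 0F)) (eq (0F , 1F , 2F)) (eq (1F , 1F , 2F))
    ¬thirdRank≤1₈ : ¬ ThirdRank≤1 (R 8F)
    ¬thirdRank≤1₈ (X , y , eq) = minor-obstruction (eq (0F , 0F , 1F)) (eq (1F , 0F , 2F)) (eq (0F , 0F , 2F))

    thirdRank≤2₄ : ThirdRank≤2 (R 4F)
    thirdRank≤2₄ = E₂₂ , e 0F , E₁₁ , e 2F , slices≈
      (mat≈ (solve 0 :0 (:0 :* :1 :+ :1 :* :0)) (solve 0 :0 (:0 :* :1 :+ :0 :* :0))
        (solve 0 :0 (:0 :* :1 :+ :0 :* :0)) (solve 0 :1 (:1 :* :1 :+ :0 :* :0))) (mat≈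
        (solve 0 :0 (:0 :* :0 :+ :1 :* :0)) (solve 0 :0 (:0 :* :0 :+ :0 :* :0))
        (solve 0 :0 (:0 :* :0 :+ :0 :* :0)) (solve 0 :0 (:1 :* :0 :+ :0 :* :0))) (mat≈
        (solve 0 :1 (:0 :* :0 :+ :1 :* :1)) (solve 0 :0 (:0 :* :0 :+ :0 :* :1))
        (solve 0 :0 (:0 :* :0 :+ :0 :* :1)) (solve 0 :0 (:1 :* :0 :+ :0 :* :1)))
    thirdRank≤2₅ : ThirdRank≤2 (R 5F)
    thirdRank≤2₅ = E₂₂ , e 0F , mat 0# 1# 1# 0# , e 2F , slices≈
      (mat≈ (solve 0 :0 (:0 :* :1 :+ :0 :* :0)) (solve 0 :0 (:0 :* :1 :+ :1 :* :0))
        (solve 0 :0 (:0 :* :1 :+ :1 :* :0)) (solve 0 :1 (:1 :* :1 :+ :0 :* :0))) (mat≈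
        (solve 0 :0 (:0 :* :0 :+ :0 :* :0)) (solve 0 :0 (:0 :* :0 :+ :1 :* :0))
        (solve 0 :0 (:0 :* :0 :+ :1 :* :0)) (solve 0 :0 (:1 :* :0 :+ :0 :* :0))) (mat≈
        (solve 0 :0 (:0 :* :0 :+ :0 :* :1)) (solve 0 :1 (:0 :* :0 :+ :1 :* :1))
        (solve 0 :1 (:0 :* :0 :+ :1 :* :1)) (solve 0 :0 (:1 :* :0 :+ :0 :* :1)))

    -- Read in this order, three entries of the slices E₂₂, E₁₂ + z E₂₁, E₁₁ form the identity
    -- matrix. The fourth entry, which holds z, is left out, so indices `6F` and `7F` are treated
    -- together.
    row : Matrix → Fin 3 → Carrier
    row X 0F = X 1F 1F
    row X 1F = X 0F 1F
    row X 2F = X 0F 0F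

    ¬thirdRank≤2 : ∀ z → ¬ ThirdRank≤2 (slices E₂₂ (mat 0# 1# z 0#) E₁₁)
    ¬thirdRank≤2 z (X , y , X′ , y′ , eq) = identity-obstruction (row X) (row X′) y y′ λ
      { 0F 0F → eq (1F , 1F , 0F) ; 0F 1F → eq (1F , 1F , 1F) ; 0F 2F → eq (1F , 1F , 2F)
      ; 1F 0F → eq (0F , 1F , 0F) ; 1F 1F → eq (0F , 1F , 1F) ; 1F 2F → eq (0F , 1F , 2F)
      ; 2F 0F → eq (0F , 0F , 0F) ; 2F 1F → eq (0F , 0F , 1F) ; 2F 2F → eq (0F , 0F , 2F) }

    -- The determinant is -ξ₂², so the singular locus is the subspace ξ₂ = 0.
    singularClosed₅ : SingularClosed (R 5F)
    singularClosed₅ ξ η p q = combine (- (ξ 2F + η 2F)) (ξ₂≈0 ξ p)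
      (combine (- (ξ 2F + η 2F)) (ξ₂≈0 η q)
        (solve 6 (((#0 :+ #1) :* :0 :+ (#2 :+ #3) :* :0 :+ (#4 :+ #5) :* :0) :* ((#0 :+ #1) :* :1 :+
        (#2 :+ #3) :* :0 :+ (#4 :+ #5) :* :0) :- ((#0 :+ #1) :* :0 :+ (#2 :+ #3) :* :0 :+ (#4 :+ #5)
        :* :1) :* ((#0 :+ #1) :* :0 :+ (#2 :+ #3) :* :0 :+ (#4 :+ #5) :* :1) :+ :- (#4 :+ #5) :* :0
        :+ :- (#4 :+ #5) :* :0) (:0 :+ :- (#4 :+ #5) :* #4 :+ :- (#4 :+ #5) :* #5)))
      where
      ξ₂≈0 : ∀ ξ → det (T (R 5F) ξ) ≈ 0# → ξ 2F ≈ 0#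
      ξ₂≈0 ξ eq = square≈0 _≈0? (combine (- 1#) eq
        (solve 3 (#0 :* #0 :+ :- :1 :* :0) (:0 :+ :- :1 :* ((#1 :* :0 :+ #2 :* :0 :+ #0 :* :0) :*
        (#1 :* :1 :+ #2 :* :0 :+ #0 :* :0) :- (#1 :* :0 :+ #2 :* :0 :+ #0 :* :1) :* (#1 :* :0 :+ #2
        :* :0 :+ #0 :* :1)))))

    ¬singularClosed₄ : ¬ SingularClosed (R 4F)
    ¬singularClosed₄ closed = 1≉0 (trans
      (solve 0 :1 (((:1 :+ :0) :* :0 :+ (:0 :+ :0) :* :0 :+ (:0 :+ :1) :* :1) :* ((:1 :+ :0) :* :1
      :+ (:0 :+ :0) :* :0 :+ (:0 :+ :1) :* :0) :- ((:1 :+ :0) :* :0 :+ (:0 :+ :0) :* :0 :+ (:0 :+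
      :1) :* :0) :* ((:1 :+ :0) :* :0 :+ (:0 :+ :0) :* :0 :+ (:0 :+ :1) :* :0))) (closed (e 0F) (e
      2F) (solve 0 ((:1 :* :0 :+ :0 :* :0 :+ :0 :* :1) :* (:1 :* :1 :+ :0 :* :0 :+ :0 :* :0) :- (:1
      :* :0 :+ :0 :* :0 :+ :0 :* :0) :* (:1 :* :0 :+ :0 :* :0 :+ :0 :* :0)) :0)
      (solve 0 ((:0 :* :0 :+ :0 :* :0 :+ :1 :* :1) :* (:0 :* :1 :+ :0 :* :0 :+ :1 :* :0) :- (:0 :*
      :0 :+ :0 :* :0 :+ :1 :* :0) :* (:0 :* :0 :+ :0 :* :0 :+ :1 :* :0)) :0)))

    -- The independent matrices E₁₂ and E₁₁ span a totally singular plane.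
    ¬singularLinesRigid₆ : ¬ SingularLinesRigid (R 6F)
    ¬singularLinesRigid₆ rigid with rigid (e 1F) (e 2F)
      (solve 0 ((:0 :* :0 :+ :1 :* :0 :+ :0 :* :1) :* (:0 :* :1 :+ :1 :* :0 :+ :0 :* :0) :- (:0 :*
      :0 :+ :1 :* :1 :+ :0 :* :0) :* (:0 :* :0 :+ :1 :* :0 :+ :0 :* :0)) :0)
      (solve 0 ((:0 :* :0 :+ :0 :* :0 :+ :1 :* :1) :* (:0 :* :1 :+ :0 :* :0 :+ :1 :* :0) :- (:0 :*
      :0 :+ :0 :* :1 :+ :1 :* :0) :* (:0 :* :0 :+ :0 :* :0 :+ :1 :* :0)) :0)
      (solve 0 (((:0 :+ :0) :* :0 :+ (:1 :+ :0) :* :0 :+ (:0 :+ :1) :* :1) :* ((:0 :+ :0) :* :1 :+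
      (:1 :+ :0) :* :0 :+ (:0 :+ :1) :* :0) :- ((:0 :+ :0) :* :0 :+ (:1 :+ :0) :* :1 :+ (:0 :+ :1)
      :* :0) :* ((:0 :+ :0) :* :0 :+ (:1 :+ :0) :* :0 :+ (:0 :+ :1) :* :0)) :0)
    ... | α , β , inj₁ α≉0 , eq = α≉0 (combine 1# (eq 0F 1F)
      (solve 2 (#0 :+ :1 :* :0) (:0 :+ :1 :* (#0 :* (:0 :* :0 :+ :1 :* :1 :+ :0 :* :0) :+ #1 :* (:0
      :* :0 :+ :0 :* :1 :+ :1 :* :0)))))
    ... | α , β , inj₂ β≉0 , eq = β≉0 (combine 1# (eq 0F 0F)
      (solve 2 (#0 :+ :1 :* :0) (:0 :+ :1 :* (#1 :* (:0 :* :0 :+ :1 :* :0 :+ :0 :* :1) :+ #0 :* (:0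
      :* :0 :+ :0 :* :0 :+ :1 :* :1)))))

    -- For two points of the conic, its equation at their sum is the polar relation x₀y₂ + x₂y₀ =
    -- 2x₁y₁. It makes the square of each minor zero; for instance (x₀y₁ - x₁y₀)² = x₀y₀(x₀y₂ + x₂y₀
    -- - 2x₁y₁) + x₀²(y₁² - y₀y₂) + y₀²(x₁² - x₀x₂), by an identity that holds in every
    -- characteristic once the first two terms are expanded.
    conic-minors : ∀ x₀ x₁ x₂ y₀ y₁ y₂ → x₀ * x₂ ≈ x₁ * x₁ → y₀ * y₂ ≈ y₁ * y₁ →
      (x₀ + y₀) * (x₂ + y₂) ≈ (x₁ + y₁) * (x₁ + y₁) →
      x₀ * y₁ - x₁ * y₀ ≈ 0# × x₁ * y₂ - x₂ * y₁ ≈ 0# × x₀ * y₂ - x₂ * y₀ ≈ 0#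
    conic-minors x₀ x₁ x₂ y₀ y₁ y₂ p q r =
      square≈0 _≈0? (combine (- (x₀ * x₀)) q (combine (- (y₀ * y₀)) p
        (combine (x₀ * y₀) polar (solve 6 ((#0 :* #1 :- #2 :* #3) :* (#0 :* #1 :- #2 :* #3) :+ :-
          (#0 :* #0) :* (#1 :* #1) :+ :- (#3 :* #3) :* (#2 :* #2) :+ #0 :* #3 :* (#2 :* #1 :+ #2 :*
          #1)) (:0 :+ :- (#0 :* #0) :* (#3 :* #4) :+ :- (#3 :* #3) :* (#0 :* #5) :+ #0 :* #3 :* (#0
          :* #4 :+ #5 :* #3)))))) ,
      square≈0 _≈0? (combine (- (x₂ * x₂)) q (combine (- (y₂ * y₂)) p
        (combine (x₂ * y₂) polar (solve 6 ((#0 :* #1 :- #2 :* #3) :* (#0 :* #1 :- #2 :* #3) :+ :-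
          (#2 :* #2) :* (#3 :* #3) :+ :- (#1 :* #1) :* (#0 :* #0) :+ #2 :* #1 :* (#0 :* #3 :+ #0 :*
          #3)) (:0 :+ :- (#2 :* #2) :* (#4 :* #1) :+ :- (#1 :* #1) :* (#5 :* #2) :+ #2 :* #1 :* (#5
          :* #1 :+ #2 :* #4)))))) ,
      square≈0 _≈0? (combine (x₀ * y₂ + x₂ * y₀ + (x₁ * y₁ + x₁ * y₁)) polar
        (combine (- ((1# + 1# + 1# + 1#) * y₀ * y₂)) p
          (combine (- ((1# + 1# + 1# + 1#) * x₁ * x₁)) q
            (solve 6 ((#0 :* #1 :- #2 :* #3) :* (#0 :* #1 :- #2 :* #3) :+ (#0 :* #1 :+ #2 :* #3 :+
            (#4 :* #5 :+ #4 :* #5)) :* (#4 :* #5 :+ #4 :* #5) :+ :- ((:1 :+ :1 :+ :1 :+ :1) :* #3 :*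
            #1) :* (#4 :* #4) :+ :- ((:1 :+ :1 :+ :1 :+ :1) :* #4 :* #4) :* (#5 :* #5)) (:0 :+ (#0
            :* #1 :+ #2 :* #3 :+ (#4 :* #5 :+ #4 :* #5)) :* (#0 :* #1 :+ #2 :* #3) :+ :- ((:1 :+ :1
            :+ :1 :+ :1) :* #3 :* #1) :* (#0 :* #2) :+ :- ((:1 :+ :1 :+ :1 :+ :1) :* #4 :* #4) :*
            (#3 :* #1))))))
      where
      polar : x₀ * y₂ + x₂ * y₀ ≈ x₁ * y₁ + x₁ * y₁
      polar = combine 1# r (combine (- 1#) p (combine (- 1#) q
        (solve 6 (#0 :* #1 :+ #2 :* #3 :+ :1 :* ((#4 :+ #5) :* (#4 :+ #5)) :+ :- :1 :* (#4 :* #4) :+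
        :- :1 :* (#5 :* #5)) (#4 :* #5 :+ #4 :* #5 :+ :1 :* ((#0 :+ #3) :* (#2 :+ #1)) :+ :- :1 :*
        (#0 :* #2) :+ :- :1 :* (#3 :* #1)))))

    singularLinesRigid₇ : SingularLinesRigid (R 7F)
    singularLinesRigid₇ ξ η p q r = dependence
      (conic-minors (ξ 0F) (ξ 1F) (ξ 2F) (η 0F) (η 1F) (η 2F)
        (combine 1# p (solve 3 (#0 :* #1 :+ :1 :* :0) (#2 :* #2 :+ :1 :* ((#0 :* :0 :+ #2 :* :0 :+
          #1 :* :1) :* (#0 :* :1 :+ #2 :* :0 :+ #1 :* :0) :- (#0 :* :0 :+ #2 :* :1 :+ #1 :* :0) :*
          (#0 :* :0 :+ #2 :* :1 :+ #1 :* :0))))) (combine 1# q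
          (solve 3 (#0 :* #1 :+ :1 :* :0) (#2 :* #2 :+ :1 :* ((#0 :* :0 :+ #2 :* :0 :+ #1 :* :1) :*
          (#0 :* :1 :+ #2 :* :0 :+ #1 :* :0) :- (#0 :* :0 :+ #2 :* :1 :+ #1 :* :0) :* (#0 :* :0 :+
          #2 :* :1 :+ #1 :* :0))))) (combine 1# r
          (solve 6 ((#0 :+ #1) :* (#2 :+ #3) :+ :1 :* :0) ((#4 :+ #5) :* (#4 :+ #5) :+ :1 :* (((#0
          :+ #1) :* :0 :+ (#4 :+ #5) :* :0 :+ (#2 :+ #3) :* :1) :* ((#0 :+ #1) :* :1 :+ (#4 :+ #5)
          :* :0 :+ (#2 :+ #3) :* :0) :- ((#0 :+ #1) :* :0 :+ (#4 :+ #5) :* :1 :+ (#2 :+ #3) :* :0)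
          :* ((#0 :+ #1) :* :0 :+ (#4 :+ #5) :* :1 :+ (#2 :+ #3) :* :0))))))
      where
      dependent : ∀ {α β} → (∀ k → α * ξ k + β * η k ≈ 0#) →
                  ∀ i j → α * T (R 7F) ξ i j + β * T (R 7F) η i j ≈ 0#
      dependent eq 0F 0F = combine 1# (eq 2F)
        (solve 8 (#0 :* (#1 :* :0 :+ #2 :* :0 :+ #3 :* :1) :+ #4 :* (#5 :* :0 :+ #6 :* :0 :+ #7 :*
        :1) :+ :1 :* :0) (:0 :+ :1 :* (#0 :* #3 :+ #4 :* #7)))
      dependent eq 0F 1F = combine 1# (eq 1F)
        (solve 8 (#0 :* (#1 :* :0 :+ #2 :* :1 :+ #3 :* :0) :+ #4 :* (#5 :* :0 :+ #6 :* :1 :+ #7 :*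
        :0) :+ :1 :* :0) (:0 :+ :1 :* (#0 :* #2 :+ #4 :* #6)))
      dependent eq 1F 0F = combine 1# (eq 1F)
        (solve 8 (#0 :* (#1 :* :0 :+ #2 :* :1 :+ #3 :* :0) :+ #4 :* (#5 :* :0 :+ #6 :* :1 :+ #7 :*
        :0) :+ :1 :* :0) (:0 :+ :1 :* (#0 :* #2 :+ #4 :* #6)))
      dependent eq 1F 1F = combine 1# (eq 0F)
        (solve 8 (#0 :* (#1 :* :1 :+ #2 :* :0 :+ #3 :* :0) :+ #4 :* (#5 :* :1 :+ #6 :* :0 :+ #7 :*
        :0) :+ :1 :* :0) (:0 :+ :1 :* (#0 :* #1 :+ #4 :* #5)))

      dependence : ξ 0F * η 1F - ξ 1F * η 0F ≈ 0# × ξ 1F * η 2F - ξ 2F * η 1F ≈ 0# ×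
        ξ 0F * η 2F - ξ 2F * η 0F ≈ 0# → ∃[ α ] ∃[ β ] (α ≉ 0# ⊎ β ≉ 0#) ×
        (∀ i j → α * T (R 7F) ξ i j + β * T (R 7F) η i j ≈ 0#)
      dependence (m₀₁ , m₁₂ , m₀₂) with η 0F ≈0? | η 1F ≈0? | η 2F ≈0?
      ... | no η₀≉0 | _ | _ = η 0F , - ξ 0F , inj₁ η₀≉0 , dependent λ
        { 0F → solve 2 (#0 :* #1 :+ :- #1 :* #0) :0 ; 1F → combine (- 1#) m₀₁
          (solve 4 (#0 :* #1 :+ :- #2 :* #3 :+ :- :1 :* :0) (:0 :+ :- :1 :* (#2 :* #3 :- #1 :* #0)))
          ; 2F → combine (- 1#) m₀₂ (solve 4 (#0 :* #1 :+ :- #2 :* #3 :+ :- :1 :* :0) (:0 :+ :- :1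
          :* (#2 :* #3 :- #1 :* #0))) }
      ... | yes _ | no η₁≉0 | _ = η 1F , - ξ 1F , inj₁ η₁≉0 , dependent λ
        { 0F → combine 1# m₀₁ (solve 4 (#0 :* #1 :+ :- #2 :* #3 :+ :1 :* :0) (:0 :+ :1 :* (#1 :* #0
          :- #2 :* #3))) ; 1F → solve 2 (#0 :* #1 :+ :- #1 :* #0) :0 ; 2F → combine (- 1#) m₁₂
          (solve 4 (#0 :* #1 :+ :- #2 :* #3 :+ :- :1 :* :0) (:0 :+ :- :1 :* (#2 :* #3 :- #1 :* #0)))
          }
      ... | yes _ | yes _ | no η₂≉0 = η 2F , - ξ 2F , inj₁ η₂≉0 , dependent λ
        { 0F → combine 1# m₀₂ (solve 4 (#0 :* #1 :+ :- #2 :* #3 :+ :1 :* :0) (:0 :+ :1 :* (#1 :* #0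
          :- #2 :* #3))) ; 1F → combine 1# m₁₂
          (solve 4 (#0 :* #1 :+ :- #2 :* #3 :+ :1 :* :0) (:0 :+ :1 :* (#1 :* #0 :- #2 :* #3))) ; 2F
          → solve 2 (#0 :* #1 :+ :- #1 :* #0) :0 }
      -- For η = 0 the relation is 0 · ξ + 1 · η; otherwise a nonzero coordinate of η is the
      -- coefficient of ξ.
      ... | yes η₀≈0 | yes η₁≈0 | yes η₂≈0 = 0# , 1# , inj₂ 1≉0 , dependent λ
        { 0F → combine 1# η₀≈0 (solve 2 (:0 :* #0 :+ :1 :* #1 :+ :1 :* :0) (:0 :+ :1 :* #1)) ; 1F →
          combine 1# η₁≈0 (solve 2 (:0 :* #0 :+ :1 :* #1 :+ :1 :* :0) (:0 :+ :1 :* #1)) ; 2F →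
          combine 1# η₂≈0 (solve 2 (:0 :* #0 :+ :1 :* #1 :+ :1 :* :0) (:0 :+ :1 :* #1)) }

    firstRank≤1₃ : FirstRank≤1 (R 3F)
    firstRank≤1₃ = e 1F , (λ j k → R 3F (1F , j , k)) , λ
      { 0F 0F 0F → solve 0 :0 (:0 :* :0) ; 0F 0F 1F → solve 0 :0 (:0 :* :0) ; 0F 0F 2F → solve 0 :0
        (:0 :* :1)
      ; 0F 1F 0F → solve 0 :0 (:0 :* :1) ; 0F 1F 1F → solve 0 :0 (:0 :* :0) ; 0F 1F 2F → solve 0 :0
        (:0 :* :0)
      ; 1F j k → sym (*-identityˡ _) }

    ¬firstRank≤1₉ : ¬ FirstRank≤1 (R 9F)
    ¬firstRank≤1₉ (a , s , eq) = minor-obstruction (eq 0F 1F 2F) (eq 1F 1F 0F) (eq 0F 1F 0F)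

-- Counting orbits

module OrbitCount {c ℓ} (F : Field c ℓ) (em : ExcludedMiddle (c ⊔ ℓ)) where
  open Field F hiding (zero)
  open FieldLemmas F
  open Moves F
  open Representatives F
  open NormalForms F em
  open Nonsplit F em
  open Invariants F em
  open Separation F em
  open Tensors F 2 2 3
  open GeneralLinear {F = F} V using (GL; module GL; module Subgroup)

  module _ (b : Carrier) where

    -- The hypotheses are conditional on `n`, so that the same evaluation serves both groups and
    -- both kinds of fields.
    code-rep : ∀ h n → (n ≡ 3F → h ≡ true) → (n ≡ 9F → h ≡ false) →
               (n ≡ 8F → ∀ x → x * x + x ≉ b) → code h (rep b n) ≡ n
    code-rep h 0F _ _ _ = tree-cong (decide-true (allSingular₀ b)) (decide-true (anisotropic₀ b))
      ≡.refl ≡.refl ≡.refl ≡.refl ≡.refl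
    code-rep h 1F _ _ _ = tree-cong (decide-true (allSingular₁ b))
      (decide-false (E₂₂-isotropic b {O} {O})) (decide-true (thirdRank≤1₁ b)) ≡.refl ≡.refl ≡.refl
      ≡.refl
    code-rep h 2F _ _ _ = tree-cong (decide-false (¬allSingular₂ b)) (decide-true (anisotropic₂ b))
      (decide-true (thirdRank≤1₂ b)) ≡.refl ≡.refl ≡.refl ≡.refl
    code-rep h 3F h≡true _ _ = tree-cong (decide-true (allSingular₃ b))
      (decide-false (E₂₂-isotropic b {O} {E₂₁})) (decide-false (¬thirdRank≤1₃ b)) ≡.refl ≡.refl
      ≡.refl (h≡true ≡.refl)
    code-rep h 4F _ _ _ = tree-cong (decide-false (¬allSingular₄ b))
      (decide-false (E₂₂-isotropic b {O} {E₁₁})) ≡.refl (decide-true (thirdRank≤2₄ b))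
      (decide-false (¬singularClosed₄ b)) ≡.refl ≡.refl
    code-rep h 5F _ _ _ = tree-cong (decide-false (¬allSingular₅ b))
      (decide-false (E₂₂-isotropic b {O} {mat 0# 1# 1# 0#})) ≡.refl (decide-true (thirdRank≤2₅ b))
      (decide-true (singularClosed₅ b)) ≡.refl ≡.refl
    code-rep h 6F _ _ _ = tree-cong (decide-false (¬allSingular₆ b))
      (decide-false (E₂₂-isotropic b {E₁₂} {E₁₁})) ≡.refl (decide-false (¬thirdRank≤2 b 0#)) ≡.refl
      (decide-false (¬singularLinesRigid₆ b)) ≡.refl
    code-rep h 7F _ _ _ = tree-cong (decide-false (¬allSingular₇ b))
      (decide-false (E₂₂-isotropic b {mat 0# 1# 1# 0#} {E₁₁})) ≡.refl
      (decide-false (¬thirdRank≤2 b 1#)) ≡.refl (decide-true (singularLinesRigid₇ b)) ≡.refl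
    code-rep h 8F _ _ irr = tree-cong (decide-false (¬allSingular₈ b))
      (decide-true (anisotropic₈ b (irr ≡.refl))) (decide-false (¬thirdRank≤1₈ b)) ≡.refl ≡.refl
      ≡.refl ≡.refl
    code-rep h 9F _ h≡false _ = tree-cong (decide-true (allSingular₉ b))
      (decide-false (E₂₂-isotropic b {O} {E₁₂})) (decide-false (¬thirdRank≤1₉ b)) ≡.refl ≡.refl
      ≡.refl (h≡false ≡.refl)

    codeᴴ : Tensor → Fin 10
    codeᴴ t = code (decide (FirstRank≤1 t)) t

    codeᴴ-invariant : ∀ {s t} → s ~ t → codeᴴ s ≡ codeᴴ t
    codeᴴ-invariant {s} {t} s~t = ≡.trans
      (≡.cong (λ h → code h s) (decide-cong (~-firstRank≤1 s~t) (~-firstRank≤1 (~-sym s~t))))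
      (code-invariant (decide (FirstRank≤1 t)) {s} {t} (~⇒~ᴳ s~t))

    transposition : GL
    transposition = linearGL Index swap swap
      (λ { eq (i , j , k) → eq (j , i , k) }) (λ { eq (i , j , k) → eq (j , i , k) })
      (λ _ _ _ → refl) (λ _ _ _ → refl) (λ _ _ → refl) (λ _ _ → refl)
      where
      swap : Tensor → Tensor
      swap t (i , j , k) = t (j , i , k)

    transposition∈G : Subgroup.Member G transposition
    transposition∈G t = mk⇔
      (λ { (u , v , w , u≉0 , v≉0 , w≉0 , eq) → v , u , w , v≉0 , u≉0 , w≉0 ,
        λ { (i , j , k) → trans (eq (j , i , k)) (*-congʳ (*-comm _ _)) } })
      (λ { (u , v , w , u≉0 , v≉0 , w≉0 , eq) → v , u , w , v≉0 , u≉0 , w≉0 ,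
        λ { (i , j , k) → trans (eq (j , i , k)) (*-congʳ (*-comm _ _)) } })

    rep₉~ᴳrep₃ : rep b 9F ~ᴳ rep b 3F
    rep₉~ᴳrep₃ = transposition , transposition∈G , slices≈
      (mat≈ refl refl refl refl) (mat≈ refl refl refl refl) (mat≈ refl refl refl refl)

    ~ᴳ-trans : ∀ {s t u} → s ~ᴳ t → t ~ᴳ u → s ~ᴳ u
    ~ᴳ-trans {s} {t} {u} = Setoid.trans (Subgroup.orbits G) {s} {t} {u}

    module _ {N} (ι : Fin N → Fin 10) (ι-injective : ∀ i j → ι i ≡ ι j → i ≡ j)
             (irr : ∀ n → ι n ≡ 8F → ∀ x → x * x + x ≉ b) where

      -- The map ι lists the representatives in use. The code recovers ι n from the orbit, which
      -- gives injectivity; surjectivity is the classification.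
      count-H : (∀ t → ∃[ n ] t ~ rep b (ι n)) → NumberOfOrbits H N
      count-H covers = record
        { to = rep b ∘ ι
        ; cong = λ { ≡.refl → inOrbit ~-refl }
        ; bijective =
          (λ {i} {j} i~j → ι-injective i j (≡.trans (≡.sym (codeᴴ-rep i))
            (≡.trans (codeᴴ-invariant (sameOrbit i~j)) (codeᴴ-rep j)))) ,
          λ t → proj₁ (covers t) , λ { ≡.refl → inOrbit (~-sym (proj₂ (covers t))) }
        }
        where
        codeᴴ-rep : ∀ n → codeᴴ (rep b (ι n)) ≡ ι n
        codeᴴ-rep n = code-rep (decide (FirstRank≤1 (rep b (ι n)))) (ι n)
          (λ n≡3 → ≡.subst (λ m → decide (FirstRank≤1 (rep b m)) ≡ true) (≡.sym n≡3)
            (decide-true (firstRank≤1₃ b)))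
          (λ n≡9 → ≡.subst (λ m → decide (FirstRank≤1 (rep b m)) ≡ false) (≡.sym n≡9)
            (decide-false (¬firstRank≤1₉ b)))
          (irr n)

      count-G : (∀ n → ι n ≢ 9F) → (∀ t → ∃[ n ] t ~ᴳ rep b (ι n)) → NumberOfOrbits G N
      count-G no-9 covers = record
        { to = rep b ∘ ι
        ; cong = λ { {i} ≡.refl → ~⇒~ᴳ {rep b (ι i)} ~-refl }
        ; bijective =
          (λ {i} {j} i~j → ι-injective i j (≡.trans (≡.sym (codeᴳ-rep i))
            (≡.trans (code-invariant true {rep b (ι i)} {rep b (ι j)} i~j) (codeᴳ-rep j)))) ,
          λ t → proj₁ (covers t) ,
            λ { ≡.refl → ~ᴳ-sym {t} {rep b (ι (proj₁ (covers t)))} (proj₂ (covers t)) }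
        }
        where
        codeᴳ-rep : ∀ n → code true (rep b (ι n)) ≡ ι n
        codeᴳ-rep n = code-rep true (ι n) (λ _ → ≡.refl) (⊥-elim ∘ no-9 n) (irr n)

    -- Index `9F` is replaced by `3F`. The implication about `8F` allows the closed case to omit
    -- that index as well.
    merge : ∀ {t} n → t ~ rep b n → ∃[ m ] m ≢ 9F × (m ≡ 8F → n ≡ 8F) × t ~ᴳ rep b m
    merge {t} n t~ with n ≟ 9F
    ... | yes ≡.refl = 3F , (λ ()) , (λ ()) , ~ᴳ-trans {t} {rep b 9F} {rep b 3F} (~⇒~ᴳ t~) rep₉~ᴳrep₃
    ... | no n≢9 = n , n≢9 , id , ~⇒~ᴳ t~

  -- The image of `punchIn i` consists of all indices other than i.
  skip : ∀ {n} (i : Fin (ℕ.suc n)) (P : Fin (ℕ.suc n) → Set (c ⊔ ℓ)) → ∃[ j ] j ≢ i × P j → ∃[ j ] P (punchIn i j)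
  skip i P (j , j≢i , p) =
    punchOut (j≢i ∘ ≡.sym) , ≡.subst P (≡.sym (punchIn-punchOut (j≢i ∘ ≡.sym))) p

  module NonclosedCount (quadratics : UniqueQuadraticExtension F) where
    open UniqueQuadraticExtension quadratics

    orbits-H : NumberOfOrbits H 10
    orbits-H = count-H b₀ id (λ _ _ → id) (λ _ _ → irreducible) (classification-all quadratics)

    orbits-G : NumberOfOrbits G 9
    orbits-G = count-G b₀ (punchIn 9F) (λ i j → punchIn-injective 9F i j) (λ _ _ → irreducible)
      (punchInᵢ≢i 9F)
      λ t → let n , t~ = classification-all quadratics t ; m , m≢9 , _ , t~ᴳ = merge b₀ n t~ in
        skip 9F (λ m → t ~ᴳ rep b₀ m) (m , m≢9 , t~ᴳ)

  module ClosedCount (closed : IsAlgebraicallyClosed F) where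

    -- The parameter `0#` is a default: b enters `rep b` only at `8F`, which `Split` excludes.
    split : ∀ t → Split 0# t
    split = classification-closed closed 0#

    orbits-H : NumberOfOrbits H 9
    orbits-H = count-H 0# (punchIn 8F) (λ i j → punchIn-injective 8F i j)
      (λ n → ⊥-elim ∘ punchInᵢ≢i 8F n) (λ t → skip 8F (λ n → t ~ rep 0# n) (split t))

    orbits-G : NumberOfOrbits G 8
    -- The inner `8F` lives in `Fin 9`; as `punchIn 9F` preserves it, the indices omitted from
    -- `Fin 10` are `8F` and `9F`.
    orbits-G = count-G 0# (punchIn 9F ∘ punchIn 8F)
      (λ i j → punchIn-injective 8F i j ∘ punchIn-injective 9F (punchIn 8F i) (punchIn 8F j))
      (λ n eq → ⊥-elim (punchInᵢ≢i 8F n (punchIn-injective 9F (punchIn 8F n) 8F eq)))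
      (λ n → punchInᵢ≢i 9F (punchIn 8F n))
      λ t → let n , n≢8 , t~ = split t ; m , m≢9 , m≡8⇒n≡8 , t~ᴳ = merge 0# n t~
                k , k≢8 , t~ᴳ′ = skip 9F (λ m → m ≢ 8F × t ~ᴳ rep 0# m) (m , m≢9 , n≢8 ∘ m≡8⇒n≡8 , t~ᴳ)
        in skip 8F (λ k → t ~ᴳ rep 0# (punchIn 9F k)) (k , k≢8 ∘ ≡.cong (punchIn 9F) , t~ᴳ′)

theorem3p10 : ∀ {c ℓ o : Level} → ExcludedMiddle (c ⊔ ℓ ⊔ o) →
    (F : Field c ℓ) →
    let open Tensors F 2 2 3 in
    ((IsFiniteField F ⊎ IsRealField F o) → NumberOfOrbits H 10 × NumberOfOrbits G 9)
    ×
    (IsAlgebraicallyClosed F → NumberOfOrbits H 9 × NumberOfOrbits G 8)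
theorem3p10 {c} {ℓ} {o} lem F =
  (λ finite-or-real →
    let open NonclosedCount (quadratics finite-or-real) in orbits-H , orbits-G) ,
  (λ closed → let open ClosedCount closed in orbits-H , orbits-G)
  where
  em : ExcludedMiddle (c ⊔ ℓ)
  em {P} = map′ lower lift (lem {Lift o P})

  open OrbitCount F em

  quadratics : IsFiniteField F ⊎ IsRealField F o → UniqueQuadraticExtension F
  quadratics (inj₁ (q , card)) = Finite.uniqueQuadraticExtension F q card
  quadratics (inj₂ real)       = Real.uniqueQuadraticExtension F (Classification._≈0? F em) real
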